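{- Let $\mathcal{G}$ be a minor-closed class of simple graphs which does not contain all graphs. (1) There is a function $f:\mathbb{N}\to\mathbb{N}$ (depending on $\mathcal{G}$) such that for every digraph $D$ whose simple underlying graph (obtained by ignoring orientations and identifying parallel edges) belongs to $\mathcal{G}$, we have $\tau(D)\le f({\rm adi}(D))$. (2) There is a constant $C>0$ (depending on $\mathcal{G}$) such that for every graph $G$ whose simplification (obtained by identifying parallel edges) belongs to $\mathcal{G}$, we have $\tau(G)\le C\cdot {\rm ava}(G)^2\log({\rm ava}(G))$.
   Context: Graphs are finite, loopless, and may have multiple edges; a pair of parallel edges (a bigon) counts as a cycle of length 2. Digraphs are finite, loopless, and may have parallel and anti-parallel arcs; an anti-parallel pair (a digon) counts as a directed cycle of length 2. A \emph{complete acyclic coloring} of a digraph $D$ is a partition of $V(D)$ into color classes each inducing an acyclic subdigraph such that the union of any two distinct color classes induces a subdigraph containing a directed cycle; ${\rm adi}(D)$ is the maximum number of colors in such a coloring. A \emph{complete arboreal coloring} of a graph $G$ is a partition of $V(G)$ into color classes each inducing a forest such that the union of any two distinct color classes induces a subgraph containing a cycle; ${\rm ava}(G)$ is the maximum number of colors in such a coloring. $\tau(D)$ (resp. $\tau(G)$) is the minimum size of a vertex set whose deletion leaves an acyclic digraph (resp. a forest). -}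

module Defs where

open import Data.Nat using (ℕ; zero; suc; _+_; _*_; _^_; _≤_; _<_)
open import Data.Nat.Logarithm using (⌊log₂_⌋)
open import Data.Fin using (Fin; zero; suc; inject₁; fromℕ)
open import Data.Fin.Subset using (Subset; _∉_; ∣_∣)
open import Data.Maybe using (Maybe; just)
open import Data.Product using (Σ; ∃; ∃-syntax; _×_; _,_)
open import Data.Sum using (_⊎_; inj₁; inj₂; [_,_])
open import Data.Empty using (⊥)
open import Relation.Nullary using (¬_)
open import Relation.Binary.PropositionalEquality using (_≡_; _≢_; refl; subst)
open import Function.Definitions using (Injective)
open import Data.Nat.Properties using (<-irrefl)

record SimpleGraph (n : ℕ) : Set₁ where
  field
    Adj    : Fin n → Fin n → Set
    adj-sym : ∀ {u v} → Adj u v → Adj v u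
    irrefl : ∀ {u} → ¬ Adj u u
open SimpleGraph public

data WalkIn {n : ℕ} (G : SimpleGraph n) (S : Fin n → Set) : Fin n → Fin n → Set where
  here : ∀ {u} → S u → WalkIn G S u u
  step : ∀ {u w v} → S u → Adj G u w → WalkIn G S w v → WalkIn G S u v

-- H (on Fin m) is a minor of G (on Fin n): there is a minor model
-- β : V(G) ⇀ V(H) whose branch sets β⁻¹(i) are nonempty, pairwise
-- disjoint (automatic: β is a function), induce connected subgraphs of G,
-- and every edge ij of H is realised by an edge of G between the
-- branch sets of i and j.
record MinorModel {m n : ℕ} (H : SimpleGraph m) (G : SimpleGraph n) : Set where
  field
    β         : Fin n → Maybe (Fin m)
    nonempty  : ∀ i → ∃[ u ] (β u ≡ just i)
    connected : ∀ i u v → β u ≡ just i → β v ≡ just i →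
                WalkIn G (λ w → β w ≡ just i) u v
    edges     : ∀ i j → Adj H i j →
                ∃[ u ] ∃[ v ] (β u ≡ just i × β v ≡ just j × Adj G u v)

IsMinor : {m n : ℕ} → SimpleGraph m → SimpleGraph n → Set
IsMinor H G = MinorModel H G

GraphClass : Set₁
GraphClass = (n : ℕ) → SimpleGraph n → Set

MinorClosed : GraphClass → Set₁
MinorClosed 𝒢 = ∀ {m n} (H : SimpleGraph m) (G : SimpleGraph n) →
                IsMinor H G → 𝒢 n G → 𝒢 m H

Proper : GraphClass → Set₁
Proper 𝒢 = ∃[ n ] Σ (SimpleGraph n) (λ G → ¬ 𝒢 n G)

-- Digraphs (loopless; parallel and anti-parallel arcs allowed):
-- arc u v = number of arcs from u to v.

record Digraph (n : ℕ) : Set where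
  field
    arc      : Fin n → Fin n → ℕ
    loopless : ∀ v → arc v v ≡ 0
open Digraph public

record Multigraph (n : ℕ) : Set where
  field
    mult      : Fin n → Fin n → ℕ
    mult-sym  : ∀ u v → mult u v ≡ mult v u
    mult-loop : ∀ v → mult v v ≡ 0
open Multigraph public

underlying : ∀ {n} → Digraph n → SimpleGraph n
underlying D = record
  { Adj    = λ u v → (0 < arc D u v) ⊎ (0 < arc D v u)
  ; adj-sym = [ inj₂ , inj₁ ]
  ; irrefl = λ {u} → [ bad u , bad u ]
  }
  where
  bad : ∀ u → ¬ (0 < arc D u u)
  bad u p = <-irrefl refl (subst (0 <_) (loopless D u) p)

simplification : ∀ {n} → Multigraph n → SimpleGraph n
simplification G = record
  { Adj    = λ u v → 0 < mult G u v
  ; adj-sym = λ {u} {v} p → subst (0 <_) (mult-sym G u v) p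
  ; irrefl = λ {u} p → <-irrefl refl (subst (0 <_) (mult-loop G u) p)
  }

-- directed cycle v₀ → v₁ → … → v_{k-1} → v₀ with k = m + 2 ≥ 2 distinct
-- vertices, all in S (length 2 = digon)
DiCycleIn : ∀ {n} → Digraph n → (Fin n → Set) → Set
DiCycleIn {n} D S =
  ∃[ m ] Σ (Fin (suc (suc m)) → Fin n) λ σ →
    Injective _≡_ _≡_ σ ×
    (∀ i → S (σ i)) ×
    (∀ (i : Fin (suc m)) → 0 < arc D (σ (inject₁ i)) (σ (suc i))) ×
    (0 < arc D (σ (fromℕ (suc m))) (σ zero))

-- cycle in a multigraph inside S: either a bigon (two vertices of S
-- joined by ≥ 2 parallel edges) or a cycle on k = m + 3 ≥ 3 distinct
-- vertices of S
CycleIn : ∀ {n} → Multigraph n → (Fin n → Set) → Set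
CycleIn {n} G S =
  (∃[ u ] ∃[ v ] (S u × S v × 2 ≤ mult G u v))
  ⊎
  (∃[ m ] Σ (Fin (suc (suc (suc m))) → Fin n) λ σ →
    Injective _≡_ _≡_ σ ×
    (∀ i → S (σ i)) ×
    (∀ (i : Fin (suc (suc m))) → 0 < mult G (σ (inject₁ i)) (σ (suc i))) ×
    (0 < mult G (σ (fromℕ (suc (suc m)))) (σ zero)))

record CompleteAcyclicColoring {n : ℕ} (D : Digraph n) (k : ℕ) : Set where
  field
    color    : Fin n → Fin k
    onto     : ∀ i → ∃[ v ] (color v ≡ i)
    acyclic  : ∀ i → ¬ DiCycleIn D (λ v → color v ≡ i)
    complete : ∀ i j → i ≢ j → DiCycleIn D (λ v → color v ≡ i ⊎ color v ≡ j)

IsAdi : ∀ {n} → Digraph n → ℕ → Set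
IsAdi D a = CompleteAcyclicColoring D a × (∀ k → CompleteAcyclicColoring D k → k ≤ a)

IsTauD : ∀ {n} → Digraph n → ℕ → Set
IsTauD {n} D t =
  (Σ (Subset n) λ X → ∣ X ∣ ≡ t × ¬ DiCycleIn D (λ v → v ∉ X)) ×
  (∀ (X : Subset n) → ¬ DiCycleIn D (λ v → v ∉ X) → t ≤ ∣ X ∣)

record CompleteArborealColoring {n : ℕ} (G : Multigraph n) (k : ℕ) : Set where
  field
    color    : Fin n → Fin k
    onto     : ∀ i → ∃[ v ] (color v ≡ i)
    forest   : ∀ i → ¬ CycleIn G (λ v → color v ≡ i)
    complete : ∀ i j → i ≢ j → CycleIn G (λ v → color v ≡ i ⊎ color v ≡ j)

IsAva : ∀ {n} → Multigraph n → ℕ → Set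
IsAva G a = CompleteArborealColoring G a × (∀ k → CompleteArborealColoring G k → k ≤ a)

IsTauG : ∀ {n} → Multigraph n → ℕ → Set
IsTauG {n} G t =
  (Σ (Subset n) λ X → ∣ X ∣ ≡ t × ¬ CycleIn G (λ v → v ∉ X)) ×
  (∀ (X : Subset n) → ¬ CycleIn G (λ v → v ∉ X) → t ≤ ∣ X ∣)

{-# OPTIONS --safe #-}
module Submission where

open import Data.Nat as ℕ using (ℕ; zero; suc; _+_; _*_; _⊔_; _⊓_; _^_; _≤_; _<_; z≤n; s≤s)
import Data.Nat.Properties as ℕₚ
open import Data.Nat.Logarithm using (⌊log₂_⌋; ⌊log₂⌋-mono-≤)
open import Data.Bool using (Bool; true; false; not; _xor_)
open import Data.Maybe using (Maybe; just; nothing)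
open import Data.Maybe.Properties using (just-injective)
open import Data.Fin as F using (Fin; zero; suc; toℕ; opposite)
import Data.Fin.Induction as Fᵢ
import Data.Fin.Properties as Fₚ
open import Data.Fin.Relation.Unary.Top using (view; ‵fromℕ; ‵inject₁)
open import Data.Fin.Subset using (Subset; _∪_; ⁅_⁆; ∣_∣) renaming (_∈_ to _∈ˢ_; _∉_ to _∉ˢ_; ⊥ to ∅)
import Data.Fin.Subset.Properties as Subₚ
open import Data.List using (List; []; _∷_; _++_; length; map; filter; allFin)
import Data.List as L
import Data.List.Properties as Lₚ
open import Data.List.Membership.Propositional using (_∈_; _∉_)
import Data.List.Membership.Propositional.Properties as Mₚ
open import Data.List.Relation.Unary.All using (All; []; _∷_)
import Data.List.Relation.Unary.All as All
import Data.List.Relation.Unary.All.Properties as Allₚ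
open import Data.List.Relation.Unary.AllPairs using ([]; _∷_)
open import Data.List.Relation.Unary.Any using (Any; here; there)
import Data.List.Relation.Unary.Any as Any
import Data.List.Relation.Unary.Any.Properties as Anyₚ
open import Data.List.Relation.Unary.Linked using (Linked; []; [-]; _∷_)
open import Data.List.Relation.Unary.Unique.Propositional using (Unique)
import Data.List.Relation.Unary.Unique.Propositional.Properties as Uₚ
open import Data.List.Relation.Binary.Sublist.Propositional using (_⊆_; []; _∷_; _∷ʳ_; ⊆-refl; ⊆-trans)
import Data.List.Relation.Binary.Sublist.Propositional as Sub
import Data.List.Relation.Binary.Sublist.Propositional.Properties as Sₚ
open import Data.Vec using (Vec; []; _∷_; toList; lookup; tabulate)
import Data.Vec as V
import Data.Vec.Properties as Vₚ
open import Data.Product using (Σ; ∃; ∃-syntax; _×_; _,_; proj₁; proj₂)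
open import Data.Sum using (_⊎_; inj₁; inj₂)
import Data.Sum as Sum
import Data.Sum.Properties as ⊎ₚ
open import Data.Empty using (⊥; ⊥-elim)
open import Data.Unit using (⊤; tt)
open import Function using (_∘_; id)
open import Relation.Binary using (tri<; tri≈; tri>)
open import Relation.Binary.Construct.Closure.ReflexiveTransitive using (Star; ε; _◅_; _◅◅_)
import Relation.Binary.Construct.Closure.ReflexiveTransitive as Star
open import Relation.Binary.PropositionalEquality using (_≡_; _≢_; refl; sym; trans; cong; cong₂; subst; subst₂)
open import Relation.Nullary using (¬_; Dec; yes; no)
import Relation.Nullary

-- A class excluding some graph excludes a complete minor K_h, so its members are sparse (Mader) and have large independent
-- sets.  Contracting many disjoint cycles gives a member of the class; an independent set in it is a family of q²
-- non-adjacent cycles.  Splitting the cycle with label (i , j) between the colours i and j makes the q colours pairwise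
-- incompatible, and merging compatible classes turns this partial coloring into a complete one.  So it suffices to bound τ
-- by the largest number of disjoint cycles, i.e. to have an Erdős–Pósa property.
--
-- For graphs it is linear: after suppressing vertices of degree at most two, a K_h-minor-free graph of minimum degree three
-- has a cycle of bounded length, since contracting the cells around a maximal scattered set would otherwise give minors that
-- are too dense.
--
-- For digraphs (Reed–Robertson–Seymour–Thomas) a minimum feedback vertex set is well linked.  By Ramsey's theorem the
-- linkages inside it can be made monotone and yield disjoint cycles or a large acyclic grid; cutting the grid into sections
-- that realise arbitrary monotone matchings and adding a return linkage gives the disjoint cycles.
--
-- Since t ≤ f a is stable under double negation, the argument runs classically inside ¬ ¬.

-- Menger's theorem says nothing about which source is joined to which target, so gluing linkages
-- may produce one long cycle instead of many. Making every matching increasing or decreasing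
-- removes this obstacle: an index and its mirror image form a pair that both kinds of matching
-- respect, so each pair closes up on its own, whatever the directions are. That is why `κ + κ`
-- paths are prepared for `κ` cycles. The bound for `suc k` disjoint directed cycles rests on the
-- bound for `k`: a small separator inside the feedback set splits the digraph into two sides, and
-- when both contain cycles neither can pack `k`, so both have small hitting sets. While they are
-- being built, cycles are only sets in which every vertex has a successor, or two neighbours;
-- sequences without repetition are extracted at the end. The number of cycles that forces `2 + a`
-- colours is quadratic in `a` and the undirected Erdős-Pósa function is linear, so the bound for
-- graphs is quadratic and the logarithm only enlarges it.

infixl 1 _>>=_
_>>=_ : ∀ {a b} {A : Set a} {B : Set b} → ¬ ¬ A → (A → ¬ ¬ B) → ¬ ¬ B
(m >>= f) k = m λ a → f a k

pure : ∀ {a} {A : Set a} → A → ¬ ¬ A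
pure a k = k a

em : ∀ {a} (P : Set a) → ¬ ¬ (Dec P)
em P k = k (no λ p → k (yes p))

-- The double-negation shift, valid because `Fin n` is finite. With `em` it makes any predicate on
-- vertices decidable inside `¬ ¬`, so that undecided relations can be filtered and counted.
¬¬-∀Fin : ∀ {p n} {P : Fin n → Set p} → (∀ i → ¬ ¬ P i) → ¬ ¬ (∀ i → P i)
¬¬-∀Fin {n = zero}  f = pure λ ()
¬¬-∀Fin {n = suc n} f = do
  p ← f zero
  ps ← ¬¬-∀Fin (f ∘ suc)
  pure λ { zero → p ; (suc i) → ps i }

decFin : ∀ {p n} (P : Fin n → Set p) → ¬ ¬ (∀ i → Dec (P i))
decFin P = ¬¬-∀Fin λ i → em (P i)

-- Finite counting and Ramsey's theorem

∈-remove : ∀ {A : Set} {x : A} {ys} → x ∈ ys →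
  Σ (List A) λ zs → (length ys ≡ suc (length zs)) × (∀ {y} → y ∈ ys → y ≢ x → y ∈ zs)
∈-remove {ys = _ ∷ ys} (here refl) = ys , refl , λ { (here refl) ne → ⊥-elim (ne refl) ; (there p) _ → p }
∈-remove {ys = y ∷ _} (there p) with zs , e , h ← ∈-remove p =
  y ∷ zs , cong suc e , λ { (here refl) _ → here refl ; (there q) ne → there (h q ne) }

unique-length-≤ : ∀ {A : Set} {xs ys : List A} → Unique xs → (∀ {x} → x ∈ xs → x ∈ ys) → length xs ≤ length ys
unique-length-≤ {xs = []} _ _ = z≤n
unique-length-≤ {xs = x ∷ xs} {ys} (x∉ ∷ u) h with zs , e , g ← ∈-remove (h (here refl)) =
  subst (suc (length xs) ≤_) (sym e)
    (s≤s (unique-length-≤ u λ q → g (h (there q)) λ { refl → All.lookup x∉ q refl }))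

injective⇒surjective : ∀ {k m} (f : Fin k → Fin m) → (∀ i j → f i ≡ f j → i ≡ j) → m ≤ k →
  ∀ j → Σ (Fin k) λ i → f i ≡ j
injective⇒surjective {k} {suc m} f inj m≤k j with Fₚ.any? (λ i → f i F.≟ j)
... | yes p = p
... | no ¬p = ⊥-elim (ℕₚ.<⇒≱ m≤k (Fₚ.injective⇒≤ {f = λ i → F.punchOut (ne i)}
    λ {i} {i'} e → inj i i' (Fₚ.punchOut-injective (ne i) (ne i') e)))
  where
  ne : ∀ i → j ≢ f i
  ne i e = ¬p (i , sym e)

vecOf : ∀ {A : Set} k (L : List A) → k ≤ length L → Σ (Vec A k) λ Z → toList Z ⊆ L
vecOf zero    L       _       = [] , Sₚ.[]⊆-universal L
vecOf (suc k) (x ∷ L) (s≤s h) with Z , p ← vecOf k L h = x ∷ Z , refl ∷ p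

Homog : ∀ {A : Set} {u} → (Vec A u → Set) → List A → Set
Homog P L = (∀ Z → toList Z ⊆ L → P Z) ⊎ (∀ Z → toList Z ⊆ L → ¬ P Z)

homog-⊆ : ∀ {A : Set} {u} {P : Vec A u → Set} {L L' : List A} → L' ⊆ L → Homog P L → Homog P L'
homog-⊆ s (inj₁ h) = inj₁ λ Z p → h Z (⊆-trans p s)
homog-⊆ s (inj₂ h) = inj₂ λ Z p → h Z (⊆-trans p s)

RamseyFor : ℕ → ℕ → ℕ → Set₁
RamseyFor u m N = ∀ {A : Set} (P : Vec A u → Set) (L : List A) → N ≤ length L →
  ¬ ¬ (Σ (List A) λ L' → L' ⊆ L × m ≤ length L' × Homog P L')

-- ys and ns collect the elements a for which all (a ∷ Z) with Z further to the right satisfy P, respectively ¬ P.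
EndHomog : ∀ {A : Set} {u} → (Vec A (suc u) → Set) → ℕ → List A → Set
EndHomog {A} {u} P t L = Σ (List A) λ ys → Σ (List A) λ ns → ys ⊆ L × ns ⊆ L × t ≡ length ys + length ns ×
  (∀ Z → toList Z ⊆ ys → P Z) × (∀ Z → toList Z ⊆ ns → ¬ P Z)

-- The first element `a` colours the `u`-tuples after it by the colour of the tuple completed with
-- `a`. A homogeneous tail `L'` fixes the colour of all tuples starting at `a`, and the remaining
-- elements are chosen inside `L'`.
endHomog : ∀ u → (∀ m → Σ ℕ (RamseyFor u m)) → ∀ t → Σ ℕ λ N → ∀ {A : Set} (P : Vec A (suc u) → Set) (L : List A) →
  N ≤ length L → ¬ ¬ EndHomog P t L
endHomog u R zero = 0 , λ P L _ → pure ([] , [] , Sₚ.[]⊆-universal L , Sₚ.[]⊆-universal L , refl , (λ { (_ ∷ _) () }) , (λ { (_ ∷ _) () }))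
endHomog u R (suc t) with N , E ← endHomog u R t = suc (proj₁ (R N)) , go
  where
  go : ∀ {A : Set} (P : Vec A (suc u) → Set) (L : List A) → suc (proj₁ (R N)) ≤ length L → ¬ ¬ EndHomog P (suc t) L
  go P (a ∷ L) (s≤s h) = do
    L' , L'⊆L , N≤ , hom ← proj₂ (R N) (λ Z → P (a ∷ Z)) L h
    ys , ns , ys⊆ , ns⊆ , e , py , pn ← E P L' N≤
    let ys⊆L = ⊆-trans ys⊆ L'⊆L
        ns⊆L = ⊆-trans ns⊆ L'⊆L
        ext : Homog (λ Z → P (a ∷ Z)) L' → ¬ ¬ EndHomog P (suc t) (a ∷ L)
        ext = λ where
          (inj₁ hy) → pure (a ∷ ys , ns , refl ∷ ys⊆L , a ∷ʳ ns⊆L , cong suc e ,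
            (λ { (_ ∷ Z) (refl ∷ p) → hy Z (⊆-trans p ys⊆) ; (b ∷ Z) (_ ∷ʳ p) → py (b ∷ Z) p }) , pn)
          (inj₂ hn) → pure (ys , a ∷ ns , a ∷ʳ ys⊆L , refl ∷ ns⊆L , trans (cong suc e) (sym (ℕₚ.+-suc (length ys) (length ns))) ,
            py , (λ { (_ ∷ Z) (refl ∷ p) → hn Z (⊆-trans p ns⊆) ; (b ∷ Z) (_ ∷ʳ p) → pn (b ∷ Z) p }))
    ext hom

abstract
  -- Of `m + m` end-homogeneous elements, `m` lie in one of the two lists. The numbers are
  -- `abstract` because they get nested and must not unfold.
  ramsey : ∀ u m → Σ ℕ (RamseyFor u m)
  ramsey zero m = m , λ P L h → em (P []) >>= λ where
    (yes p) → pure (L , ⊆-refl , h , inj₁ λ { [] _ → p })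
    (no ¬p) → pure (L , ⊆-refl , h , inj₂ λ { [] _ → ¬p })
  ramsey (suc u) m with N , E ← endHomog u (ramsey u) (m + m) = N , λ {A} P L h → do
    ys , ns , ys⊆ , ns⊆ , e , py , pn ← E P L h
    yes q ← em (m ≤ length ys)
      where no q → pure (ns , ns⊆ , ℕₚ.+-cancelˡ-≤ (length ys) m (length ns)
                     (ℕₚ.≤-trans (ℕₚ.+-monoˡ-≤ m (ℕₚ.<⇒≤ (ℕₚ.≰⇒> q))) (ℕₚ.≤-reflexive e)) , inj₂ pn)
    pure (ys , ys⊆ , q , inj₁ py)

  ramsey* : ∀ u m q → Σ ℕ λ N → ∀ {A : Set} (Ps : Fin q → Vec A u → Set) (L : List A) → N ≤ length L →
    ¬ ¬ (Σ (List A) λ L' → L' ⊆ L × m ≤ length L' × (∀ i → Homog (Ps i) L'))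
  ramsey* u m zero = m , λ Ps L h → pure (L , ⊆-refl , h , λ ())
  ramsey* u m (suc q) with N₁ , R₁ ← ramsey* u m q with N₂ , R₂ ← ramsey u N₁ = N₂ , λ Ps L h → do
      L₁ , s₁ , h₁ , hom₁ ← R₂ (Ps zero) L h
      L₂ , s₂ , h₂ , hom₂ ← R₁ (Ps ∘ suc) L₁ h₁
      pure (L₂ , ⊆-trans s₂ s₁ , h₂ , λ { zero → homog-⊆ s₂ hom₁ ; (suc i) → hom₂ i })

tabulate-⊆ : ∀ {A : Set} {r} k (X : Fin r → A) (f : Fin k → Fin r) → (∀ i j → i F.< j → f i F.< f j) →
  toList (tabulate (X ∘ f)) ⊆ toList (tabulate X)
tabulate-⊆ zero X f mono = Sₚ.[]⊆-universal _
tabulate-⊆ {r = zero} (suc k) X f mono = ⊥-elim (Fₚ.¬Fin0 (f zero))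
tabulate-⊆ {A} {suc r} (suc k) X f mono with f zero in e
... | zero = refl ∷ rest
  where
  pos : ∀ i → zero ≢ f (suc i)
  pos i q = ℕₚ.n≮0 (subst (λ z → f zero F.< z) (sym q) (mono zero (suc i) (s≤s z≤n)))
  g : Fin k → Fin r
  g i = F.punchOut (pos i)
  gs : ∀ i → suc (g i) ≡ f (suc i)
  gs i = Fₚ.punchIn-punchOut (pos i)
  rest : toList (tabulate (λ i → X (f (suc i)))) ⊆ toList (tabulate (X ∘ suc))
  rest = subst (λ v → toList v ⊆ toList (tabulate (X ∘ suc))) (Vₚ.tabulate-cong (λ i → cong X (gs i)))
    (tabulate-⊆ k (X ∘ suc) g λ i j i<j → ℕₚ.≤-pred (subst₂ F._<_ (sym (gs i)) (sym (gs j)) (mono (suc i) (suc j) (s≤s i<j))))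
... | suc z = X zero ∷ʳ subst (λ v → toList v ⊆ toList (tabulate (X ∘ suc))) (trans (Vₚ.tabulate-cong (λ i → cong X (gs i))) (cong (λ z → X z ∷ tabulate (λ i → X (f (suc i)))) e))
        (tabulate-⊆ (suc k) (X ∘ suc) g λ i j i<j → ℕₚ.≤-pred (subst₂ F._<_ (sym (gs i)) (sym (gs j)) (mono i j i<j)))
  where
  pos : ∀ i → zero ≢ f i
  pos zero q with () ← trans q e
  pos (suc i) q = ℕₚ.n≮0 (subst (λ z → f zero F.< z) (sym q) (mono zero (suc i) (s≤s z≤n)))
  g : Fin (suc k) → Fin r
  g i = F.punchOut (pos i)
  gs : ∀ i → suc (g i) ≡ f i
  gs i = Fₚ.punchIn-punchOut (pos i)

-- Walks and Menger's theorem

on : ∀ {A : Set} {R : A → A → Set} {u v} → Star R u v → A → Set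
on {u = u} ε x = x ≡ u
on {u = u} (r ◅ w) x = x ≡ u ⊎ on w x

WalkIn′ : ∀ {A : Set} (R : A → A → Set) (P : A → Set) → A → A → Set
WalkIn′ R P x y = Σ (Star R x y) λ w → ∀ {z} → on w z → P z

module _ {A : Set} {R : A → A → Set} where

  on-start : ∀ {u v} (w : Star R u v) → on w u
  on-start ε = refl
  on-start (r ◅ w) = inj₁ refl

  on-end : ∀ {u v} (w : Star R u v) → on w v
  on-end ε = refl
  on-end (r ◅ w) = inj₂ (on-end w)

  on-◅◅ : ∀ {u v t x} (p : Star R u v) (q : Star R v t) → on (p ◅◅ q) x → on p x ⊎ on q x
  on-◅◅ ε q h = inj₂ h
  on-◅◅ (r ◅ p) q (inj₁ e) = inj₁ (inj₁ e)
  on-◅◅ (r ◅ p) q (inj₂ h) with on-◅◅ p q h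
  ... | inj₁ h' = inj₁ (inj₂ h')
  ... | inj₂ h' = inj₂ h'

  infixr 5 _⊕_
  _⊕_ : ∀ {P u v t} → WalkIn′ R P u v → WalkIn′ R P v t → WalkIn′ R P u t
  (p , hp) ⊕ (q , hq) = p ◅◅ q , λ h → case-⊎ (on-◅◅ p q h)
    where
    case-⊎ : ∀ {z} → on p z ⊎ on q z → _
    case-⊎ (inj₁ h) = hp h
    case-⊎ (inj₂ h) = hq h

  weaken : ∀ {P Q : A → Set} {u v} → (∀ {z} → P z → Q z) → WalkIn′ R P u v → WalkIn′ R Q u v
  weaken f (w , h) = w , λ o → f (h o)

  prefix : ∀ {u v x} (w : Star R u v) → on w x → WalkIn′ R (on w) u x
  prefix ε refl = ε , id
  prefix (r ◅ w) (inj₁ refl) = ε , λ { refl → inj₁ refl }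
  prefix (r ◅ w) (inj₂ h) with p , hp ← prefix w h = r ◅ p , λ { (inj₁ e) → inj₁ e ; (inj₂ o) → inj₂ (hp o) }

  suffix : ∀ {u v x} (w : Star R u v) → on w x → WalkIn′ R (on w) x v
  suffix ε refl = ε , id
  suffix (r ◅ w) (inj₁ refl) = r ◅ w , id
  suffix (r ◅ w) (inj₂ h) = weaken inj₂ (suffix w h)

  between : ∀ {u v x y} (w : Star R u v) → on w x → on w y → WalkIn′ R (on w) x y ⊎ WalkIn′ R (on w) y x
  between ε refl refl = inj₁ (ε , id)
  between (r ◅ w) (inj₁ refl) h = inj₁ (prefix (r ◅ w) h)
  between (r ◅ w) (inj₂ h) (inj₁ refl) = inj₂ (prefix (r ◅ w) (inj₂ h))
  between (r ◅ w) (inj₂ h) (inj₂ h') with between w h h'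
  ... | inj₁ s = inj₁ (weaken inj₂ s)
  ... | inj₂ s = inj₂ (weaken inj₂ s)

  stays : ∀ {P : A → Set} → (∀ {u v} → R u v → P u → P v) → ∀ {u v} (w : Star R u v) → P u → ∀ {z} → on w z → P z
  stays f ε p refl = p
  stays f (r ◅ w) p (inj₁ refl) = p
  stays f (r ◅ w) p (inj₂ o) = stays f w (f r p) o

on-gmap : ∀ {A : Set} {R R' : A → A → Set} (f : ∀ {u v} → R u v → R' u v) {u v x} (w : Star R u v) → on (Star.map f w) x → on w x
on-gmap f ε h = h
on-gmap f (r ◅ w) (inj₁ e) = inj₁ e
on-gmap f (r ◅ w) (inj₂ h) = inj₂ (on-gmap f w h)

restrict : ∀ {A : Set} {R R' : A → A → Set} {P Q : A → Set} → (∀ {u v} → R u v → P u → P v → R' u v) → (∀ {z} → P z → Q z) →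
  ∀ {u v} → WalkIn′ R P u v → WalkIn′ R' Q u v
restrict {R = R} {R'} {P} {Q} f g (w , h) = go w h
  where
  go : ∀ {u v} (w : Star R u v) → (∀ {z} → on w z → P z) → WalkIn′ R' Q u v
  go ε h = ε , λ o → g (h o)
  go (r ◅ w) h with w' , h' ← go w (h ∘ inj₂) =
    f r (h (inj₁ refl)) (h (inj₂ (on-start w))) ◅ w' , λ { (inj₁ e) → g (h (inj₁ e)) ; (inj₂ o) → h' o }

module _ {n : ℕ} where
  private
    W = Fin n
  open import Data.List.Membership.DecPropositional (F._≟_ {n}) using (_∈?_)
  open import Data.List.Relation.Unary.Unique.DecPropositional.Properties (F._≟_ {n}) using (deduplicate-!)

  module _ {R : W → W → Set} (B : List W) where
    -- `Early` is what cutting a walk at its first vertex in `B` achieves, `Late` what keeping it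
    -- from its last vertex in `B` achieves; the end, respectively the start, may still lie in `B`.
    Early : ∀ {u v} → Star R u v → Set
    Early ε = ⊤
    Early {u} (r ◅ w) = u ∉ B × Early w

    Late : ∀ {u v} → Star R u v → Set
    Late ε = ⊤
    Late (r ◅ w) = ∀ {x} → on w x → x ∉ B

    prefixEarly : ∀ {u v x} (w : Star R u v) → Early w → on w x →
      (x ≡ v) ⊎ Σ (Star R u x) λ w₁ → ∀ {z} → on w₁ z → on w z × z ∉ B
    prefixEarly ε e refl = inj₁ refl
    prefixEarly (r ◅ w) (u∉ , e) (inj₁ refl) = inj₂ (ε , λ { refl → inj₁ refl , u∉ })
    prefixEarly (r ◅ w) (u∉ , e) (inj₂ o) with prefixEarly w e o
    ... | inj₁ eq = inj₁ eq
    ... | inj₂ (w₁ , h) = inj₂ (r ◅ w₁ , λ { (inj₁ refl) → inj₁ refl , u∉ ; (inj₂ q) → inj₂ (proj₁ (h q)) , proj₂ (h q) })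

    suffixLate : ∀ {u v x} (w : Star R u v) → Late w → on w x →
      (x ≡ u) ⊎ Σ (Star R x v) λ w₂ → ∀ {z} → on w₂ z → on w z × z ∉ B
    suffixLate ε e refl = inj₁ refl
    suffixLate (r ◅ w) e (inj₁ refl) = inj₁ refl
    suffixLate (r ◅ w) e (inj₂ o) with w₂ , h ← suffix w o = inj₂ (w₂ , λ q → inj₂ (h q) , e (h q))

    trimEnd : ∀ {u v} (w : Star R u v) → v ∈ B → Σ W λ v' → v' ∈ B × Σ (Star R u v') λ w' → Early w' × (∀ {z} → on w' z → on w z)
    trimEnd ε v∈ = _ , v∈ , ε , tt , id
    trimEnd {u} (r ◅ w) v∈ with u ∈? B
    ... | yes u∈ = _ , u∈ , ε , tt , λ { refl → inj₁ refl }
    ... | no u∉ with v' , v'∈ , w' , e , h ← trimEnd w v∈ = v' , v'∈ , r ◅ w' , (u∉ , e) , λ { (inj₁ q) → inj₁ q ; (inj₂ o) → inj₂ (h o) }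

    lastHit : ∀ {u v} (w : Star R u v) → (∀ {x} → on w x → x ∉ B) ⊎
      Σ W λ u' → u' ∈ B × Σ (Star R u' v) λ w' → Late w' × (∀ {z} → on w' z → on w z)
    lastHit {u} ε with u ∈? B
    ... | yes u∈ = inj₂ (_ , u∈ , ε , tt , id)
    ... | no u∉ = inj₁ λ { refl → u∉ }
    lastHit {u} (r ◅ w) with lastHit w
    ... | inj₂ (u' , u'∈ , w' , e , h) = inj₂ (u' , u'∈ , w' , e , inj₂ ∘ h)
    ... | inj₁ none with u ∈? B
    ...   | yes u∈ = inj₂ (u , u∈ , r ◅ w , none , id)
    ...   | no u∉ = inj₁ λ { (inj₁ refl) → u∉ ; (inj₂ o) → none o }

    trimStart : ∀ {u v} (w : Star R u v) → u ∈ B → Σ W λ u' → u' ∈ B × Σ (Star R u' v) λ w' → Late w' × (∀ {z} → on w' z → on w z)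
    trimStart w u∈ with lastHit w
    ... | inj₁ none = ⊥-elim (none (on-start w) u∈)
    ... | inj₂ r = r

  record Fam (R : W → W → Set) (k : ℕ) (A B : List W) : Set where
    field
      s t  : Fin k → W
      w    : ∀ i → Star R (s i) (t i)
      s∈   : ∀ i → s i ∈ A
      t∈   : ∀ i → t i ∈ B
      disj : ∀ i j {x} → on (w i) x → on (w j) x → i ≡ j

  Sep : (W → W → Set) → ℕ → List W → List W → Set
  Sep R k A B = Σ (List W) λ Z → length Z < k × (∀ {a b} → a ∈ A → b ∈ B → (w : Star R a b) → Σ W λ z → z ∈ Z × on w z)

  private
    Ed : List (W × W) → W → W → Set
    Ed L u v = (u , v) ∈ L

  module _ {L : List (W × W)} {x y : W} where
    -- Up to its first use of the new edge a walk stays in `L`, and it gets to `x`; `lastUse` treats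
    -- the part after the last use. This transfers separators found in `L` to `L` with the new edge.
    firstUse : ∀ {u v} (w : Star (Ed ((x , y) ∷ L)) u v) → WalkIn′ (Ed L) (on w) u v ⊎ WalkIn′ (Ed L) (on w) u x
    firstUse ε = inj₁ (ε , id)
    firstUse (here refl ◅ w) = inj₂ (ε , λ { refl → inj₁ refl })
    firstUse (there r ◅ w) with firstUse w
    ... | inj₁ (w' , h) = inj₁ (r ◅ w' , λ { (inj₁ e) → inj₁ e ; (inj₂ o) → inj₂ (h o) })
    ... | inj₂ (w' , h) = inj₂ (r ◅ w' , λ { (inj₁ e) → inj₁ e ; (inj₂ o) → inj₂ (h o) })

    lastUse : ∀ {u v} (w : Star (Ed ((x , y) ∷ L)) u v) → WalkIn′ (Ed L) (on w) u v ⊎ WalkIn′ (Ed L) (on w) y v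
    lastUse ε = inj₁ (ε , id)
    lastUse (r ◅ w) with lastUse w
    ... | inj₂ (w' , h) = inj₂ (w' , inj₂ ∘ h)
    lastUse (here refl ◅ w) | inj₁ (w' , h) = inj₂ (w' , inj₂ ∘ h)
    lastUse (there r ◅ w) | inj₁ (w' , h) = inj₁ (r ◅ w' , λ { (inj₁ e) → inj₁ e ; (inj₂ o) → inj₂ (h o) })

  -- S separates A from B in L.  Linkages A → x ∷ S and y ∷ S → B can meet only in S, since a further common vertex would
  -- give an A–B walk avoiding S; gluing them along S and the edge (x , y) gives the linkage A → B.
  module Glue {L : List (W × W)} {A B S : List W} {x y : W} {k : ℕ}
    (sep : ∀ {a b} → a ∈ A → b ∈ B → (w : Star (Ed L) a b) → Σ W λ z → z ∈ S × on w z)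
    (|S| : suc (length S) ≤ k) (F₁ : Fam (Ed L) k A (x ∷ S)) (F₂ : Fam (Ed L) k (y ∷ S) B) where
    open Fam

    p : ∀ i → Σ W λ v' → v' ∈ x ∷ S × Σ (Star (Ed L) (s F₁ i) v') λ w' → Early (x ∷ S) w' × (∀ {z} → on w' z → on (w F₁ i) z)
    p i = trimEnd (x ∷ S) (w F₁ i) (t∈ F₁ i)
    q : ∀ i → Σ W λ u' → u' ∈ y ∷ S × Σ (Star (Ed L) u' (t F₂ i)) λ w' → Late (y ∷ S) w' × (∀ {z} → on w' z → on (w F₂ i) z)
    q i = trimStart (y ∷ S) (w F₂ i) (s∈ F₂ i)
    pw : ∀ i → Star (Ed L) (s F₁ i) (proj₁ (p i))
    pw i = proj₁ (proj₂ (proj₂ (p i)))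
    qw : ∀ i → Star (Ed L) (proj₁ (q i)) (t F₂ i)
    qw i = proj₁ (proj₂ (proj₂ (q i)))
    early : ∀ i → Early (x ∷ S) (pw i)
    early i = proj₁ (proj₂ (proj₂ (proj₂ (p i))))
    late : ∀ i → Late (y ∷ S) (qw i)
    late i = proj₁ (proj₂ (proj₂ (proj₂ (q i))))
    pd : ∀ i j {z} → on (pw i) z → on (pw j) z → i ≡ j
    pd i j a b = disj F₁ i j (proj₂ (proj₂ (proj₂ (proj₂ (p i)))) a) (proj₂ (proj₂ (proj₂ (proj₂ (p j)))) b)
    qd : ∀ i j {z} → on (qw i) z → on (qw j) z → i ≡ j
    qd i j a b = disj F₂ i j (proj₂ (proj₂ (proj₂ (proj₂ (q i)))) a) (proj₂ (proj₂ (proj₂ (proj₂ (q j)))) b)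

    pos₁ pos₂ : Fin k → Fin (suc (length S))
    pos₁ i = Any.index (proj₁ (proj₂ (p i)))
    pos₂ i = Any.index (proj₁ (proj₂ (q i)))
    at₁ : ∀ i → L.lookup (x ∷ S) (pos₁ i) ≡ proj₁ (p i)
    at₁ i = sym (Anyₚ.lookup-index (proj₁ (proj₂ (p i))))
    at₂ : ∀ i → L.lookup (y ∷ S) (pos₂ i) ≡ proj₁ (q i)
    at₂ i = sym (Anyₚ.lookup-index (proj₁ (proj₂ (q i))))
    same₁ : ∀ i j → proj₁ (p i) ≡ proj₁ (p j) → i ≡ j
    same₁ i j e = pd i j (on-end (pw i)) (subst (on (pw j)) (sym e) (on-end (pw j)))
    same₂ : ∀ i j → proj₁ (q i) ≡ proj₁ (q j) → i ≡ j
    same₂ i j e = qd i j (on-start (qw i)) (subst (on (qw j)) (sym e) (on-start (qw j)))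
    inj₁' : ∀ i j → pos₁ i ≡ pos₁ j → i ≡ j
    inj₁' i j e = same₁ i j (trans (sym (at₁ i)) (trans (cong (L.lookup (x ∷ S)) e) (at₁ j)))
    inj₂' : ∀ i j → pos₂ i ≡ pos₂ j → i ≡ j
    inj₂' i j e = same₂ i j (trans (sym (at₂ i)) (trans (cong (L.lookup (y ∷ S)) e) (at₂ j)))
    sur₁ : ∀ j → Σ (Fin k) λ i → pos₁ i ≡ j
    sur₁ = injective⇒surjective pos₁ inj₁' |S|
    sur₂ : ∀ j → Σ (Fin k) λ i → pos₂ i ≡ j
    sur₂ = injective⇒surjective pos₂ inj₂' |S|
    mate : Fin k → Fin k
    mate i = proj₁ (sur₂ (pos₁ i))
    mate-pos : ∀ i → pos₂ (mate i) ≡ pos₁ i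
    mate-pos i = proj₂ (sur₂ (pos₁ i))

    -- The two lists of endpoints agree except at position zero, where they hold `x` and `y`. Since
    -- both linkages exhaust their lists, a common vertex belonging to `S` forces equal positions.
    samePos : ∀ i j → proj₁ (p i) ≡ proj₁ (q j) → pos₁ i ≡ pos₂ j
    samePos i j e with pos₁ i in e₁ | pos₂ j in e₂
    ... | _     | suc b with i' , e' ← sur₁ (suc b) = trans (sym e₁) (trans (cong pos₁ (same₁ i i'
            (trans e (trans (sym (at₂ j)) (trans (cong (L.lookup (y ∷ S)) e₂) (trans (cong (L.lookup (x ∷ S)) (sym e')) (at₁ i'))))))) e')
    ... | zero  | zero = refl
    ... | suc a | zero with j' , e' ← sur₂ (suc a) = trans (sym (trans (cong pos₂ (same₂ j j'
            (trans (sym e) (trans (sym (at₁ i)) (trans (cong (L.lookup (x ∷ S)) e₁) (trans (cong (L.lookup (y ∷ S)) (sym e')) (at₂ j'))))))) e')) e₂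

    meet : ∀ i j {z} → on (pw i) z → on (qw j) z → pos₁ i ≡ pos₂ j
    meet i j {z} oi oj with prefixEarly (x ∷ S) (pw i) (early i) oi | suffixLate (y ∷ S) (qw j) (late j) oj
    ... | inj₁ refl | inj₁ e = samePos i j e
    ... | inj₂ (p₁ , h₁) | inj₂ (q₂ , h₂) with sep (s∈ F₁ i) (t∈ F₂ j) (p₁ ◅◅ q₂)
    ...   | z' , z'∈ , o with on-◅◅ p₁ q₂ o
    ...     | inj₁ o' = ⊥-elim (proj₂ (h₁ o') (there z'∈))
    ...     | inj₂ o' = ⊥-elim (proj₂ (h₂ o') (there z'∈))
    meet i j {z} oi oj | inj₁ refl | inj₂ (q₂ , h₂) with sep (s∈ F₁ i) (t∈ F₂ j) (pw i ◅◅ q₂)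
    ...   | z' , z'∈ , o with on-◅◅ (pw i) q₂ o
    ...     | inj₂ o' = ⊥-elim (proj₂ (h₂ o') (there z'∈))
    ...     | inj₁ o' with prefixEarly (x ∷ S) (pw i) (early i) o'
    ...       | inj₁ refl = ⊥-elim (proj₂ (h₂ (on-start q₂)) (there z'∈))
    ...       | inj₂ (p₁ , h₁) = ⊥-elim (proj₂ (h₁ (on-end p₁)) (there z'∈))
    meet i j {z} oi oj | inj₂ (p₁ , h₁) | inj₁ refl with sep (s∈ F₁ i) (t∈ F₂ j) (p₁ ◅◅ qw j)
    ...   | z' , z'∈ , o with on-◅◅ p₁ (qw j) o
    ...     | inj₁ o' = ⊥-elim (proj₂ (h₁ o') (there z'∈))
    ...     | inj₂ o' with suffixLate (y ∷ S) (qw j) (late j) o'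
    ...       | inj₁ refl = ⊥-elim (proj₂ (h₁ (on-end p₁)) (there z'∈))
    ...       | inj₂ (q₂ , h₂) = ⊥-elim (proj₂ (h₂ (on-start q₂)) (there z'∈))

    E = Ed ((x , y) ∷ L)

    bridge : ∀ j → WalkIn′ E (λ z → z ≡ L.lookup (x ∷ S) j ⊎ z ≡ L.lookup (y ∷ S) j) (L.lookup (x ∷ S) j) (L.lookup (y ∷ S) j)
    bridge zero = here refl ◅ ε , id
    bridge (suc j) = ε , inj₁

    glued : ∀ i → WalkIn′ E (λ z → on (pw i) z ⊎ on (qw (mate i)) z) (s F₁ i) (t F₂ (mate i))
    glued i = (Star.map there (pw i) , inj₁ ∘ on-gmap there (pw i))
      ⊕ weaken (λ { (inj₁ refl) → inj₁ (subst (on (pw i)) (sym (at₁ i)) (on-end (pw i)))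
                  ; (inj₂ refl) → inj₂ (subst (on (qw (mate i))) (sym e₂) (on-start (qw (mate i)))) })
               (subst₂ (WalkIn′ E _) (at₁ i) e₂ (bridge (pos₁ i)))
      ⊕ (Star.map there (qw (mate i)) , inj₂ ∘ on-gmap there (qw (mate i)))
      where
      e₂ : L.lookup (y ∷ S) (pos₁ i) ≡ proj₁ (q (mate i))
      e₂ = trans (cong (L.lookup (y ∷ S)) (sym (mate-pos i))) (at₂ (mate i))

    fam : Fam E k A B
    fam = record
      { s = s F₁ ; t = t F₂ ∘ mate ; w = proj₁ ∘ glued ; s∈ = s∈ F₁ ; t∈ = t∈ F₂ ∘ mate
      ; disj = λ i j o o' → cases i j (proj₂ (glued i) o) (proj₂ (glued j) o') }
      where
      cases : ∀ i j {z} → on (pw i) z ⊎ on (qw (mate i)) z → on (pw j) z ⊎ on (qw (mate j)) z → i ≡ j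
      cases i j (inj₁ a) (inj₁ b) = pd i j a b
      cases i j (inj₁ a) (inj₂ b) = inj₁' i j (trans (meet i (mate j) a b) (mate-pos j))
      cases i j (inj₂ a) (inj₁ b) = inj₁' i j (sym (trans (meet j (mate i) b a) (mate-pos i)))
      cases i j (inj₂ a) (inj₂ b) = inj₁' i j (trans (sym (mate-pos i)) (trans (cong pos₂ (qd (mate i) (mate j) a b)) (mate-pos j)))

  lookup-injective : ∀ {xs : List W} → Unique xs → ∀ i j → L.lookup xs i ≡ L.lookup xs j → i ≡ j
  lookup-injective (_ ∷ _) zero zero _ = refl
  lookup-injective (x∉ ∷ u) zero (suc j) e = ⊥-elim (All.lookup x∉ (Mₚ.∈-lookup j) e)
  lookup-injective (x∉ ∷ u) (suc i) zero e = ⊥-elim (All.lookup x∉ (Mₚ.∈-lookup i) (sym e))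
  lookup-injective (_ ∷ u) (suc i) (suc j) e = cong suc (lookup-injective u i j e)

  -- Induction on the edges, after Göring. Without edges the common vertices of `A` and `B` are both
  -- linkage and separator. If `S` separates in `L`, then either linkages to `x ∷ S` and from
  -- `y ∷ S` exist and are glued, or a separator for one of these pairs also separates `A` from `B`:
  -- a walk reaches `x` or a vertex of `S` within `L`, and leaves `y` or a vertex of `S` within `L`.
  mengerList : ∀ (L : List (W × W)) A B k → Fam (Ed L) k A B ⊎ Sep (Ed L) k A B
  mengerList [] A B k with k ℕₚ.≤? length C
    where
    C = filter (_∈? B) (L.deduplicate F._≟_ A)
  ... | no k≰ = inj₂ (_ , ℕₚ.≰⇒> k≰ , λ { {a} a∈ b∈ ε → a , Mₚ.∈-filter⁺ (_∈? B) (Mₚ.∈-deduplicate⁺ F._≟_ a∈) b∈ , refl })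
  ... | yes k≤ = inj₁ (record
    { s = c ; t = c ; w = λ _ → ε
    ; s∈ = λ i → Mₚ.∈-deduplicate⁻ F._≟_ A (proj₁ (Mₚ.∈-filter⁻ (_∈? B) (Mₚ.∈-lookup (F.inject≤ i k≤))))
    ; t∈ = λ i → proj₂ (Mₚ.∈-filter⁻ (_∈? B) {xs = L.deduplicate F._≟_ A} (Mₚ.∈-lookup (F.inject≤ i k≤)))
    ; disj = λ { i j refl e → Fₚ.inject≤-injective k≤ k≤ i j (lookup-injective (Uₚ.filter⁺ (_∈? B) (deduplicate-! A)) _ _ e) } })
    where
    c : Fin k → W
    c i = L.lookup (filter (_∈? B) (L.deduplicate F._≟_ A)) (F.inject≤ i k≤)
  mengerList ((x , y) ∷ L) A B k with mengerList L A B k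
  ... | inj₁ F = inj₁ (record { Fam F ; w = λ i → Star.map there (Fam.w F i)
        ; disj = λ i j a b → Fam.disj F i j (on-gmap there (Fam.w F i) a) (on-gmap there (Fam.w F j) b) })
  ... | inj₂ (S , |S| , sep) with mengerList L A (x ∷ S) k | mengerList L (y ∷ S) B k
  ...   | inj₁ F₁ | inj₁ F₂ = inj₁ (Glue.fam sep |S| F₁ F₂)
  ...   | inj₂ (Z , |Z| , sepZ) | _ = inj₂ (Z , |Z| , hit)
    where
    hit : ∀ {a b} → a ∈ A → b ∈ B → (w : Star (Ed ((x , y) ∷ L)) a b) → Σ W λ z → z ∈ Z × on w z
    hit a∈ b∈ w with firstUse w
    ... | inj₂ (w' , h) with z , z∈ , o ← sepZ a∈ (here refl) w' = z , z∈ , h o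
    ... | inj₁ (w' , h) with z₀ , z₀∈ , o₀ ← sep a∈ b∈ w' with w₁ , h₁ ← prefix w' o₀
          with z , z∈ , o ← sepZ a∈ (there z₀∈) w₁ = z , z∈ , h (h₁ o)
  ...   | inj₁ _ | inj₂ (Z , |Z| , sepZ) = inj₂ (Z , |Z| , hit)
    where
    hit : ∀ {a b} → a ∈ A → b ∈ B → (w : Star (Ed ((x , y) ∷ L)) a b) → Σ W λ z → z ∈ Z × on w z
    hit a∈ b∈ w with lastUse w
    ... | inj₂ (w' , h) with z , z∈ , o ← sepZ (here refl) b∈ w' = z , z∈ , h o
    ... | inj₁ (w' , h) with z₀ , z₀∈ , o₀ ← sep a∈ b∈ w' with w₁ , h₁ ← suffix w' o₀
          with z , z∈ , o ← sepZ (there z₀∈) b∈ w₁ = z , z∈ , h (h₁ o)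

  menger : ∀ (R : W → W → Set) A B k → ¬ ¬ (Fam R k A B ⊎ Sep R k A B)
  menger R A B k = do
    R? ← ¬¬-∀Fin λ u → decFin (R u)
    let R?' = λ (e : W × W) → R? (proj₁ e) (proj₂ e)
        L = filter R?' (L.cartesianProduct (allFin n) (allFin n))
        to : ∀ {u v} → Ed L u v → R u v
        to e = proj₂ (Mₚ.∈-filter⁻ R?' {xs = L.cartesianProduct (allFin n) (allFin n)} e)
        from : ∀ {u v} → R u v → Ed L u v
        from {u} {v} r = Mₚ.∈-filter⁺ R?' (Mₚ.∈-cartesianProduct⁺ (Mₚ.∈-allFin u) (Mₚ.∈-allFin v)) r
        conv : Fam (Ed L) k A B ⊎ Sep (Ed L) k A B → Fam R k A B ⊎ Sep R k A B
        conv = λ where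
          (inj₁ F) → inj₁ (record { Fam F ; w = λ i → Star.map to (Fam.w F i)
            ; disj = λ i j a b → Fam.disj F i j (on-gmap to (Fam.w F i) a) (on-gmap to (Fam.w F j) b) })
          (inj₂ (Z , |Z| , sep)) → inj₂ (Z , |Z| , λ a∈ b∈ w → let z , z∈ , o = sep a∈ b∈ (Star.map from w) in z , z∈ , on-gmap from w o)
    pure (conv (mengerList L A B k))

-- Linkages and monotone sublinkages

unique-⊆ : ∀ {A : Set} {xs ys : List A} → xs ⊆ ys → Unique ys → Unique xs
unique-⊆ [] u = u
unique-⊆ (y ∷ʳ s) (_ ∷ u) = unique-⊆ s u
unique-⊆ (refl ∷ s) (x∉ ∷ u) = Sₚ.All-resp-⊆ s x∉ ∷ unique-⊆ s u

unique-++ : ∀ {A : Set} (xs : List A) {ys} → Unique (xs ++ ys) → Unique xs × Unique ys × (∀ {x} → x ∈ xs → x ∈ ys → ⊥)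
unique-++ [] u = [] , u , λ ()
unique-++ (x ∷ xs) (x∉ ∷ u) with ux , uy , d ← unique-++ xs u =
  Allₚ.++⁻ˡ xs x∉ ∷ ux , uy , λ { (here refl) q → All.lookup (Allₚ.++⁻ʳ xs x∉) q refl ; (there p) q → d p q }

unique-swap : ∀ {A : Set} (xs : List A) {ys} → Unique (xs ++ ys) → Unique (ys ++ xs)
unique-swap xs u with ux , uy , d ← unique-++ xs u = Uₚ.++⁺ uy ux λ (p , q) → d q p

swap-∈ : ∀ {A : Set} (xs : List A) {ys x} → x ∈ xs ++ ys → x ∈ ys ++ xs
swap-∈ xs {ys} p with Mₚ.∈-++⁻ xs p
... | inj₁ a = Mₚ.∈-++⁺ʳ ys a
... | inj₂ b = Mₚ.∈-++⁺ˡ b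

delete : ∀ {A : Set} {x : A} {xs} → x ∈ xs → Unique xs →
  Σ (List A) λ ys → ys ⊆ xs × length xs ≡ suc (length ys) × x ∉ ys
delete {xs = _ ∷ xs} (here refl) (x∉ ∷ u) = xs , _ ∷ʳ ⊆-refl , refl , λ p → All.lookup x∉ p refl
delete {xs = y ∷ _} (there p) (y∉ ∷ u) with ys , s , e , x∉ ← delete p u =
  y ∷ ys , refl ∷ s , cong suc e , λ { (here refl) → All.lookup y∉ p refl ; (there q) → x∉ q }

module _ {X I : Set} (sup : I → X → Set) (disj : ∀ i j {x} → sup i x → sup j x → i ≡ j) where
  survivors : ∀ (Z : List X) (Is : List I) → Unique Is →
    ¬ ¬ (Σ (List I) λ Js → Js ⊆ Is × length Is ≤ length Js + length Z × (∀ {j z} → j ∈ Js → z ∈ Z → ¬ sup j z))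
  survivors [] Is u = pure (Is , ⊆-refl , ℕₚ.m≤m+n _ 0 , λ { _ () })
  survivors (z ∷ Z) Is u = do
    Js , s , h , av ← survivors Z Is u
    let keep : Dec (Σ I λ j → j ∈ Js × sup j z) → _
        keep = λ where
          (no none) → pure (Js , s , ℕₚ.≤-trans h (ℕₚ.+-monoʳ-≤ (length Js) (ℕₚ.n≤1+n _)) , λ { j∈ (here refl) p → none (_ , j∈ , p) ; j∈ (there q) → av j∈ q })
          (yes (j , j∈ , p)) → let Ks , t , e , j∉ = delete j∈ (unique-⊆ s u) in
            pure (Ks , ⊆-trans t s , ℕₚ.≤-trans h (ℕₚ.≤-reflexive (trans (cong (_+ length Z) e) (sym (ℕₚ.+-suc (length Ks) (length Z))))) ,
              λ { k∈ (here refl) q → j∉ (subst (_∈ Ks) (disj _ j q p) k∈) ; k∈ (there q) → av (Sub.lookup t k∈) q })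
    d ← em _
    keep d

-- Each of the `q` families is disjoint and therefore loses at most `length Z` indices. Applied
-- throughout to a Menger separator `Z`, to find rows, columns and paths that avoid it.
survivor* : ∀ {X : Set} {q k} (Z : List X) (sup : Fin q → Fin k → X → Set) → (∀ t i j {x} → sup t i x → sup t j x → i ≡ j) →
  q * length Z < k → ¬ ¬ (Σ (Fin k) λ i → ∀ t {z} → z ∈ Z → ¬ sup t i z)
survivor* {X} {q} {k} Z sup disj h = go q sup disj >>= λ where
    ([] , u , e , av) → ⊥-elim (ℕₚ.<⇒≱ h (subst (_≤ q * length Z) (Lₚ.length-tabulate id) e))
    (i ∷ _ , u , e , av) → pure (i , λ t {z} z∈ → av t (here refl) z∈)
  where
  go : ∀ q (sup : Fin q → Fin k → X → Set) → (∀ t i j {x} → sup t i x → sup t j x → i ≡ j) →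
    ¬ ¬ (Σ (List (Fin k)) λ Js → Unique Js × length (allFin k) ≤ length Js + q * length Z × (∀ t {j z} → j ∈ Js → z ∈ Z → ¬ sup t j z))
  go zero sup disj = pure (allFin k , Uₚ.allFin⁺ k , ℕₚ.m≤m+n _ 0 , λ ())
  go (suc q) sup disj = do
    Js , u , e , av ← go q (sup ∘ suc) (disj ∘ suc)
    Ks , s , e' , av' ← survivors (sup zero) (disj zero) Z Js u
    pure (Ks , unique-⊆ s u
      , ℕₚ.≤-trans e (ℕₚ.≤-trans (ℕₚ.+-monoˡ-≤ (q * length Z) e') (ℕₚ.≤-reflexive (ℕₚ.+-assoc (length Ks) (length Z) _)))
      , λ { zero → av' ; (suc t) j∈ → av t (Sub.lookup s j∈) })

survivor : ∀ {X : Set} {k} (Z : List X) (sup : Fin k → X → Set) → (∀ i j {x} → sup i x → sup j x → i ≡ j) →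
  length Z < k → ¬ ¬ (Σ (Fin k) λ i → ∀ {z} → z ∈ Z → ¬ sup i z)
survivor {k = k} Z sup disj h = do
  i , av ← survivor* {q = 1} Z (λ _ → sup) (λ _ → disj) (subst (_< k) (sym (ℕₚ.*-identityˡ _)) h)
  pure (i , λ {z} z∈ → av zero z∈)

opposite-< : ∀ {k} (i j : Fin k) → i F.< j → opposite j F.< opposite i
opposite-< {k} i j i<j = subst₂ _<_ (sym (Fₚ.opposite-prop j)) (sym (Fₚ.opposite-prop i)) (ℕₚ.∸-monoʳ-< (s≤s i<j) (Fₚ.toℕ<n j))

-- The two monotone bijections of `Fin k`; the Boolean tells whether a matching reverses the order.
flip′ : ∀ {k} → Bool → Fin k → Fin k
flip′ false i = i
flip′ true  i = opposite i

flip′-involutive : ∀ {k} b (i : Fin k) → flip′ b (flip′ b i) ≡ i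
flip′-involutive false i = refl
flip′-involutive true i = Fₚ.opposite-involutive i

pick : ∀ {A : Set} (L : List A) {k} (f : Fin k → Fin (length L)) → (∀ i j → i F.< j → f i F.< f j) →
  toList (tabulate (L.lookup L ∘ f)) ⊆ L
pick L f mono = subst (toList (tabulate (L.lookup L ∘ f)) ⊆_) (e L) (tabulate-⊆ _ (L.lookup L) f mono)
  where
  e : ∀ {A : Set} (L : List A) → toList (tabulate (L.lookup L)) ≡ L
  e [] = refl
  e (x ∷ L) = cong (x ∷_) (e L)

pick2 : ∀ {A : Set} (L : List A) {i j} → i F.< j → L.lookup L i ∷ L.lookup L j ∷ [] ⊆ L
pick2 L {i} {j} i<j = pick L (λ { zero → i ; (suc zero) → j }) λ { zero (suc zero) _ → i<j ; (suc zero) (suc zero) (s≤s ()) }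

inject≤-< : ∀ {m n} (h : m ≤ n) (i j : Fin m) → i F.< j → F.inject≤ i h F.< F.inject≤ j h
inject≤-< h i j = subst₂ _<_ (sym (Fₚ.toℕ-inject≤ i h)) (sym (Fₚ.toℕ-inject≤ j h))

abstract
  -- Erdős-Szekeres for two injections, from Ramsey for pairs. Both become monotone on a sublist;
  -- reversing the index if `α` decreases makes `α` increasing, so one Boolean, for `β`, is left.
  es : ∀ k → Σ ℕ λ N → ∀ {r a b} (α : Fin r → Fin a) (β : Fin r → Fin b) → (∀ i j → α i ≡ α j → i ≡ j) → (∀ i j → β i ≡ β j → i ≡ j) → N ≤ r →
    ¬ ¬ (Σ (Fin k → Fin r) λ I → Σ Bool λ c → (∀ i j → i F.< j → α (I i) F.< α (I j)) × (∀ i j → i F.< j → β (I (flip′ c i)) F.< β (I (flip′ c j))))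
  es k with N , R ← ramsey* 2 k 2 = N , λ {r} α β injα injβ h → do
    L , s , k≤ , hom ← R (λ { zero → inc α ; (suc _) → inc β }) (allFin r) (subst (N ≤_) (sym (Lₚ.length-tabulate id)) h)
    let I : Fin k → Fin r
        I i = L.lookup L (F.inject≤ i k≤)
        distinct : ∀ i j → i F.< j → I i ≢ I j
        distinct i j i<j e = ℕₚ.<⇒≢ (inject≤-< k≤ i j i<j) (cong toℕ (lookup-injective (unique-⊆ s (Uₚ.allFin⁺ r)) _ _ e))
        ia , A = mono L k≤ s α injα distinct (hom zero)
        ib , B = mono L k≤ s β injβ distinct (hom (suc zero))
    pure (combine I α β ia A ib B)
    where
    inc : ∀ {r a} → (Fin r → Fin a) → Vec (Fin r) 2 → Set
    inc γ Z = γ (lookup Z zero) F.< γ (lookup Z (suc zero))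
    mono : ∀ {r a} (L : List (Fin r)) (k≤ : k ≤ length L) → L ⊆ allFin r → (γ : Fin r → Fin a) → (∀ i j → γ i ≡ γ j → i ≡ j) →
      (∀ (i j : Fin k) → i F.< j → L.lookup L (F.inject≤ i k≤) ≢ L.lookup L (F.inject≤ j k≤)) → Homog (inc γ) L →
      Σ Bool λ c → ∀ (i j : Fin k) → i F.< j → γ (L.lookup L (F.inject≤ (flip′ c i) k≤)) F.< γ (L.lookup L (F.inject≤ (flip′ c j) k≤))
    mono L k≤ s γ injγ ne (inj₁ h) = false , λ i j i<j → h (_ ∷ _ ∷ []) (pick2 L (inject≤-< k≤ i j i<j))
    mono L k≤ s γ injγ ne (inj₂ h) = true , λ i j i<j → let lt = opposite-< i j i<j in
      ℕₚ.≤∧≢⇒< (ℕₚ.≮⇒≥ (h (_ ∷ _ ∷ []) (pick2 L (inject≤-< k≤ _ _ lt)))) λ e → ne _ _ lt (sym (injγ _ _ (Fₚ.toℕ-injective e)))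
    combine : ∀ {r a b} (I : Fin k → Fin r) (α : Fin r → Fin a) (β : Fin r → Fin b) (c : Bool) →
      (∀ i j → i F.< j → α (I (flip′ c i)) F.< α (I (flip′ c j))) → (d : Bool) → (∀ i j → i F.< j → β (I (flip′ d i)) F.< β (I (flip′ d j))) →
      Σ (Fin k → Fin r) λ I → Σ Bool λ c → (∀ i j → i F.< j → α (I i) F.< α (I j)) × (∀ i j → i F.< j → β (I (flip′ c i)) F.< β (I (flip′ c j)))
    combine I α β false A d B = I , d , A , B
    combine I α β true A d B = I ∘ opposite , flipped d , A , g d B
      where
      flipped : Bool → Bool
      flipped false = true
      flipped true = false
      g : ∀ d → (∀ i j → i F.< j → β (I (flip′ d i)) F.< β (I (flip′ d j))) →
        ∀ i j → i F.< j → β (I (opposite (flip′ (flipped d) i))) F.< β (I (opposite (flip′ (flipped d) j)))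
      g false B i j i<j = subst₂ (λ u v → β (I u) F.< β (I v)) (sym (Fₚ.opposite-involutive i)) (sym (Fₚ.opposite-involutive j)) (B i j i<j)
      g true B = B

select-⊆ : ∀ {A : Set} {r k} (V : Vec A r) (f : Fin k → Fin r) → (∀ i j → i F.< j → f i F.< f j) →
  toList (tabulate (lookup V ∘ f)) ⊆ toList V
select-⊆ {k = k} V f mono = subst (λ v → toList (tabulate (lookup V ∘ f)) ⊆ toList v) (Vₚ.tabulate∘lookup V) (tabulate-⊆ k (lookup V) f mono)

-- Paths stay abstract so that one Ramsey argument serves paths between vertices of `T`, lanes of a
-- stage and return paths, the first two also with source and target exchanged.
module Linkage {A X : Set} (Path : A → A → Set) (sup : ∀ {x y} → Path x y → X → Set) where
  record Link {k} (f : Fin k → Fin k) (V W : Vec A k) : Set where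
    field
      path : ∀ i → Path (lookup V i) (lookup W (f i))
      disj : ∀ i j {x} → sup (path i) x → sup (path j) x → i ≡ j

  -- The form in which Menger's theorem is applied: disjoint paths without control over the matching
  -- of their ends.
  record Unord (r : ℕ) {a b} (V : Vec A a) (W : Vec A b) : Set where
    field
      α : Fin r → Fin a
      β : Fin r → Fin b
      α-inj : ∀ i j → α i ≡ α j → i ≡ j
      β-inj : ∀ i j → β i ≡ β j → i ≡ j
      path : ∀ i → Path (lookup V (α i)) (lookup W (β i))
      disj : ∀ i j {x} → sup (path i) x → sup (path j) x → i ≡ j

  private
    cast : ∀ {x x' y y'} → x ≡ x' → y ≡ y' → Path x y → Path x' y'
    cast refl refl p = p
    sup-cast : ∀ {x x' y y'} (e : x ≡ x') (e' : y ≡ y') (p : Path x y) {z} → sup (cast e e' p) z → sup p z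
    sup-cast refl refl p h = h

  link : ∀ {k} b (s t : Fin k → A) (p : ∀ i → Path (s i) (t (flip′ b i))) →
    (∀ i j {x} → sup (p i) x → sup (p j) x → i ≡ j) → Link (flip′ b) (tabulate s) (tabulate t)
  link b s t p d = record
    { path = λ i → cast (sym (Vₚ.lookup∘tabulate s i)) (sym (Vₚ.lookup∘tabulate t (flip′ b i))) (p i)
    ; disj = λ i j x y → d i j (sup-cast _ _ (p i) x) (sup-cast _ _ (p j) y) }

  monotone : ∀ {k r a b} {V : Vec A a} {W : Vec A b} → proj₁ (es k) ≤ r → Unord r V W →
    ¬ ¬ (Σ (Vec A k) λ V' → Σ (Vec A k) λ W' → toList V' ⊆ toList V × toList W' ⊆ toList W × Σ Bool λ c → Link (flip′ c) V' W')
  monotone {k} {V = V} {W} h U = do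
    I , c , incα , incβ ← proj₂ (es k) α β α-inj β-inj h
    let inj : ∀ i j → I i ≡ I j → i ≡ j
        inj = λ i j e → ι I α incα i j e
    pure (tabulate (lookup V ∘ α ∘ I) , tabulate (lookup W ∘ β ∘ I ∘ flip′ c)
      , select-⊆ V (α ∘ I) incα
      , select-⊆ W (β ∘ I ∘ flip′ c) incβ
      , c , link c (lookup V ∘ α ∘ I) (lookup W ∘ β ∘ I ∘ flip′ c)
          (λ i → cast refl (cong (lookup W ∘ β ∘ I) (sym (flip′-involutive c i))) (path (I i)))
          (λ i j x y → inj i j (disj (I i) (I j) (sup-cast refl _ (path (I i)) x) (sup-cast refl _ (path (I j)) y))))
    where
    open Unord U
    ι : ∀ {r a} (I : Fin k → Fin r) (α : Fin r → Fin a) → (∀ i j → i F.< j → α (I i) F.< α (I j)) → ∀ i j → I i ≡ I j → i ≡ j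
    ι I α m i j e with Fₚ.<-cmp i j
    ... | tri< lt _ _ = ⊥-elim (ℕₚ.<⇒≢ (m i j lt) (cong (toℕ ∘ α) e))
    ... | tri≈ _ eq _ = eq
    ... | tri> _ _ gt = ⊥-elim (ℕₚ.<⇒≢ (m j i gt) (cong (toℕ ∘ α) (sym e)))

  -- Colour a `(k + k)`-tuple by whether its first half is linked increasingly to its second, and
  -- likewise decreasingly. If neither always holds on the homogeneous list, neither ever holds; but
  -- `r + r` of its elements have an unordered linkage, and `monotone` finds a linked tuple in it.
  homogenize : ∀ k m r → proj₁ (es k) ≤ r → (L : List A) → proj₁ (ramsey* (k + k) (m ⊔ (r + r)) 2) ≤ length L →
    (∀ (V W : Vec A r) → toList V ++ toList W ⊆ L → ¬ ¬ Unord r V W) →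
    ¬ ¬ (Σ (List A) λ L' → L' ⊆ L × m ≤ length L' × Σ Bool λ c → ∀ (V W : Vec A k) → toList V ++ toList W ⊆ L' → Link (flip′ c) V W)
  homogenize k m r es≤r L N≤ hyp = do
    L' , s , h , hom ← proj₂ (ramsey* (k + k) (m ⊔ (r + r)) 2) (λ { zero → P false ; (suc _) → P true }) L N≤
    c , all ← choose L' s h (hom zero) (hom (suc zero))
    pure (L' , s , ℕₚ.≤-trans (ℕₚ.m≤m⊔n m (r + r)) h , c , λ V W p → all (V V.++ W) (subst (_⊆ L') (sym (Vₚ.toList-++ V W)) p) V W refl)
    where
    P : Bool → Vec A (k + k) → Set
    P b Z = ∀ (V W : Vec A k) → Z ≡ V V.++ W → Link (flip′ b) V W
    choose : ∀ L' → L' ⊆ L → m ⊔ (r + r) ≤ length L' → Homog (P false) L' → Homog (P true) L' →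
      ¬ ¬ (Σ Bool λ c → ∀ Z → toList Z ⊆ L' → P c Z)
    choose L' s h (inj₁ a) _ = pure (false , a)
    choose L' s h (inj₂ _) (inj₁ a) = pure (true , a)
    choose L' s h (inj₂ na) (inj₂ nb) with vecOf (r + r) L' (ℕₚ.≤-trans (ℕₚ.m≤n⊔m m (r + r)) h)
    ... | Z , Z⊆ with V.splitAt r Z
    ... | X , Y , refl = do
      let XY⊆ = subst (_⊆ L') (Vₚ.toList-++ X Y) Z⊆
      U ← hyp X Y (⊆-trans XY⊆ s)
      V , W , V⊆ , W⊆ , c , l ← monotone {k = k} es≤r U
      let VW⊆ = subst (_⊆ L') (sym (Vₚ.toList-++ V W)) (⊆-trans (Sₚ.++⁺ V⊆ W⊆) XY⊆)
          give : ∀ c → Link (flip′ c) V W → P c (V V.++ W)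
          give c l V' W' e = subst₂ (Link (flip′ c)) (proj₁ (Vₚ.++-injective V V' e)) (proj₂ (Vₚ.++-injective V V' e)) l
          absurd : ∀ c → Link (flip′ c) V W → ⊥
          absurd = λ { false l → na (V V.++ W) VW⊆ (give false l) ; true l → nb (V V.++ W) VW⊆ (give true l) }
      λ _ → absurd c l

-- Packing directed cycles; a minimum feedback vertex set is well linked

∈-toList : ∀ {A : Set} {q} (Z : Vec A q) {x} → x ∈ toList Z → Σ (Fin q) λ i → lookup Z i ≡ x
∈-toList (_ ∷ Z) (here refl) = zero , refl
∈-toList (_ ∷ Z) (there p) with i , e ← ∈-toList Z p = suc i , e

toList-∈ : ∀ {A : Set} {q} (Z : Vec A q) i → lookup Z i ∈ toList Z
toList-∈ (_ ∷ Z) zero = here refl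
toList-∈ (_ ∷ Z) (suc i) = there (toList-∈ Z i)

module _ {V : Set} (E : V → V → Set) where
  -- In a finite digraph such a set contains a directed cycle. In this form neither an order nor
  -- distinctness of vertices has to be tracked while cycles are assembled from paths.
  Cyc : (V → Set) → Set
  Cyc S = Σ V S × (∀ {x} → S x → Σ V λ y → E x y × S y)

  Packing : ℕ → Set₁
  Packing k = Σ (Fin k → V → Set) λ S → (∀ i → Cyc (S i)) × (∀ i j {x} → S i x → S j x → i ≡ j)

  Hits : List V → Set₁
  Hits X = ∀ S → Cyc S → ¬ (∀ {x} → S x → x ∉ X)

  -- The end of a piece has an arc to the start of the next one, so the pieces of a block, being
  -- closed under `next`, contain a cycle. Pieces of the same block may meet; only different blocks
  -- have to be disjoint.
  record Pieces (I B : Set) : Set₁ where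
    field
      R     : V → V → Set
      R⇒E   : ∀ {u v} → R u v → E u v
      s l   : I → V
      next  : I → I
      w     : ∀ p → Star R (s p) (l p)
      close : ∀ p → E (l p) (s (next p))
      block : I → B
      block-next : ∀ p → block (next p) ≡ block p
      disj  : ∀ p q {x} → on (w p) x → on (w q) x → block p ≡ block q

  packPieces : ∀ {I B k} (P : Pieces I B) (rep : Fin k → I) →
    (∀ i j → Pieces.block P (rep i) ≡ Pieces.block P (rep j) → i ≡ j) → Packing k
  packPieces {I} P rep inj = (λ i x → Σ I λ p → block p ≡ block (rep i) × on (w p) x)
    , (λ i → (s (rep i) , rep i , refl , on-start (w (rep i))) , λ (p , e , o) → successor p e (w p) id refl o)
    , λ i j (p , e , o) (q , e' , o') → inj i j (trans (sym e) (trans (disj p q o o') e'))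
    where
    open Pieces P
    successor : ∀ p {b} → block p ≡ b → ∀ {u v x} (w' : Star R u v) → (∀ {z} → on w' z → on (w p) z) → v ≡ l p → on w' x →
      Σ V λ y → E x y × Σ I λ q → block q ≡ b × on (w q) y
    successor p e ε f refl refl = _ , close p , next p , trans (block-next p) e , on-start (w (next p))
    successor p e (r ◅ w') f ev (inj₁ refl) = _ , R⇒E r , p , e , f (inj₂ (on-start w'))
    successor p e (r ◅ w') f ev (inj₂ o) = successor p e w' (f ∘ inj₂) ev o

-- A name for the pair of `i` and `opposite i`, invariant under both monotone matchings.
mirror : ∀ {k} → Fin k → ℕ
mirror i = toℕ i ⊓ toℕ (opposite i)

mirror-flip′ : ∀ {k} b (i : Fin k) → mirror (flip′ b i) ≡ mirror i
mirror-flip′ false i = refl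
mirror-flip′ true i = trans (cong (λ j → toℕ (opposite i) ⊓ toℕ j) (Fₚ.opposite-involutive i)) (ℕₚ.⊓-comm (toℕ (opposite i)) (toℕ i))

-- The first `k` of `k + k` indices thus represent different pairs, which gives `k` cycles.
mirror-↑ˡ : ∀ {k} (i : Fin k) → mirror (i F.↑ˡ k) ≡ toℕ i
mirror-↑ˡ {k} i = trans (ℕₚ.m≤n⇒m⊓n≡m (ℕₚ.≤-trans (ℕₚ.≤-reflexive (Fₚ.toℕ-↑ˡ i k)) (ℕₚ.<⇒≤ (ℕₚ.<-≤-trans (Fₚ.toℕ<n i)
  (subst (k ≤_) (sym (Fₚ.opposite-prop (i F.↑ˡ k))) (ℕₚ.m+n≤o⇒m≤o∸n k
    (ℕₚ.+-monoʳ-≤ k (subst (_< k) (sym (Fₚ.toℕ-↑ˡ i k)) (Fₚ.toℕ<n i))))))))) (Fₚ.toℕ-↑ˡ i k)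

EPWith : ℕ → ℕ → Set₁
EPWith k s = ∀ {n} (E : Fin n → Fin n → Set) → ¬ Packing E k → ¬ ¬ (Σ (List (Fin n)) λ X → length X ≤ s × Hits E X)

-- A large well-linked set yields a web

flip′-xor : ∀ {k} a b (i : Fin k) → flip′ a (flip′ b i) ≡ flip′ (a xor b) i
flip′-xor false b i = refl
flip′-xor true false i = refl
flip′-xor true true i = Fₚ.opposite-involutive i

flip′-injective : ∀ {k} b (i j : Fin k) → flip′ b i ≡ flip′ b j → i ≡ j
flip′-injective b i j e = trans (sym (flip′-involutive b i)) (trans (cong (flip′ b) e) (flip′-involutive b j))

lookup-toList-injective : ∀ {A : Set} {k} (Z : Vec A k) → Unique (toList Z) → ∀ i j → lookup Z i ≡ lookup Z j → i ≡ j
lookup-toList-injective (_ ∷ _) _ zero zero _ = refl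
lookup-toList-injective (_ ∷ Z) (x∉ ∷ _) zero (suc j) e = ⊥-elim (All.lookup x∉ (toList-∈ Z j) e)
lookup-toList-injective (_ ∷ Z) (x∉ ∷ _) (suc i) zero e = ⊥-elim (All.lookup x∉ (toList-∈ Z i) (sym e))
lookup-toList-injective (_ ∷ Z) (_ ∷ u) (suc i) (suc j) e = cong suc (lookup-toList-injective Z u i j e)

pick4 : ∀ {A : Set} (L : List A) {i j a b} → i F.< j → j F.< a → a F.< b →
  L.lookup L i ∷ L.lookup L j ∷ L.lookup L a ∷ L.lookup L b ∷ [] ⊆ L
pick4 L {i} {j} {a} {b} p q r = pick L f mono
  where
  f : Fin 4 → Fin (length L)
  f zero = i
  f (suc zero) = j
  f (suc (suc zero)) = a
  f (suc (suc (suc zero))) = b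
  mono : ∀ u v → u F.< v → f u F.< f v
  mono zero (suc zero) _ = p
  mono zero (suc (suc zero)) _ = ℕₚ.<-trans p q
  mono zero (suc (suc (suc zero))) _ = ℕₚ.<-trans p (ℕₚ.<-trans q r)
  mono (suc zero) (suc (suc zero)) _ = q
  mono (suc zero) (suc (suc (suc zero))) _ = ℕₚ.<-trans q r
  mono (suc (suc zero)) (suc (suc (suc zero))) _ = r
  mono (suc zero) (suc zero) (s≤s ())
  mono (suc (suc zero)) (suc zero) (s≤s ())
  mono (suc (suc zero)) (suc (suc zero)) (s≤s (s≤s ()))
  mono (suc (suc (suc zero))) (suc zero) (s≤s ())
  mono (suc (suc (suc zero))) (suc (suc zero)) (s≤s (s≤s ()))
  mono (suc (suc (suc zero))) (suc (suc (suc zero))) (s≤s (s≤s (s≤s ())))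

-- The eight predicates choose a member of each mirror pair on the `P` side and on the `Q` side, and
-- say which pair comes first. `m + m` leaves room for separate rows and columns, `suc k` for the
-- forbidden packing.
webSize : ℕ → ℕ → ℕ
webSize k m = proj₁ (ramsey* 2 ((m + m) ⊔ suc k) 8)

-- Two nested uses of `homogenize`, one for each direction of the linkages, with `κ + κ` elements
-- left for `V` and `W`. `s + s` is the size from which `TLink.tlink` applies.
linkedSize : ℕ → ℕ → ℕ → ℕ
linkedSize k s m = proj₁ (ramsey* (κ + κ) (proj₁ (ramsey* (κ + κ) ((κ + κ) ⊔ (r + r)) 2) ⊔ (r + r)) 2)
  where
  κ = webSize k m + webSize k m
  r = proj₁ (es κ) ⊔ (s + s)

-- Quadruples consist of two rows and two columns. The six predicates are the order along rows, the
-- order along columns and four variants of a backward comparison.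
gridSize : ℕ → ℕ
gridSize M = proj₁ (ramsey* 4 (suc M + suc M) 6)

-- The stages of a grid

laneBound : ℕ → ℕ → ℕ
laneBound μ κ = proj₁ (ramsey* (κ + κ) (proj₁ (ramsey* (κ + κ) ((μ + κ) ⊔ (r + r)) 2) ⊔ (r + r)) 2)
  where
  r = proj₁ (es κ)

famUnord : ∀ {n m r a b} {R E₀ : Fin n → Fin n → Set} {Q : Fin n → Set} (f : ∀ {u v} → R u v → E₀ u v) (src tgt : Fin m → Fin n)
  (X : Vec (Fin m) a) (Y : Vec (Fin m) b) (F : Fam R r (L.tabulate (src ∘ lookup X)) (L.tabulate (tgt ∘ lookup Y))) →
  (∀ i {x} → on (Fam.w F i) x → Q x) → Linkage.Unord (λ i j → WalkIn′ E₀ Q (src i) (tgt j)) (λ p → on (proj₁ p)) r X Y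
famUnord {R = R} {E₀} {Q} f src tgt X Y F inQ = record
  { α = α ; β = β
  ; α-inj = λ i j e → disj i j (on-start (w i)) (subst (on (w j)) (trans (sα j) (trans (cong (src ∘ lookup X) (sym e)) (sym (sα i)))) (on-start (w j)))
  ; β-inj = λ i j e → disj i j (on-end (w i)) (subst (on (w j)) (trans (sβ j) (trans (cong (tgt ∘ lookup Y) (sym e)) (sym (sβ i)))) (on-end (w j)))
  ; path = λ i → proj₁ (walk i)
  ; disj = λ i j a b → disj i j (proj₂ (walk i) a) (proj₂ (walk j) b) }
  where
  open Fam F renaming (s to σ)
  α = λ i → proj₁ (Mₚ.∈-tabulate⁻ (s∈ i))
  β = λ i → proj₁ (Mₚ.∈-tabulate⁻ (t∈ i))
  sα : ∀ i → σ i ≡ src (lookup X (α i))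
  sα i = proj₂ (Mₚ.∈-tabulate⁻ (s∈ i))
  sβ : ∀ i → t i ≡ tgt (lookup Y (β i))
  sβ i = proj₂ (Mₚ.∈-tabulate⁻ (t∈ i))
  walk : ∀ i → Σ (WalkIn′ E₀ Q (src (lookup X (α i))) (tgt (lookup Y (β i)))) λ p → ∀ {x} → on (proj₁ p) x → on (w i) x
  walk i = go (sα i) (sβ i) (w i) (inQ i)
    where
    go : ∀ {u v u' v'} → u ≡ u' → v ≡ v' → (w' : Star R u v) → (∀ {x} → on w' x → Q x) →
      Σ (WalkIn′ E₀ Q u' v') λ p → ∀ {x} → on (proj₁ p) x → on w' x
    go refl refl w' q = (Star.map f w' , λ o → q (on-gmap f w' o)) , on-gmap f w'

-- Returning to the first stage; the Erdős–Pósa property for directed cycles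

join : ∀ {A : Set} {R : A → A → Set} {P : A → Set} {u v x y} → WalkIn′ R P u v → R v x → WalkIn′ R P x y → WalkIn′ R P u y
join (p , hp) e (q , hq) = (p , hp) ⊕ (e ◅ q , λ { (inj₁ refl) → hp (on-end p) ; (inj₂ o) → hq o })

toList-tabulate : ∀ {A : Set} {k} (f : Fin k → A) → toList (tabulate f) ≡ L.tabulate f
toList-tabulate {k = zero} f = refl
toList-tabulate {k = suc k} f = cong (f zero ∷_) (toList-tabulate (f ∘ suc))

record MinimalHitting (k s n : ℕ) : Set₁ where
  field
    IH    : EPWith k s
    E     : Fin n → Fin n → Set
    ¬pack : ¬ Packing E (suc k)
    T     : List (Fin n)
    T!    : Unique T
    hitsT : Hits E T
    minT  : ∀ X → Hits E X → length T ≤ length X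

-- Linkages within a minimum feedback vertex set

module WellLinked {k s n : ℕ} (𝕊 : MinimalHitting k s n) where
  open MinimalHitting 𝕊

  private
    Vx = Fin n
  open import Data.List.Membership.DecPropositional (F._≟_ {n}) using (_∈?_)

  -- Without the arcs into `T`, a walk meets `T` at most in its first vertex. A closed walk would
  -- avoid `T` altogether, so `E′` is acyclic and reachability is a partial order.
  E′ : Vx → Vx → Set
  E′ u v = E u v × v ∉ T

  -- The last arc, which may enter `T`, is kept apart, and `tsup` omits the endpoint `b`: a path may
  -- end where another one starts.
  TPath : Vx → Vx → Set
  TPath a b = Σ Vx λ l → Star E′ a l × E l b

  tsup : ∀ {a b} → TPath a b → Vx → Set
  tsup (_ , w , _) = on w

  module TLink {q} (A B : Vec Vx q) (2s≤q : s + s ≤ q) (AB! : Unique (toList A ++ toList B))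
           (A∪B⊆T : ∀ {x} → x ∈ toList A ++ toList B → x ∈ T) where
    open Linkage TPath tsup
    private
      LA = toList A
      LB = toList B
      AB = LA ++ LB

    rest : List Vx
    rest = filter (λ x → Relation.Nullary.¬? (x ∈? AB)) T

    rest-length : length rest + (q + q) ≤ length T
    rest-length = subst (_≤ length T) (trans (Lₚ.length-++ rest) (cong (length rest +_)
        (trans (Lₚ.length-++ LA) (cong₂ _+_ (Vₚ.length-toList A) (Vₚ.length-toList B)))))
      (unique-length-≤ (Uₚ.++⁺ (Uₚ.filter⁺ _ T!) AB! λ (a , b) → proj₂ (Mₚ.∈-filter⁻ (λ x → Relation.Nullary.¬? (x ∈? AB)) {xs = T} a) b) sub)
      where
      sub : ∀ {x} → x ∈ rest ++ AB → x ∈ T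
      sub p with Mₚ.∈-++⁻ rest p
      ... | inj₁ a = proj₁ (Mₚ.∈-filter⁻ (λ x → Relation.Nullary.¬? (x ∈? AB)) {xs = T} a)
      ... | inj₂ b = A∪B⊆T b

    ok : Vx → Set
    ok u = u ∉ T ⊎ u ∈ AB

    rest⇒ok : ∀ {x} → x ∉ rest → ok x
    rest⇒ok {x} x∉ with x ∈? T | x ∈? AB
    ... | no a  | _     = inj₁ a
    ... | yes _ | yes b = inj₂ b
    ... | yes a | no b  = ⊥-elim (x∉ (Mₚ.∈-filter⁺ (λ x → Relation.Nullary.¬? (x ∈? AB)) a b))

    R : Vx → Vx → Set
    R u v = E u v × ok u × ok v

    -- A separator `Z` with fewer than `q` vertices would give a hitting set of `rest`, `Z` and at
    -- most `q` further vertices. This is shorter than `T`, which has `q + q` vertices besides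
    -- `rest`. `C` is the side reachable from `A`.
    module Separated (Z : List Vx) (|Z| : length Z < q)
      (sep : ∀ {a b} → a ∈ LA → b ∈ LB → (w : Star R a b) → Σ Vx λ z → z ∈ Z × on w z) where

      R′ : Vx → Vx → Set
      R′ u v = R u v × u ∉ Z × v ∉ Z
      ok′ C : Vx → Set
      ok′ u = ok u × u ∉ Z
      C u = ok′ u × Σ Vx λ a → a ∈ LA × a ∉ Z × Star R′ a u
      E₁ E₂ : Vx → Vx → Set
      E₁ u v = E u v × C u × C v
      E₂ u v = E u v × (ok′ u × ¬ C u) × (ok′ v × ¬ C v)

      C-closed : ∀ {u v} → C u → E u v → ok′ v → C v
      C-closed ((oku , u∉) , a , a∈ , a∉ , w) e (okv , v∉) = (okv , v∉) , a , a∈ , a∉ , w ◅◅ ((e , oku , okv) , u∉ , v∉) ◅ ε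

      C∩B : ∀ {x} → C x → x ∉ LB
      C∩B (_ , a , a∈ , a∉ , w) x∈ with z , z∈ , o ← sep a∈ x∈ (Star.map proj₁ w) =
        stays {P = _∉ Z} (λ r _ → proj₂ (proj₂ r)) w a∉ (on-gmap proj₁ w o) z∈

      -- `C` is closed under arcs to admissible vertices, so a cycle that meets `C` has a cyclic
      -- part within it.
      split : ∀ S → Cyc E S → (∀ {x} → S x → ok′ x) →
        ¬ ¬ (Cyc E₁ (λ x → S x × C x) ⊎ (Cyc E₂ S × (∀ {x} → S x → ¬ C x)))
      split S (x₀ , s) good = em (Σ Vx λ x → S x × C x) >>= λ where
        (yes p) → pure (inj₁ (p , λ {x} (sx , cx) → both sx cx (s sx)))
        (no ¬p) → pure (inj₂ ((x₀ , λ {x} sx → let y , e , sy = s sx in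
                      y , (e , (good sx , λ c → ¬p (x , sx , c)) , (good sy , λ c → ¬p (y , sy , c))) , sy) , λ {x} sx c → ¬p (x , sx , c)))

       where
        both : ∀ {x} → S x → C x → Σ Vx (λ y → E x y × S y) → Σ Vx λ y → E₁ x y × S y × C y
        both sx cx (y , e , sy) = let cy = C-closed cx e (good sy) in y , (e , cx , cy) , sy , cy

      tooShort : ∀ Y → length Y < q + q → ¬ Hits E (rest ++ Y)
      tooShort Y h hit = ℕₚ.<⇒≱ (ℕₚ.<-≤-trans (ℕₚ.+-monoʳ-< (length rest) h) rest-length)
        (ℕₚ.≤-trans (minT _ hit) (ℕₚ.≤-reflexive (Lₚ.length-++ rest)))

      avoid : ∀ {Y} (S : Vx → Set) → (∀ {x} → S x → x ∉ rest ++ Z ++ Y) → (∀ {x} → S x → ok′ x) × (∀ {x} → S x → x ∉ Y)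
      avoid S h = (λ sx → rest⇒ok (λ p → h sx (Mₚ.∈-++⁺ˡ p)) , λ p → h sx (Mₚ.∈-++⁺ʳ rest (Mₚ.∈-++⁺ˡ p)))
                , λ sx p → h sx (Mₚ.∈-++⁺ʳ rest (Mₚ.∈-++⁺ʳ Z p))

      E₁⊆ : ∀ {S} → Cyc E₁ S → Cyc E S
      E₁⊆ (x , s) = x , λ sx → let y , e , sy = s sx in y , proj₁ e , sy
      E₂⊆ : ∀ {S} → Cyc E₂ S → Cyc E S
      E₂⊆ (x , s) = x , λ sx → let y , e , sy = s sx in y , proj₁ e , sy

      -- A cycle on the other side would extend `k` disjoint cycles to `suc k`; hence the induction
      -- hypothesis applies to this side.
      +cycle : ∀ {E″ : Vx → Vx → Set} {Q : Vx → Set} → (∀ {S} → Cyc E″ S → Cyc E S) → (∀ {u v} → E″ u v → Q u) →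
        ∀ S → Cyc E S → (∀ {x} → S x → ¬ Q x) → ¬ Packing E″ k
      +cycle f g S cyc ¬q (Ss , cycs , d) = ¬pack
        ( (λ { zero → S ; (suc i) → Ss i }) , (λ { zero → cyc ; (suc i) → f (cycs i) })
        , λ { zero zero _ _ → refl ; zero (suc j) a b → ⊥-elim (¬q a (inQ j b)) ; (suc i) zero a b → ⊥-elim (¬q b (inQ i a))
            ; (suc i) (suc j) a b → cong suc (d i j a b) })
        where
        inQ : ∀ i {x} → Ss i x → _
        inQ i sx = g (proj₁ (proj₂ (proj₂ (cycs i) sx)))

      inT : ∀ {x} → ok′ x → x ∈ T → x ∉ LA → x ∉ LB → ⊥
      inT (inj₁ x∉T , _) x∈T _ _ = x∉T x∈T
      inT (inj₂ x∈AB , _) _ a b with Mₚ.∈-++⁻ LA x∈AB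
      ... | inj₁ p = a p
      ... | inj₂ p = b p

      absurd : ¬ ¬ ⊥
      absurd = do
        c₁ ← em (Σ (Vx → Set) (Cyc E₁))
        c₂ ← em (Σ (Vx → Set) (Cyc E₂))
        go c₁ c₂
        where
        go : Dec (Σ (Vx → Set) (Cyc E₁)) → Dec (Σ (Vx → Set) (Cyc E₂)) → ¬ ¬ ⊥
        -- Cycles on both sides: the two hitting sets together have at most `s + s ≤ q` vertices.
        go (yes (S₁ , c₁)) (yes (S₂ , c₂)) = do
          X₁ , h₁ , hit₁ ← IH E₁ (+cycle E₁⊆ (proj₁ ∘ proj₂) S₂ (E₂⊆ c₂) λ sx → proj₂ (proj₁ (proj₂ (proj₁ (proj₂ (proj₂ c₂ sx))))))
          X₂ , h₂ , hit₂ ← IH E₂ (+cycle E₂⊆ (proj₂ ∘ proj₁ ∘ proj₂) S₁ (E₁⊆ c₁) λ sx ¬c → ¬c (proj₁ (proj₂ (proj₁ (proj₂ (proj₂ c₁ sx))))))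
          pure (tooShort (Z ++ X₁ ++ X₂)
            (ℕₚ.≤-trans (s≤s (ℕₚ.≤-reflexive (trans (Lₚ.length-++ Z) (cong (length Z +_) (Lₚ.length-++ X₁)))))
              (ℕₚ.+-mono-≤ |Z| (ℕₚ.≤-trans (ℕₚ.+-mono-≤ h₁ h₂) 2s≤q)))
            λ S cyc av → let good , avY = avoid S av in split S cyc good λ where
              (inj₁ c) → hit₁ _ c λ (sx , _) p → avY sx (Mₚ.∈-++⁺ˡ p)
              (inj₂ (c , _)) → hit₂ _ c λ sx p → avY sx (Mₚ.∈-++⁺ʳ X₁ p))
        -- The remaining cycles have a part in `C`, which is disjoint from `B`; so they meet `T`
        -- within `A`. In the next case the roles are exchanged, since `A` without `Z` lies in `C`.
        go _ (no ¬c₂) = pure (tooShort (Z ++ LA)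
            (ℕₚ.≤-trans (s≤s (ℕₚ.≤-reflexive (Lₚ.length-++ Z))) (ℕₚ.+-mono-≤ |Z| (ℕₚ.≤-reflexive (Vₚ.length-toList A))))
            λ S cyc av → let good , avY = avoid S av in split S cyc good λ where
              (inj₁ c) → hitsT _ (E₁⊆ c) λ {x} (sx , cx) x∈T → inT (good sx) x∈T (avY sx) (C∩B cx)
              (inj₂ (c , _)) → ¬c₂ (_ , c))
        go (no ¬c₁) (yes _) = pure (tooShort (Z ++ LB)
            (ℕₚ.≤-trans (s≤s (ℕₚ.≤-reflexive (Lₚ.length-++ Z))) (ℕₚ.+-mono-≤ |Z| (ℕₚ.≤-reflexive (Vₚ.length-toList B))))
            λ S cyc av → let good , avY = avoid S av in split S cyc good λ where
              (inj₁ c) → ¬c₁ (_ , c)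
              (inj₂ (c , ¬C)) → hitsT _ cyc λ {x} sx x∈T → inT (good sx) x∈T (λ a → ¬C sx (good sx , x , a , proj₂ (good sx) , ε)) (avY sx))

    A∩B : ∀ {x} → x ∈ LA → x ∈ LB → ⊥
    A∩B = proj₂ (proj₂ (unique-++ LA AB!))

    half : ∀ {u v t} → R u v → (w : Star R v t) → (∀ {x} → on w x → x ∉ LA) → Early LB w →
      Σ (TPath u t) λ p → ∀ {z} → tsup p z → z ≡ u ⊎ on w z
    half (e , _) ε _ _ = (_ , ε , e) , inj₁
    half {v = v} (e , _ , okv) (r ◅ w) a∉ (b∉ , early) with (l , w' , e') , h ← half r w (a∉ ∘ inj₂) early =
      (l , (e , v∉T okv) ◅ w' , e') , λ { (inj₁ p) → inj₁ p ; (inj₂ o) → inj₂ (h o) }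
      where
      v∉T : ok v → v ∉ T
      v∉T (inj₁ p) = p
      v∉T (inj₂ p) with Mₚ.∈-++⁻ LA p
      ... | inj₁ a = ⊥-elim (a∉ (inj₁ refl) a)
      ... | inj₂ b = ⊥-elim (b∉ b)

    -- The walk is kept from its last vertex in `A` up to the first vertex in `B` after that. As
    -- `rest` was deleted, the inner vertices then lie outside `T`.
    trimmed : ∀ {a b} → a ∈ LA → b ∈ LB → (w : Star R a b) → Σ (Fin q) λ i → Σ (Fin q) λ j →
      on w (lookup A i) × on w (lookup B j) × Σ (TPath (lookup A i) (lookup B j)) λ p → ∀ {z} → tsup p z → on w z
    trimmed a∈ b∈ w with trimStart LA w a∈
    ... | a' , a'∈ , ε , _ , h = ⊥-elim (A∩B a'∈ b∈)
    ... | a' , a'∈ , r ◅ w' , late , h with trimEnd LB w' b∈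
    ... | b' , b'∈ , w″ , early , h' with half r w″ (λ o → late (h' o)) early
    ... | p , hp with ∈-toList A a'∈ | ∈-toList B b'∈
    ... | i , refl | j , refl = i , j , h (inj₁ refl) , h (inj₂ (h' (on-end w″))) , p , sub
      where
      sub : ∀ {z} → tsup p z → on w z
      sub o with hp o
      ... | inj₁ refl = h (inj₁ refl)
      ... | inj₂ o' = h (inj₂ (h' o'))

    tlink : ¬ ¬ Unord q A B
    tlink = menger R LA LB q >>= λ where
      (inj₂ (Z , |Z| , sep)) → Separated.absurd Z |Z| sep >>= ⊥-elim
      (inj₁ F) → let open Fam F
                     tr = λ i → trimmed (s∈ i) (t∈ i) (w i) in pure (record
        { α = λ i → proj₁ (tr i) ; β = λ i → proj₁ (proj₂ (tr i))
        ; α-inj = λ i j e → disj i j (proj₁ (proj₂ (proj₂ (tr i)))) (subst (on (w j) ∘ lookup A) (sym e) (proj₁ (proj₂ (proj₂ (tr j)))))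
        ; β-inj = λ i j e → disj i j (proj₁ (proj₂ (proj₂ (proj₂ (tr i))))) (subst (on (w j) ∘ lookup B) (sym e) (proj₁ (proj₂ (proj₂ (proj₂ (tr j))))))
        ; path = λ i → proj₁ (proj₂ (proj₂ (proj₂ (proj₂ (tr i)))))
        ; disj = λ i j a b → disj i j (proj₂ (proj₂ (proj₂ (proj₂ (proj₂ (tr i))))) a) (proj₂ (proj₂ (proj₂ (proj₂ (proj₂ (tr j))))) b) })

  -- The order of reachability outside the feedback set, and webs

  _≼_ : Fin n → Fin n → Set
  _≼_ = Star E′

  acyclic : ∀ {u v} → E′ u v → v ≼ u → ⊥
  acyclic {u} {v} r w = hitsT (on w) ((v , on-start w) , λ o → successor w id refl o)
    λ o → stays {P = _∉ T} (λ r _ → proj₂ r) w (proj₂ r) o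
    where
    successor : ∀ {a b x} (w' : Star E′ a b) → (∀ {z} → on w' z → on w z) → b ≡ u → on w' x → Σ (Fin n) λ y → E x y × on w y
    successor ε f refl refl = v , proj₁ r , on-start w
    successor (r' ◅ w') f e (inj₁ refl) = _ , proj₁ r' , f (inj₂ (on-start w'))
    successor (r' ◅ w') f e (inj₂ o) = successor w' (f ∘ inj₂) e o

  antisym : ∀ {u v} → u ≼ v → v ≼ u → u ≡ v
  antisym ε _ = refl
  antisym (r ◅ w) w' = ⊥-elim (acyclic r (w ◅◅ w'))

  T-start : ∀ {u v x} (w : Star E′ u v) → on w x → x ∈ T → x ≡ u
  T-start ε refl _ = refl
  T-start (r ◅ w) (inj₁ e) _ = e
  T-start (r ◅ w) (inj₂ o) x∈ = ⊥-elim (stays {P = _∉ T} (λ r _ → proj₂ r) w (proj₂ r) o x∈)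

  record TFam (M : ℕ) : Set where
    field
      a l b : Fin M → Fin n
      w     : ∀ i → Star E′ (a i) (l i)
      last  : ∀ i → E (l i) (b i)
      a∈T   : ∀ i → a i ∈ T
      b∈T   : ∀ i → b i ∈ T
      disj  : ∀ i j {x} → on (w i) x → on (w j) x → i ≡ j
      b-inj : ∀ i j → b i ≡ b j → i ≡ j
      a≢b   : ∀ i j → a i ≢ b j

  record Web (M : ℕ) : Set where
    field
      P Q : TFam M
      z   : Fin M → Fin M → Fin n
      zP  : ∀ i j → on (TFam.w P i) (z i j)
      zQ  : ∀ i j → on (TFam.w Q j) (z i j)
      z∉T : ∀ i j → z i j ∉ T

  reindex : ∀ {M N} (f : Fin N → Fin M) → (∀ i j → f i ≡ f j → i ≡ j) → TFam M → TFam N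
  reindex f inj F = record
    { a = a ∘ f ; l = l ∘ f ; b = b ∘ f ; w = λ i → w (f i) ; last = λ i → last (f i) ; a∈T = a∈T ∘ f ; b∈T = b∈T ∘ f
    ; disj = λ i j x y → inj i j (disj (f i) (f j) x y) ; b-inj = λ i j e → inj i j (b-inj _ _ e) ; a≢b = λ i j → a≢b (f i) (f j) }
    where open TFam F

  module Op = Linkage (λ x y → TPath y x) tsup
  module Tm = Linkage TPath tsup

  pairCodes : Fin 8 → Bool × Bool × Bool
  pairCodes zero = false , false , false
  pairCodes (suc zero) = false , false , true
  pairCodes (suc (suc zero)) = false , true , false
  pairCodes (suc (suc (suc zero))) = false , true , true
  pairCodes (suc (suc (suc (suc zero)))) = true , false , false
  pairCodes (suc (suc (suc (suc (suc zero))))) = true , false , true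
  pairCodes (suc (suc (suc (suc (suc (suc zero)))))) = true , true , false
  pairCodes (suc (suc (suc (suc (suc (suc (suc _))))))) = true , true , true

  allCodes : ∀ c → Σ (Fin 8) λ i → pairCodes i ≡ c
  allCodes (false , false , false) = zero , refl
  allCodes (false , false , true) = suc zero , refl
  allCodes (false , true , false) = suc (suc zero) , refl
  allCodes (false , true , true) = suc (suc (suc zero)) , refl
  allCodes (true , false , false) = suc (suc (suc (suc zero))) , refl
  allCodes (true , false , true) = suc (suc (suc (suc (suc zero)))) , refl
  allCodes (true , true , false) = suc (suc (suc (suc (suc (suc zero))))) , refl
  allCodes (true , true , true) = suc (suc (suc (suc (suc (suc (suc zero)))))) , refl

  -- The paths P and Q join V and W in both directions; {i , opposite i} is closed under both matchings, so the paths of such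
  -- a block contain a cycle.  Either many blocks are pairwise disjoint, or many P's all meet many Q's.
  module Blocks {K} (V W : Vec (Fin n) (K + K)) (VW! : Unique (toList V ++ toList W)) (VW⊆T : ∀ {x} → x ∈ toList V ++ toList W → x ∈ T)
    {c d : Bool} (LP : Tm.Link (flip′ c) V W) (LQ : Op.Link (flip′ d) V W) where
    private
      module LP = Tm.Link LP
      module LQ = Op.Link LQ
      V! = lookup-toList-injective V (proj₁ (unique-++ (toList V) VW!))
      W! = lookup-toList-injective W (proj₁ (proj₂ (unique-++ (toList V) VW!)))
      V≢W : ∀ i j → lookup V i ≢ lookup W j
      V≢W i j e = proj₂ (proj₂ (unique-++ (toList V) VW!)) (toList-∈ V i) (subst (_∈ toList W) (sym e) (toList-∈ W j))

    famP famQ : TFam (K + K)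
    famP = record
      { a = lookup V ; l = λ i → proj₁ (LP.path i) ; b = λ i → lookup W (flip′ c i)
      ; w = λ i → proj₁ (proj₂ (LP.path i)) ; last = λ i → proj₂ (proj₂ (LP.path i))
      ; a∈T = λ i → VW⊆T (Mₚ.∈-++⁺ˡ (toList-∈ V i)) ; b∈T = λ i → VW⊆T (Mₚ.∈-++⁺ʳ (toList V) (toList-∈ W _))
      ; disj = LP.disj ; b-inj = λ i j e → flip′-injective c i j (W! _ _ e) ; a≢b = λ i j → V≢W i _ }
    famQ = record
      { a = λ i → lookup W (flip′ d i) ; l = λ i → proj₁ (LQ.path i) ; b = lookup V
      ; w = λ i → proj₁ (proj₂ (LQ.path i)) ; last = λ i → proj₂ (proj₂ (LQ.path i))
      ; a∈T = λ i → VW⊆T (Mₚ.∈-++⁺ʳ (toList V) (toList-∈ W _)) ; b∈T = λ i → VW⊆T (Mₚ.∈-++⁺ˡ (toList-∈ V i))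
      ; disj = LQ.disj ; b-inj = V! ; a≢b = λ i j e → V≢W j _ (sym e) }

    pos : Bool → Fin K → Fin (K + K)
    pos e b = flip′ e (b F.↑ˡ K)

    mirror-pos : ∀ e b → mirror (pos e b) ≡ toℕ b
    mirror-pos e b = trans (mirror-flip′ e _) (mirror-↑ˡ b)

    pos-injective : ∀ e e' b b' → pos e b ≡ pos e' b' → b ≡ b'
    pos-injective e e' b b' h = Fₚ.toℕ-injective (trans (sym (mirror-pos e b)) (trans (cong mirror h) (mirror-pos e' b')))

    Meet : Bool → Bool → Fin K → Fin K → Set
    Meet η δ b b' = Σ (Fin n) λ x → on (TFam.w famP (pos η b)) x × on (TFam.w famQ (pos δ b')) x

    Pred : Bool × Bool × Bool → Vec (Fin K) 2 → Set
    Pred (η , δ , false) Z = Meet η δ (lookup Z zero) (lookup Z (suc zero))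
    Pred (η , δ , true) Z = Meet η δ (lookup Z (suc zero)) (lookup Z zero)

    module _ (L : List (Fin K)) (L! : Unique L) where
      idx : ∀ {m} → m ≤ length L → Fin m → Fin K
      idx h i = L.lookup L (F.inject≤ i h)

      idx-injective : ∀ {m} (h : m ≤ length L) i j → idx h i ≡ idx h j → i ≡ j
      idx-injective h i j e = Fₚ.inject≤-injective h h i j (lookup-injective L! _ _ e)

      cycles : ∀ {m} → m ≤ length L → (∀ η δ d (Z : Vec (Fin K) 2) → toList Z ⊆ L → ¬ Pred (η , δ , d) Z) → Packing E m
      cycles {m} h none = packPieces E pieces (λ i → false , i , false) λ i j e → e
        where
        fam : Bool → TFam (K + K)
        fam false = famP
        fam true = famQ
        -- After the `P` with index `x` comes the `Q` that starts at the same vertex of `W`: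
        -- `flip′ d` of its index must be `flip′ c x`, whence the twist `c xor d`. The `Q` with
        -- index `x` ends where the `P` with index `x` starts.
        sh : Bool → Bool
        sh false = c xor d
        sh true = false
        at : Bool → Fin m → Fin (K + K)
        at η i = pos η (idx h i)
        close : ∀ t η i → E (TFam.l (fam t) (at η i)) (TFam.a (fam (not t)) (at (sh t xor η) i))
        close false η i = subst (λ u → E (proj₁ (LP.path (at η i))) (lookup W u)) (sym e) (TFam.last famP (at η i))
          where
          e : flip′ d (flip′ ((c xor d) xor η) (idx h i F.↑ˡ K)) ≡ flip′ c (at η i)
          e = trans (flip′-xor d _ _) (trans (cong (λ t → flip′ t (idx h i F.↑ˡ K)) (x c d η)) (sym (flip′-xor c η _)))
            where
            x : ∀ c d η → d xor ((c xor d) xor η) ≡ c xor η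
            x false false η = refl
            x true false η = refl
            x false true false = refl
            x false true true = refl
            x true true false = refl
            x true true true = refl
        close true η i = TFam.last famQ (at η i)
        apart : ∀ η δ i j → Meet η δ (idx h i) (idx h j) → i ≡ j
        apart η δ i j p with Fₚ.<-cmp i j
        ... | tri< lt _ _ = ⊥-elim (none η δ false (_ ∷ _ ∷ []) (pick2 L (inject≤-< h i j lt)) p)
        ... | tri≈ _ e _ = e
        ... | tri> _ _ gt = ⊥-elim (none η δ true (_ ∷ _ ∷ []) (pick2 L (inject≤-< h j i gt)) p)
        disj : ∀ t t' η η' i j {x} → on (TFam.w (fam t) (at η i)) x → on (TFam.w (fam t') (at η' j)) x → i ≡ j
        disj false false η η' i j o o' = idx-injective h i j (pos-injective η η' _ _ (LP.disj _ _ o o'))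
        disj true true η η' i j o o' = idx-injective h i j (pos-injective η η' _ _ (LQ.disj _ _ o o'))
        disj false true η η' i j o o' = apart η η' i j (_ , o , o')
        disj true false η η' i j o o' = sym (apart η' η j i (_ , o' , o))
        pieces : Pieces E (Bool × Fin m × Bool) (Fin m)
        pieces = record
          { R = E′ ; R⇒E = proj₁
          ; s = λ (η , i , t) → TFam.a (fam t) (at η i) ; l = λ (η , i , t) → TFam.l (fam t) (at η i)
          ; next = λ (η , i , t) → sh t xor η , i , not t ; w = λ (η , i , t) → TFam.w (fam t) (at η i)
          ; close = λ (η , i , t) → close t η i ; block = λ (_ , i , _) → i ; block-next = λ _ → refl
          ; disj = λ (η , i , t) (η' , j , t') → disj t t' η η' i j }

      -- Rows come from the first half of `L` and columns from the second, so all pairs have the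
      -- order that the predicate speaks about. If it puts the `Q` pair first, the two families
      -- exchange roles.
      web : ∀ {m} → m + m ≤ length L → ∀ η δ d → (∀ Z → toList Z ⊆ L → Pred (η , δ , d) Z) → Web m
      web {m} h η δ d all = go d all
        where
        fst snd : Fin m → Fin K
        fst i = idx h (i F.↑ˡ m)
        snd j = idx h (m F.↑ʳ j)
        fst<snd : ∀ i j → fst i ∷ snd j ∷ [] ⊆ L
        fst<snd i j = pick2 L (inject≤-< h _ _ (subst₂ _<_ (sym (Fₚ.toℕ-↑ˡ i m)) (sym (Fₚ.toℕ-↑ʳ m j)) (ℕₚ.<-≤-trans (Fₚ.toℕ<n i) (ℕₚ.m≤m+n m (toℕ j)))))
        fst! : ∀ i j → fst i ≡ fst j → i ≡ j
        fst! i j e = Fₚ.↑ˡ-injective m i j (idx-injective h _ _ e)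
        snd! : ∀ i j → snd i ≡ snd j → i ≡ j
        snd! i j e = Fₚ.↑ʳ-injective m i j (idx-injective h _ _ e)
        sel : (f : Fin m → Fin K) → (∀ i j → f i ≡ f j → i ≡ j) → Bool → TFam (K + K) → TFam m
        sel f f! e = reindex (pos e ∘ f) λ i j h → f! i j (pos-injective e e _ _ h)
        -- A walk meets `T` only in its start, which lies in `V` for `P` and in `W` for `Q`.
        ∉T : ∀ {i j x} → on (TFam.w famP i) x → on (TFam.w famQ j) x → x ∉ T
        ∉T {i} {j} o o' x∈ = V≢W i _ (trans (sym (T-start (TFam.w famP i) o x∈)) (T-start (TFam.w famQ j) o' x∈))
        go : ∀ d → (∀ Z → toList Z ⊆ L → Pred (η , δ , d) Z) → Web m
        go false all = record { P = sel fst fst! η famP ; Q = sel snd snd! δ famQ ; z = λ i j → proj₁ (M i j)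
          ; zP = λ i j → proj₁ (proj₂ (M i j)) ; zQ = λ i j → proj₂ (proj₂ (M i j)) ; z∉T = λ i j → ∉T (proj₁ (proj₂ (M i j))) (proj₂ (proj₂ (M i j))) }
          where
          M : ∀ i j → Meet η δ (fst i) (snd j)
          M i j = all (_ ∷ _ ∷ []) (fst<snd i j)
        go true all = record { P = sel fst fst! δ famQ ; Q = sel snd snd! η famP ; z = λ i j → proj₁ (M i j)
          ; zP = λ i j → proj₂ (proj₂ (M i j)) ; zQ = λ i j → proj₁ (proj₂ (M i j)) ; z∉T = λ i j → ∉T (proj₁ (proj₂ (M i j))) (proj₂ (proj₂ (M i j))) }
          where
          M : ∀ i j → Meet η δ (snd j) (fst i)
          M i j = all (_ ∷ _ ∷ []) (fst<snd i j)

    find : ∀ m → proj₁ (ramsey* 2 ((m + m) ⊔ suc k) 8) ≤ K → ¬ ¬ Web m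
    find m h = do
      L , L⊆ , len , hom ← proj₂ (ramsey* 2 ((m + m) ⊔ suc k) 8) (Pred ∘ pairCodes) (allFin K) (subst (_ ≤_) (sym (Lₚ.length-tabulate id)) h)
      let L! = unique-⊆ L⊆ (Uₚ.allFin⁺ K)
          hom' : ∀ η δ d → Homog (Pred (η , δ , d)) L
          hom' = λ η δ d → subst (λ c → Homog (Pred c) L) (proj₂ (allCodes (η , δ , d))) (hom (proj₁ (allCodes (η , δ , d))))
      pos? ← em (Σ (Bool × Bool × Bool) λ c → ∀ Z → toList Z ⊆ L → Pred c Z)
      decide L L! len hom' pos?
      where
      decide : ∀ L → Unique L → (m + m) ⊔ suc k ≤ length L → (∀ η δ d → Homog (Pred (η , δ , d)) L) →
        Dec (Σ (Bool × Bool × Bool) λ c → ∀ Z → toList Z ⊆ L → Pred c Z) → ¬ ¬ Web m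
      decide L L! len hom (yes ((η , δ , d) , all)) = pure (web L L! (ℕₚ.≤-trans (ℕₚ.m≤m⊔n (m + m) (suc k)) len) η δ d all)
      decide L L! len hom (no ¬p) = λ _ → ¬pack (cycles L L! (ℕₚ.≤-trans (ℕₚ.m≤n⊔m (m + m) (suc k)) len) neg)
        where
        neg : ∀ η δ d Z → toList Z ⊆ L → ¬ Pred (η , δ , d) Z
        neg η δ d with hom η δ d
        ... | inj₁ a = ⊥-elim (¬p (_ , a))
        ... | inj₂ na = na

  -- In `L₁` earlier tuples are linked to later ones, and in the sublist `L₂` later ones also to
  -- earlier ones; splitting `L₂` gives `V` and `W` with linkages both ways.
  findWeb : ∀ m → linkedSize k s m ≤ length T → ¬ ¬ Web m
  findWeb m h = do
    L₁ , s₁ , h₁ , c , linkP ← Tm.homogenize κ _ r es≤r T h λ V W VW⊆ →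
      TLink.tlink V W 2s≤ (unique-⊆ VW⊆ T!) (Sub.lookup VW⊆)
    L₂ , s₂ , h₂ , d , linkQ ← Op.homogenize κ (κ + κ) r es≤r L₁ h₁ λ V W VW⊆ → do
      let sub = ⊆-trans VW⊆ s₁
          swap : ∀ {x} → x ∈ toList W ++ toList V → x ∈ toList V ++ toList W
          swap p = swap-∈ (toList W) p
      U ← TLink.tlink W V 2s≤ (unique-swap (toList V) (unique-⊆ sub T!)) (Sub.lookup sub ∘ swap)
      let open Tm.Unord U
      pure (record { α = β ; β = α ; α-inj = β-inj ; β-inj = α-inj ; path = path ; disj = disj })
    let Z , Z⊆ = vecOf (κ + κ) L₂ h₂
    build L₁ s₁ c linkP L₂ s₂ d linkQ Z Z⊆ (V.splitAt κ Z)
    where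
    κ = webSize k m + webSize k m
    r = proj₁ (es κ) ⊔ (s + s)
    es≤r = ℕₚ.m≤m⊔n (proj₁ (es κ)) (s + s)
    2s≤ = ℕₚ.m≤n⊔m (proj₁ (es κ)) (s + s)
    build : ∀ L₁ → L₁ ⊆ T → ∀ c → (∀ (V W : Vec (Fin n) κ) → toList V ++ toList W ⊆ L₁ → Tm.Link (flip′ c) V W) →
      ∀ L₂ → L₂ ⊆ L₁ → ∀ d → (∀ (V W : Vec (Fin n) κ) → toList V ++ toList W ⊆ L₂ → Op.Link (flip′ d) V W) →
      ∀ Z → toList Z ⊆ L₂ → (Σ (Vec (Fin n) κ) λ V → Σ (Vec (Fin n) κ) λ W → Z ≡ V V.++ W) → ¬ ¬ Web m
    build L₁ s₁ c linkP L₂ s₂ d linkQ _ Z⊆ (V , W , refl) = Blocks.find {K = webSize k m} V W (unique-⊆ sub T!) (Sub.lookup sub) {c} {d}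
        (linkP V W (⊆-trans VW⊆ s₂)) (linkQ V W VW⊆) m ℕₚ.≤-refl
      where
      VW⊆ : toList V ++ toList W ⊆ L₂
      VW⊆ = subst (_⊆ L₂) (Vₚ.toList-++ V W) Z⊆
      sub = ⊆-trans VW⊆ (⊆-trans s₂ s₁)

  -- Acyclic grids

  record Grid (M : ℕ) : Set where
    field
      P Q : TFam M
      z   : Fin M → Fin M → Fin n
      zP  : ∀ i j → on (TFam.w P i) (z i j)
      zQ  : ∀ i j → on (TFam.w Q j) (z i j)
      z∉T : ∀ i j → z i j ∉ T
      along-P : ∀ u {w y} → w F.< y → z u w ≼ z u y
      along-Q : ∀ w {u v} → u F.< v → z u w ≼ z v w
      no-back : ∀ {u v w y} → u F.< v → w F.< y → ¬ z u y ≼ z v w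

    -- For `i < i'` this is `no-back`; otherwise the comparison closes a chain, and by antisymmetry
    -- two columns would share a vertex. It allows cutting the grid between columns: what lies
    -- before the earlier ones contains no point of a later one.
    later : ∀ i i' {w y} → w F.< y → ¬ z i y ≼ z i' w
    later i i' {w} {y} w<y h with Fₚ.<-cmp i i'
    ... | tri< lt _ _ = no-back lt w<y h
    ... | tri≈ _ refl _ = ℕₚ.<⇒≢ w<y (cong toℕ (TFam.disj Q w y (zQ i w) (subst (on (TFam.w Q y)) (antisym h (along-P i w<y)) (zQ i y))))
    ... | tri> _ _ gt = ℕₚ.<⇒≢ w<y (cong toℕ (TFam.disj Q w y (zQ i' w) (subst (on (TFam.w Q y)) (antisym h (along-Q w gt ◅◅ along-P i w<y)) (zQ i y))))

  choose : ∀ {A : Set} → Bool → A → A → A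
  choose false x y = x
  choose true  x y = y

  module Normalise {M : ℕ} (web : Web (gridSize M)) where
    open Web web
    private
      N = gridSize M

    -- Whether rows and columns have to be reversed is known only after passing to the homogeneous
    -- list, so the backward comparison is prepared for all four cases.
    PX : Bool → Bool → Vec (Fin N) 4 → Set
    PX r c (u ∷ v ∷ w ∷ y ∷ []) = z (choose r u v) (choose c y w) ≼ z (choose r v u) (choose c w y)

    preds : Fin 6 → Vec (Fin N) 4 → Set
    preds zero (u ∷ v ∷ w ∷ y ∷ []) = z u w ≼ z u y
    preds (suc zero) (u ∷ v ∷ w ∷ y ∷ []) = z u w ≼ z v w
    preds (suc (suc zero)) = PX false false
    preds (suc (suc (suc zero))) = PX false true
    preds (suc (suc (suc (suc zero)))) = PX true false
    preds (suc (suc (suc (suc (suc _))))) = PX true true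

    module _ (L : List (Fin N)) (L! : Unique L) (len : suc M + suc M ≤ length L) (hom : ∀ i → Homog (preds i) L) where
      at : Fin (suc M + suc M) → Fin N
      at i = L.lookup L (F.inject≤ i len)

      at! : ∀ i j → at i ≡ at j → i ≡ j
      at! i j e = Fₚ.inject≤-injective len len i j (lookup-injective L! _ _ e)

      -- The last index of each half is spared: it fills the coordinate of a quadruple that the two
      -- order predicates ignore.
      e₁ e₂ : Fin M → Fin (suc M + suc M)
      e₁ u = F.inject₁ u F.↑ˡ suc M
      e₂ u = suc M F.↑ʳ F.inject₁ u


      <₁ : ∀ {u v : Fin (suc M)} → u F.< v → (u F.↑ˡ suc M) F.< (v F.↑ˡ suc M)
      <₁ {u} {v} = subst₂ _<_ (sym (Fₚ.toℕ-↑ˡ u (suc M))) (sym (Fₚ.toℕ-↑ˡ v (suc M)))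

      <₂ : ∀ {u v : Fin (suc M)} → u F.< v → (suc M F.↑ʳ u) F.< (suc M F.↑ʳ v)
      <₂ {u} {v} lt = subst₂ _<_ (sym (Fₚ.toℕ-↑ʳ (suc M) u)) (sym (Fₚ.toℕ-↑ʳ (suc M) v)) (ℕₚ.+-monoʳ-< (suc M) lt)

      <₁₂ : ∀ (u v : Fin (suc M)) → (u F.↑ˡ suc M) F.< (suc M F.↑ʳ v)
      <₁₂ u v = subst₂ _<_ (sym (Fₚ.toℕ-↑ˡ u (suc M))) (sym (Fₚ.toℕ-↑ʳ (suc M) v)) (ℕₚ.<-≤-trans (Fₚ.toℕ<n u) (ℕₚ.m≤m+n (suc M) (toℕ v)))

      inj< : ∀ {u v : Fin M} → u F.< v → F.inject₁ u F.< F.inject₁ v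
      inj< {u} {v} = subst₂ _<_ (sym (Fₚ.toℕ-inject₁ u)) (sym (Fₚ.toℕ-inject₁ v))

      <last : ∀ (u : Fin M) → F.inject₁ u F.< F.fromℕ M
      <last u = subst₂ _<_ (sym (Fₚ.toℕ-inject₁ u)) (sym (Fₚ.toℕ-fromℕ M)) (Fₚ.toℕ<n u)

      quad : ∀ {u v w y : Fin (suc M)} → u F.< v → w F.< y →
        toList (at (u F.↑ˡ suc M) ∷ at (v F.↑ˡ suc M) ∷ at (suc M F.↑ʳ w) ∷ at (suc M F.↑ʳ y) ∷ []) ⊆ L
      quad {u} {v} {w} {y} u<v w<y = pick4 L (inject≤-< len _ _ (<₁ u<v)) (inject≤-< len _ _ (<₁₂ v w)) (inject≤-< len _ _ (<₂ w<y))

      quad′ : ∀ {u v w y : Fin M} → u F.< v → w F.< y → toList (at (e₁ u) ∷ at (e₁ v) ∷ at (e₂ w) ∷ at (e₂ y) ∷ []) ⊆ L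
      quad′ u<v w<y = quad (inj< u<v) (inj< w<y)

      comparable : ∀ {u v x y} (w : Star E′ u v) → on w x → on w y → ¬ x ≼ y → y ≼ x
      comparable w ox oy h with between w ox oy
      ... | inj₁ p = ⊥-elim (h (proj₁ p))
      ... | inj₂ p = proj₁ p

      Z : Fin M → Fin M → Fin n
      Z u w = z (at (e₁ u)) (at (e₂ w))

      orderP : Σ Bool λ c → ∀ u {w y} → w F.< y → Z u (flip′ c w) ≼ Z u (flip′ c y)
      orderP with hom zero
      ... | inj₁ h = false , λ u w<y → h (_ ∷ _ ∷ _ ∷ _ ∷ []) (quad (<last u) (inj< w<y))
      ... | inj₂ h = true , λ u {w} {y} w<y → comparable (TFam.w P _) (zP _ _) (zP _ _)
            (h (_ ∷ _ ∷ _ ∷ _ ∷ []) (quad (<last u) (inj< (opposite-< w y w<y))))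

      orderQ : Σ Bool λ r → ∀ w {u v} → u F.< v → Z (flip′ r u) w ≼ Z (flip′ r v) w
      orderQ with hom (suc zero)
      ... | inj₁ h = false , λ w u<v → h (_ ∷ _ ∷ _ ∷ _ ∷ []) (quad (inj< u<v) (<last w))
      ... | inj₂ h = true , λ w {u} {v} u<v → comparable (TFam.w Q _) (zQ _ _) (zQ _ _)
            (h (_ ∷ _ ∷ _ ∷ _ ∷ []) (quad (inj< (opposite-< u v u<v)) (<last w)))

      Back : Bool → Bool → Fin M → Fin M → Fin M → Fin M → Set
      Back r c u v w y = Z (flip′ r u) (flip′ c y) ≼ Z (flip′ r v) (flip′ c w)

      AllOrNone : ∀ r c → Set
      AllOrNone r c = (∀ {u v w y} → u F.< v → w F.< y → Back r c u v w y) ⊎ (∀ {u v w y} → u F.< v → w F.< y → ¬ Back r c u v w y)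

      back : ∀ r c → AllOrNone r c
      back false false with hom (suc (suc zero))
      ... | inj₁ h = inj₁ λ p q → h (_ ∷ _ ∷ _ ∷ _ ∷ []) (quad′ p q)
      ... | inj₂ h = inj₂ λ p q → h (_ ∷ _ ∷ _ ∷ _ ∷ []) (quad′ p q)
      back false true with hom (suc (suc (suc zero)))
      ... | inj₁ h = inj₁ λ p q → h (_ ∷ _ ∷ _ ∷ _ ∷ []) (quad′ p (opposite-< _ _ q))
      ... | inj₂ h = inj₂ λ p q → h (_ ∷ _ ∷ _ ∷ _ ∷ []) (quad′ p (opposite-< _ _ q))
      back true false with hom (suc (suc (suc (suc zero))))
      ... | inj₁ h = inj₁ λ p q → h (_ ∷ _ ∷ _ ∷ _ ∷ []) (quad′ (opposite-< _ _ p) q)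
      ... | inj₂ h = inj₂ λ p q → h (_ ∷ _ ∷ _ ∷ _ ∷ []) (quad′ (opposite-< _ _ p) q)
      back true true with hom (suc (suc (suc (suc (suc zero)))))
      ... | inj₁ h = inj₁ λ p q → h (_ ∷ _ ∷ _ ∷ _ ∷ []) (quad′ (opposite-< _ _ p) (opposite-< _ _ q))
      ... | inj₂ h = inj₂ λ p q → h (_ ∷ _ ∷ _ ∷ _ ∷ []) (quad′ (opposite-< _ _ p) (opposite-< _ _ q))

      famP famQ : Bool → TFam M
      famP r = reindex (at ∘ e₁ ∘ flip′ r) (λ i j e → flip′-injective r i j (Fₚ.inject₁-injective (Fₚ.↑ˡ-injective (suc M) _ _ (at! _ _ e)))) P
      famQ c = reindex (at ∘ e₂ ∘ flip′ c) (λ i j e → flip′-injective c i j (Fₚ.inject₁-injective (Fₚ.↑ʳ-injective (suc M) _ _ (at! _ _ e)))) Q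

      -- If every point lies before the points below and to its left, exchanging rows and columns excludes this.
      grid : Grid M
      grid with orderP | orderQ
      ... | c , oP | r , oQ with back r c
      ... | inj₂ none = record
        { P = famP r ; Q = famQ c ; z = λ i j → Z (flip′ r i) (flip′ c j) ; zP = λ i j → zP _ _ ; zQ = λ i j → zQ _ _ ; z∉T = λ i j → z∉T _ _
        ; along-P = λ u → oP (flip′ r u) ; along-Q = λ w → oQ (flip′ c w) ; no-back = none }
      ... | inj₁ all = record
        { P = famQ c ; Q = famP r ; z = λ j i → Z (flip′ r i) (flip′ c j) ; zP = λ i j → zQ _ _ ; zQ = λ i j → zP _ _ ; z∉T = λ i j → z∉T _ _
        ; along-P = λ w → oQ (flip′ c w) ; along-Q = λ u → oP (flip′ r u)
        ; no-back = λ {w} {y} {u} {v} w<y u<v h → ℕₚ.<⇒≢ u<v (cong toℕ (TFam.disj (famP r) u v (zP _ _)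
            (subst (on (TFam.w (famP r) v)) (antisym h (all u<v w<y)) (zP _ _)))) }

    normalise : ¬ ¬ Grid M
    normalise = do
      L , L⊆ , len , hom ← proj₂ (ramsey* 4 (suc M + suc M) 6) preds (allFin N) (ℕₚ.≤-reflexive (sym (Lₚ.length-tabulate id)))
      pure (grid L (unique-⊆ L⊆ (Uₚ.allFin⁺ N)) len hom)

  findGrid : ∀ M → linkedSize k s (gridSize M) ≤ length T → ¬ ¬ Grid M
  findGrid M h = do
    web ← findWeb (gridSize M) h
    Normalise.normalise web

  -- Cutting a grid into stages

  upward : ∀ {Δ : Fin n → Set} → (∀ {u v} → u ≼ v → Δ v → Δ u) → ∀ {u v} (w : Star E′ u v) → ¬ Δ u → ∀ {x} → on w x → ¬ Δ x
  upward down w ¬Δ o Δx = ¬Δ (down (proj₁ (prefix w o)) Δx)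

  downward : ∀ {Δ : Fin n → Set} → (∀ {u v} → u ≼ v → Δ v → Δ u) → ∀ {u v} (w : Star E′ u v) → Δ v → ∀ {x} → on w x → Δ x
  downward down w Δv o = down (proj₁ (suffix w o)) Δv

  along : ∀ {u v x y} (w : Star E′ u v) → on w x → on w y → x ≼ y → WalkIn′ E′ (on w) x y
  along w ox oy h with between w ox oy
  ... | inj₁ p = p
  ... | inj₂ (p , _) with refl ← antisym h p = ε , λ { refl → ox }

  -- For a down-set the walk never re-enters, so `cover` can place each vertex before the exit or
  -- after the entry.
  record Crossing (Δ : Fin n → Set) {a l : Fin n} (w : Star E′ a l) : Set where
    field
      exit entry : Fin n
      edge    : E′ exit entry
      exit∈   : on w exit
      entry∈  : on w entry
      inside  : Δ exit
      outside : ¬ Δ entry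
      cover   : ∀ {y} → on w y → WalkIn′ E′ (on w) y exit ⊎ WalkIn′ E′ (on w) entry y

  crossing : ∀ {Δ : Fin n → Set} → (∀ x → Dec (Δ x)) → ∀ {a l} (w : Star E′ a l) → Δ a → ∀ {x} → on w x → ¬ Δ x → Crossing Δ w
  crossing Δ? ε Δa refl ¬Δx = ⊥-elim (¬Δx Δa)
  crossing Δ? (r ◅ w) Δa (inj₁ refl) ¬Δx = ⊥-elim (¬Δx Δa)
  crossing Δ? {a} (_◅_ {j = v} r w) Δa (inj₂ o) ¬Δx with Δ? v
  ... | no ¬Δv = record { exit = a ; entry = v ; edge = r ; exit∈ = inj₁ refl ; entry∈ = inj₂ (on-start w) ; inside = Δa ; outside = ¬Δv
        ; cover = λ { (inj₁ refl) → inj₁ (ε , λ { refl → inj₁ refl }) ; (inj₂ q) → inj₂ (weaken inj₂ (prefix w q)) } }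
  ... | yes Δv = record { Crossing c ; exit∈ = inj₂ exit∈ ; entry∈ = inj₂ entry∈ ; cover = cov }
    where
    c = crossing Δ? w Δv o ¬Δx
    open Crossing c
    cov : ∀ {y} → on (r ◅ w) y → WalkIn′ E′ (on (r ◅ w)) y exit ⊎ WalkIn′ E′ (on (r ◅ w)) entry y
    cov (inj₁ refl) with p , h ← prefix w exit∈ = inj₁ (r ◅ p , λ { (inj₁ e) → inj₁ e ; (inj₂ q) → inj₂ (h q) })
    cov (inj₂ q) with cover q
    ... | inj₁ p = inj₁ (weaken inj₂ p)
    ... | inj₂ p = inj₂ (weaken inj₂ p)

  module Cuts (S m : ℕ) (κ₀ : Fin m) (G : Grid (S * m)) where
    open Grid G
    module P = TFam P
    module Q = TFam Q

    -- Rows and columns alike are numbered by a stage and one of `m` lanes, the stage first; a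
    -- smaller stage means an earlier row or column.
    ix : Fin S → Fin m → Fin (S * m)
    ix = F.combine

    ix-injective : ∀ a {i j} → ix a i ≡ ix a j → i ≡ j
    ix-injective a e = proj₂ (Fₚ.combine-injective a _ a _ e)

    ix-< : ∀ {a b i j} → a F.< b → ix a i F.< ix b j
    ix-< lt = Fₚ.combine-monoˡ-< _ _ lt

    -- By `later` no grid point in a column of stage `c` or beyond belongs to `Δ c`, so every row
    -- leaves `Δ c` before these columns. Including `T` keeps this a down-set, since no arc of `E′`
    -- enters `T`.
    Δ : Fin S → Fin n → Set
    Δ c w = w ∈ T ⊎ Σ (Fin (S * m)) λ i → Σ (Fin S) λ t → Σ (Fin m) λ κ → t F.< c × w ≼ z i (ix t κ)

    Δ-down : ∀ c {u v} → u ≼ v → Δ c v → Δ c u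
    Δ-down c ε h = h
    Δ-down c (r ◅ w) (inj₁ v∈) = ⊥-elim (stays {P = _∉ T} (λ r _ → proj₂ r) w (proj₂ r) (on-end w) v∈)
    Δ-down c w (inj₂ (i , t , κ , lt , w')) = inj₂ (i , t , κ , lt , w ◅◅ w')

    Δ-mono : ∀ {c d} → c F.≤ d → ∀ {x} → Δ c x → Δ d x
    Δ-mono h (inj₁ x∈) = inj₁ x∈
    Δ-mono h (inj₂ (i , t , κ , lt , w)) = inj₂ (i , t , κ , ℕₚ.<-≤-trans lt h , w)

    z∈Δ : ∀ {c t} → t F.< c → ∀ i κ → Δ c (z i (ix t κ))
    z∈Δ lt i κ = inj₂ (i , _ , κ , lt , ε)

    z∉Δ : ∀ {c t} → c F.≤ t → ∀ i κ → ¬ Δ c (z i (ix t κ))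
    z∉Δ h i κ (inj₁ z∈) = z∉T _ _ z∈
    z∉Δ h i κ (inj₂ (i' , t' , κ' , lt , w)) = later i i' (ix-< (ℕₚ.<-≤-trans lt h)) w

    module _ (Δ? : ∀ c x → Dec (Δ c x)) where
      cut : ∀ c i → Crossing (Δ c) (P.w i)
      cut c i = crossing (Δ? c) (P.w i) (inj₁ (P.a∈T i)) (zP i (ix c κ₀)) (z∉Δ ℕₚ.≤-refl i κ₀)

      ex en : Fin S → Fin (S * m) → Fin n
      ex c i = Crossing.exit (cut c i)
      en c i = Crossing.entry (cut c i)

      toExit : ∀ c i {x} → on (P.w i) x → Δ c x → WalkIn′ E′ (on (P.w i)) x (ex c i)
      toExit c i o Δx with Crossing.cover (cut c i) o
      ... | inj₁ p = p
      ... | inj₂ (p , _) = ⊥-elim (Crossing.outside (cut c i) (Δ-down c p Δx))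

      fromEntry : ∀ c i {x} → on (P.w i) x → ¬ Δ c x → WalkIn′ E′ (on (P.w i)) (en c i) x
      fromEntry c i o ¬Δx with Crossing.cover (cut c i) o
      ... | inj₂ p = p
      ... | inj₁ (p , _) = ⊥-elim (¬Δx (Δ-down c p (Crossing.inside (cut c i))))

      Rows : Fin (S * m) → Fin (S * m) → Fin (S * m) → Fin n → Set
      Rows i j i' x = on (P.w i) x ⊎ on (Q.w j) x ⊎ on (P.w i') x

      switch : ∀ {i i' j} → i F.< i' → WalkIn′ E′ (on (Q.w j)) (z i j) (z i' j)
      switch {i} {i'} {j} lt = along (Q.w j) (zQ i j) (zQ i' j) (along-Q j lt)

      descend : ∀ c t {i i'} κ → c F.≤ t → i F.< i' → WalkIn′ E′ (Rows i (ix t κ) i') (en c i) (z i' (ix t κ))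
      descend c t {i} {i'} κ c≤t lt = weaken inj₁ (fromEntry c i (zP i (ix t κ)) (z∉Δ c≤t i κ)) ⊕ weaken (inj₂ ∘ inj₁) (switch lt)

      hop : ∀ c t d {i i'} κ → c F.≤ t → t F.< d → i F.< i' → WalkIn′ E′ (Rows i (ix t κ) i') (en c i) (ex d i')
      hop c t d {i} {i'} κ c≤t t<d lt = descend c t κ c≤t lt ⊕ weaken (inj₂ ∘ inj₂) (toExit d i' (zP i' (ix t κ)) (z∈Δ t<d i' κ))

      -- Rows of stage `lo` precede rows of stage `hi`, so from any lane of `lo` any column of stage
      -- `lo` leads to any lane of `hi`. The vertices used lie in `Δ hi` but not in `Δ lo`, which
      -- keeps successive steps disjoint.
      record Step : Set where
        constructor step
        field
          lo hi : Fin S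
          lo<hi : lo F.< hi
        stage : ∀ (i κ j : Fin m) → WalkIn′ E′ (Rows (ix lo i) (ix lo κ) (ix hi j)) (en lo (ix lo i)) (ex hi (ix hi j))
        stage i κ j = hop lo lo hi κ ℕₚ.≤-refl lo<hi (ix-< lo<hi)

        K : Fin n → Set
        K x = Σ (Fin m) λ i → Σ (Fin m) λ κ → Σ (Fin m) λ j → on (proj₁ (stage i κ j)) x

        K-above : ∀ {x} → K x → ¬ Δ lo x
        K-above (i , κ , j , o) = upward (Δ-down lo) (proj₁ (stage i κ j)) (Crossing.outside (cut lo _)) o

        K-below : ∀ {x} → K x → Δ hi x
        K-below (i , κ , j , o) = downward (Δ-down hi) (proj₁ (stage i κ j)) (Crossing.inside (cut hi _)) o

        LanePath : Fin m → Fin m → Set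
        LanePath i j = WalkIn′ E′ K (en lo (ix lo i)) (ex hi (ix hi j))

        lsup : ∀ {i j} → LanePath i j → Fin n → Set
        lsup (w , _) = on w

        -- A separator of fewer than `r` vertices misses a source row, a column and a target row,
        -- and the stage walk along these three contradicts it.
        stageLink : ∀ {r} (X Y : Vec (Fin m) r) → Unique (toList X) → Unique (toList Y) → r ≤ m → ¬ ¬ Linkage.Unord LanePath lsup r X Y
        stageLink {r} X Y X! Y! r≤m = menger R (L.tabulate src) (L.tabulate tgt) r >>= found
          where
          R : Fin n → Fin n → Set
          R u v = E′ u v × K u × K v
          src tgt : Fin r → Fin n
          src i = en lo (ix lo (lookup X i))
          tgt i = ex hi (ix hi (lookup Y i))
          inK : ∀ {u v} → K u → (w : Star R u v) → ∀ {x} → on w x → K x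
          inK h w = stays (λ r _ → proj₂ (proj₂ r)) w h
          srcK : ∀ i → K (src i)
          srcK i = lookup X i , κ₀ , κ₀ , on-start (proj₁ (stage (lookup X i) κ₀ κ₀))
          found : Fam R r (L.tabulate src) (L.tabulate tgt) ⊎ Sep R r (L.tabulate src) (L.tabulate tgt) → ¬ ¬ _
          found (inj₁ F) = pure (famUnord proj₁ (λ i → en lo (ix lo i)) (λ i → ex hi (ix hi i)) X Y F λ i →
            inK (subst K (sym (proj₂ (Mₚ.∈-tabulate⁻ (Fam.s∈ F i)))) (srcK _)) (Fam.w F i))
          found (inj₂ (Z , |Z| , sep)) = do
            i , avi ← survivor Z (λ i → on (P.w (ix lo (lookup X i)))) (λ i j a b → lookup-toList-injective X X! i j (ix-injective lo (P.disj _ _ a b))) |Z|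
            κ , avκ ← survivor Z (λ κ → on (Q.w (ix lo κ))) (λ i j a b → ix-injective lo (Q.disj _ _ a b)) (ℕₚ.<-≤-trans |Z| r≤m)
            j , avj ← survivor Z (λ i → on (P.w (ix hi (lookup Y i)))) (λ i j a b → lookup-toList-injective Y Y! i j (ix-injective hi (P.disj _ _ a b))) |Z|
            let st = stage (lookup X i) κ (lookup Y j)
                w , h = restrict {R' = R} {P = λ x → K x × on (proj₁ st) x} {Q = on (proj₁ st)} (λ r a b → r , proj₁ a , proj₁ b) proj₂
                          (proj₁ st , λ o → (lookup X i , κ , lookup Y j , o) , o)
                x , x∈ , o = sep (Mₚ.∈-tabulate⁺ i) (Mₚ.∈-tabulate⁺ j) w
                clash : Rows (ix lo (lookup X i)) (ix lo κ) (ix hi (lookup Y j)) x → ⊥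
                clash = λ { (inj₁ p) → avi x∈ p ; (inj₂ (inj₁ p)) → avκ x∈ p ; (inj₂ (inj₂ p)) → avj x∈ p }
            ⊥-elim (clash (proj₂ st (h o)))

      -- U collects auxiliary lanes.  Lanes run upwards from W' to U in the first step and back down from U to V' in the second,
      -- so both steps together realise a monotone matching between arbitrary k-sets W' and V' of good lanes.
      module Section (st₀ st₁ : Step) (glue : Step.hi st₀ ≡ Step.lo st₁) where
        module L₀ = Step st₀
        module L₁ = Step st₁

        module Up = Linkage L₀.LanePath L₀.lsup
        module Dn = Linkage (λ x y → L₁.LanePath y x) L₁.lsup

        disjointK : ∀ {x} → L₀.K x → ¬ L₁.K x
        disjointK k₀ k₁ = L₁.K-above k₁ (subst (λ c → Δ c _) glue (L₀.K-below k₀))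

        record Lanes (μ κ : ℕ) : Set where
          field
            good : Vec (Fin m) μ
            good! : Unique (toList good)
            U    : Vec (Fin m) κ
            c d  : Bool
            up   : ∀ V → toList V ⊆ toList good → Up.Link (flip′ c) V U
            down : ∀ V → toList V ⊆ toList good → Dn.Link (flip′ d) V U

        lanes : ∀ μ κ → proj₁ (es κ) ≤ m → laneBound μ κ ≤ m → ¬ ¬ Lanes μ κ
        lanes μ κ r≤m h = do
          L₁ , s₁ , h₁ , c , up ← Up.homogenize κ _ r ℕₚ.≤-refl (allFin m) (subst (laneBound μ κ ≤_) (sym (Lₚ.length-tabulate id)) h) λ V W VW⊆ →
            let uV , uW , _ = unique-++ (toList V) (unique-⊆ VW⊆ (Uₚ.allFin⁺ m)) in L₀.stageLink V W uV uW r≤m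
          L₂ , s₂ , h₂ , d , down ← Dn.homogenize κ (μ + κ) r ℕₚ.≤-refl L₁ h₁ λ V W VW⊆ → do
            let uV , uW , _ = unique-++ (toList V) (unique-⊆ (⊆-trans VW⊆ s₁) (Uₚ.allFin⁺ m))
            U ← L₁.stageLink W V uW uV r≤m
            let open Linkage.Unord U
            pure (record { α = β ; β = α ; α-inj = β-inj ; β-inj = α-inj ; path = path ; disj = disj })
          let Z , Z⊆ = vecOf (μ + κ) L₂ (ℕₚ.≤-trans (ℕₚ.≤-reflexive refl) h₂)
          build L₁ s₁ c up L₂ s₂ d down Z Z⊆ (V.splitAt μ Z)
          where
          r = proj₁ (es κ)
          build : ∀ L₁ → L₁ ⊆ allFin m → ∀ c → (∀ (V W : Vec (Fin m) κ) → toList V ++ toList W ⊆ L₁ → Up.Link (flip′ c) V W) →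
            ∀ L₂ → L₂ ⊆ L₁ → ∀ d → (∀ (V W : Vec (Fin m) κ) → toList V ++ toList W ⊆ L₂ → Dn.Link (flip′ d) V W) →
            ∀ Z → toList Z ⊆ L₂ → (Σ (Vec (Fin m) μ) λ V → Σ (Vec (Fin m) κ) λ W → Z ≡ V V.++ W) → ¬ ¬ Lanes μ κ
          build L₁ s₁ c up L₂ s₂ d down _ Z⊆ (M , U , refl) = pure (record
            { good = M ; good! = proj₁ (unique-++ (toList M) (unique-⊆ (⊆-trans MU⊆ (⊆-trans s₂ s₁)) (Uₚ.allFin⁺ m))) ; U = U ; c = c ; d = d
            ; up = λ V V⊆ → up V U (⊆-trans (Sₚ.++⁺ V⊆ ⊆-refl) (⊆-trans MU⊆ s₂))
            ; down = λ V V⊆ → down V U (⊆-trans (Sₚ.++⁺ V⊆ ⊆-refl) MU⊆) })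
            where
            MU⊆ : toList M ++ toList U ⊆ L₂
            MU⊆ = subst (_⊆ L₂) (Vₚ.toList-++ M U) Z⊆

        Outside : Fin n → Set
        Outside x = ¬ L₀.K x × ¬ L₁.K x

        Return : Fin m → Fin m → Set
        Return i j = WalkIn′ E Outside (en L₁.hi (ix L₁.hi i)) (ex L₀.lo (ix L₀.lo j))

        rsup : ∀ {i j} → Return i j → Fin n → Set
        rsup (w , _) = on w

        module Re = Linkage Return rsup

        -- The return linkage dictates the sublists `V` and `W` of `good`, and `Lanes` serves any
        -- such sublists. Returning from `V` to `W`, going to `U` and back to `V` are all monotone,
        -- so each mirror pair contains a cycle.
        close : ∀ {κ μ ρ} (ls : Lanes μ (κ + κ)) → Re.Unord ρ (Lanes.good ls) (Lanes.good ls) → proj₁ (es (κ + κ)) ≤ ρ → ¬ ¬ Packing E κ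
        close {κ} ls ret h = do
          V , W , V⊆ , W⊆ , e , link ← Re.monotone {k = κ + κ} h ret
          pure (pack V W e link (up W W⊆) (down V V⊆))
          where
          open Lanes ls
          pack : ∀ V W e → Re.Link (flip′ e) V W → Up.Link (flip′ c) W U → Dn.Link (flip′ d) V U → Packing E κ
          pack V W e re up dn = packPieces E pieces (λ i → zero , i F.↑ˡ κ) λ i j h →
              Fₚ.toℕ-injective (trans (sym (mirror-↑ˡ i)) (trans h (mirror-↑ˡ j)))
            where
            module re = Re.Link re
            module up = Up.Link up
            module dn = Dn.Link dn
            st lt : Fin 3 → Fin (κ + κ) → Fin n
            st zero i = en L₁.hi (ix L₁.hi (lookup V i))
            st (suc zero) i = en L₀.lo (ix L₀.lo (lookup W i))
            st (suc (suc zero)) i = en L₁.lo (ix L₁.lo (lookup U (flip′ d i)))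
            lt zero i = ex L₀.lo (ix L₀.lo (lookup W (flip′ e i)))
            lt (suc zero) i = ex L₀.hi (ix L₀.hi (lookup U (flip′ c i)))
            lt (suc (suc zero)) i = ex L₁.hi (ix L₁.hi (lookup V i))
            wk : ∀ t i → Star E (st t i) (lt t i)
            wk zero i = proj₁ (re.path i)
            wk (suc zero) i = Star.map proj₁ (proj₁ (up.path i))
            wk (suc (suc zero)) i = Star.map proj₁ (proj₁ (dn.path i))
            nx : Fin 3 × Fin (κ + κ) → Fin 3 × Fin (κ + κ)
            nx (zero , i) = suc zero , flip′ e i
            nx (suc zero , i) = suc (suc zero) , flip′ d (flip′ c i)
            nx (suc (suc zero) , i) = zero , i
            cl : ∀ p → E (lt (proj₁ p) (proj₂ p)) (st (proj₁ (nx p)) (proj₂ (nx p)))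
            cl (zero , i) = proj₁ (Crossing.edge (cut L₀.lo _))
            cl (suc zero , i) = subst₂ (λ h u → E (lt (suc zero) i) (en h (ix h (lookup U u)))) glue (sym (flip′-involutive d _)) (proj₁ (Crossing.edge (cut L₀.hi _)))
            cl (suc (suc zero) , i) = proj₁ (Crossing.edge (cut L₁.hi _))
            bn : ∀ p → mirror (proj₂ (nx p)) ≡ mirror (proj₂ p)
            bn (zero , i) = mirror-flip′ e i
            bn (suc zero , i) = trans (mirror-flip′ d _) (mirror-flip′ c i)
            bn (suc (suc zero) , i) = refl
            upK : ∀ {i x} → on (wk (suc zero) i) x → L₀.K x
            upK {i} o = proj₂ (up.path i) (on-gmap proj₁ (proj₁ (up.path i)) o)
            dnK : ∀ {i x} → on (wk (suc (suc zero)) i) x → L₁.K x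
            dnK {i} o = proj₂ (dn.path i) (on-gmap proj₁ (proj₁ (dn.path i)) o)
            dj : ∀ t t' i j {x} → on (wk t i) x → on (wk t' j) x → mirror i ≡ mirror j
            dj zero zero i j a b = cong mirror (re.disj i j a b)
            dj (suc zero) (suc zero) i j a b = cong mirror (up.disj i j (on-gmap proj₁ (proj₁ (up.path i)) a) (on-gmap proj₁ (proj₁ (up.path j)) b))
            dj (suc (suc zero)) (suc (suc zero)) i j a b = cong mirror (dn.disj i j (on-gmap proj₁ (proj₁ (dn.path i)) a) (on-gmap proj₁ (proj₁ (dn.path j)) b))
            dj zero (suc zero) i j a b = ⊥-elim (proj₁ (proj₂ (re.path i) a) (upK b))
            dj (suc zero) zero i j a b = ⊥-elim (proj₁ (proj₂ (re.path j) b) (upK a))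
            dj zero (suc (suc zero)) i j a b = ⊥-elim (proj₂ (proj₂ (re.path i) a) (dnK b))
            dj (suc (suc zero)) zero i j a b = ⊥-elim (proj₂ (proj₂ (re.path j) b) (dnK a))
            dj (suc zero) (suc (suc zero)) i j a b = ⊥-elim (disjointK (upK a) (dnK b))
            dj (suc (suc zero)) (suc zero) i j a b = ⊥-elim (disjointK (upK b) (dnK a))
            pieces : Pieces E (Fin 3 × Fin (κ + κ)) ℕ
            pieces = record
              { R = E ; R⇒E = id ; s = λ (t , i) → st t i ; l = λ (t , i) → lt t i ; next = nx ; w = λ (t , i) → wk t i
              ; close = cl ; block = λ (_ , i) → mirror i ; block-next = bn ; disj = λ (t , i) (t' , j) → dj t t' i j }

      -- Closing up sections of the grid to disjoint cycles

      -- Stages 0 to 2 form the first section, stages `3 + 4 * c` to `6 + 4 * c` the band of section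
      -- `c`, and `7 + 4 * ℓ` holds the rows that lead to the return paths. Among `ℓ` bands one
      -- avoids a separator of fewer than `ℓ` vertices. `3 * (ℓ + ℓ) < μ` leaves a return path that
      -- avoids two separators together with the rows at its two ends.
      module Close (ℓ μ : ℕ) (S≥ : 8 + 4 * ℓ ≤ S) (es≤ℓ : proj₁ (es (suc k + suc k)) ≤ ℓ) (3ℓ<μ : 3 * (ℓ + ℓ) < μ) (2s≤μ : s + s ≤ μ)
        (ℓ≤m : ℓ ≤ m) (bound≤m : laneBound μ (suc k + suc k) ≤ m) where
        private
          κ = suc k + suc k

        at : ∀ {x} → x < S → Fin S
        at p = F.fromℕ< p

        at-< : ∀ {x y} (p : x < S) (q : y < S) → x < y → at p F.< at q
        at-< p q = subst₂ _<_ (sym (Fₚ.toℕ-fromℕ< p)) (sym (Fₚ.toℕ-fromℕ< q))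

        at-≤ : ∀ {x y} (p : x < S) (q : y < S) → x ≤ y → at p F.≤ at q
        at-≤ p q = subst₂ _≤_ (sym (Fₚ.toℕ-fromℕ< p)) (sym (Fₚ.toℕ-fromℕ< q))

        mk : ∀ {x} (p : x < S) (q : suc x < S) → Step
        mk p q = step (at p) (at q) (at-< p q ℕₚ.≤-refl)

        low : ∀ x → x < 8 → x < S
        low x h = ℕₚ.<-≤-trans h (ℕₚ.≤-trans (ℕₚ.m≤m+n 8 _) S≥)

        off : ∀ (c : Fin ℓ) x → x < 8 → x + 4 * toℕ c < S
        off c x h = ℕₚ.<-≤-trans (ℕₚ.+-mono-<-≤ h (ℕₚ.*-monoʳ-≤ 4 (ℕₚ.<⇒≤ (Fₚ.toℕ<n c)))) S≥

        Band : Fin ℓ → Fin n → Set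
        Band c x = ¬ Δ (at (off c 3 (ℕₚ.m≤m+n 4 4))) x × Δ (at (off c 6 (ℕₚ.m≤m+n 7 1))) x

        private
          gap : ∀ {x y} → x < y → 6 + 4 * x ≤ 3 + 4 * y
          gap {x} lt = ℕₚ.+-monoʳ-≤ 3 (ℕₚ.≤-trans (ℕₚ.n≤1+n _) (ℕₚ.≤-trans (ℕₚ.≤-reflexive (sym (ℕₚ.*-suc 4 x))) (ℕₚ.*-monoʳ-≤ 4 lt)))

        Band-disjoint : ∀ i j {x} → Band i x → Band j x → i ≡ j
        Band-disjoint i j (lo , hi) (lo′ , hi′) with Fₚ.<-cmp i j
        ... | tri≈ _ e _ = e
        ... | tri< lt _ _ = ⊥-elim (lo′ (Δ-mono (at-≤ (off i 6 (ℕₚ.m≤m+n 7 1)) (off j 3 (ℕₚ.m≤m+n 4 4)) (gap lt)) hi))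
        ... | tri> _ _ gt = ⊥-elim (lo (Δ-mono (at-≤ (off j 6 (ℕₚ.m≤m+n 7 1)) (off i 3 (ℕₚ.m≤m+n 4 4)) (gap gt)) hi′))

        s₀ s₁ : Step
        s₀ = mk (low 0 (s≤s z≤n)) (low 1 (s≤s (s≤s z≤n)))
        s₁ = mk (low 1 (s≤s (s≤s z≤n))) (low 2 (s≤s (s≤s (s≤s z≤n))))

        Out₀ : Fin n → Set
        Out₀ = Section.Outside s₀ s₁ refl

        c₀ c₂ final : Fin S
        c₀ = at (low 0 (s≤s z≤n))
        c₂ = at (low 2 (s≤s (s≤s (s≤s z≤n))))
        final = at {7 + 4 * ℓ} S≥

        -- Nothing but `T` lies in `Δ` at stage 0, and a row meets `T` only in its start. So a path
        -- that returns to the start of a row has returned to the first section.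
        ex₀ : ∀ i → ex c₀ i ≡ P.a i
        ex₀ i with Crossing.inside (cut c₀ i)
        ... | inj₁ x∈ = T-start (P.w i) (Crossing.exit∈ (cut c₀ i)) x∈
        ... | inj₂ (_ , t , _ , lt , _) = ⊥-elim (ℕₚ.n≮0 (subst (toℕ t <_) (Fₚ.toℕ-fromℕ< (low 0 (s≤s z≤n))) lt))

        ok : Fin n → Set
        ok x = x ∈ T ⊎ ¬ Δ c₂ x

        module WithLanes (ls : Section.Lanes s₀ s₁ refl μ κ) where
          open Section.Lanes ls using (good; good!)

          a₀ b₁ : Fin μ → Fin (S * m)
          a₀ i = ix c₀ (lookup good i)
          b₁ i = ix final (lookup good i)

          a₀-inj : ∀ {i j} → a₀ i ≡ a₀ j → i ≡ j
          a₀-inj e = lookup-toList-injective good good! _ _ (ix-injective c₀ e)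

          b₁-inj : ∀ {i j} → b₁ i ≡ b₁ j → i ≡ j
          b₁-inj e = lookup-toList-injective good good! _ _ (ix-injective final e)

          A B : Vec (Fin n) μ
          A = tabulate (P.b ∘ b₁)
          B = tabulate (P.a ∘ a₀)

          returnPaths : ¬ ¬ Linkage.Unord TPath tsup μ A B
          returnPaths = TLink.tlink A B 2s≤μ
              (subst Unique (sym (cong₂ _++_ (toList-tabulate (P.b ∘ b₁)) (toList-tabulate (P.a ∘ a₀))))
                (Uₚ.++⁺ (Uₚ.tabulate⁺ λ e → b₁-inj (P.b-inj _ _ e)) (Uₚ.tabulate⁺ λ e → a₀-inj (aInj e)) λ (p , q) → apart p q))
              inT
            where
            aInj : ∀ {i j} → P.a i ≡ P.a j → i ≡ j
            aInj {i} {j} e = P.disj i j (on-start (P.w i)) (subst (on (P.w j)) (sym e) (on-start (P.w j)))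
            apart : ∀ {x} → x ∈ L.tabulate (P.b ∘ b₁) → x ∈ L.tabulate (P.a ∘ a₀) → ⊥
            apart p q with Mₚ.∈-tabulate⁻ p | Mₚ.∈-tabulate⁻ q
            ... | i , refl | j , e = P.a≢b (a₀ j) (b₁ i) (sym e)
            inT : ∀ {x} → x ∈ toList A ++ toList B → x ∈ T
            inT h with Mₚ.∈-++⁻ (toList A) h
            ... | inj₁ p with i , refl ← ∈-toList A p = subst (_∈ T) (sym (Vₚ.lookup∘tabulate _ i)) (P.b∈T _)
            ... | inj₂ p with i , refl ← ∈-toList B p = subst (_∈ T) (sym (Vₚ.lookup∘tabulate _ i)) (P.a∈T _)

          module WithReturn (U : Linkage.Unord TPath tsup μ A B) where
            module U = Linkage.Unord U
            start end : Fin μ → Fin (S * m)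
            start i = b₁ (U.α i)
            end i = a₀ (U.β i)

            β : ∀ i → lookup A (U.α i) ≡ P.b (start i)
            β i = Vₚ.lookup∘tabulate _ (U.α i)

            ω : ∀ i → lookup B (U.β i) ≡ P.a (end i)
            ω i = Vₚ.lookup∘tabulate _ (U.β i)

            R₁ : Fin n → Fin n → Set
            R₁ u v = E u v × ok u × ok v

            src₁ tgt₁ : Fin m → Fin n
            src₁ i = en c₂ (ix c₂ i)
            tgt₁ i = ex c₀ (ix c₀ i)

            outside₀ : ∀ {x} → ok x → Out₀ x
            outside₀ (inj₁ x∈) = (λ h → Step.K-above s₀ h (inj₁ x∈)) , λ h → Step.K-above s₁ h (inj₁ x∈)
            outside₀ (inj₂ ¬Δ) = (λ h → ¬Δ (Δ-mono (at-≤ (low 1 (s≤s (s≤s z≤n))) (low 2 (s≤s (s≤s (s≤s z≤n)))) (s≤s z≤n)) (Step.K-below s₀ h))) , λ h → ¬Δ (Step.K-below s₁ h)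

            -- With `ℓ` disjoint returns outside the first section, this section alone closes up to
            -- too many cycles.
            early : Fam R₁ ℓ (L.tabulate (src₁ ∘ lookup good)) (L.tabulate (tgt₁ ∘ lookup good)) → ¬ ¬ ⊥
            early F = do
              pk ← Section.close s₀ s₁ refl ls (famUnord proj₁ src₁ tgt₁ good good F λ i {x} o → outside₀ (okF i o)) es≤ℓ
              λ _ → ¬pack pk
              where
              okF : ∀ i {x} → on (Fam.w F i) x → ok x
              okF i = stays {P = ok} (λ r _ → proj₂ (proj₂ r)) (Fam.w F i)
                (subst ok (sym (proj₂ (Mₚ.∈-tabulate⁻ (Fam.s∈ F i)))) (inj₂ (Crossing.outside (cut c₂ _))))

            -- Z separates lane exits of the first section from its entries, and the band of section c avoids Z.  A return path
            -- meeting the band could be reached from the first section, so almost all return paths avoid section c.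
            module Late (Z : List (Fin n)) (|Z| : length Z < ℓ)
              (sepZ : ∀ {a b} → a ∈ L.tabulate (src₁ ∘ lookup good) → b ∈ L.tabulate (tgt₁ ∘ lookup good) → (w : Star R₁ a b) → Σ (Fin n) λ z → z ∈ Z × on w z)
              (c : Fin ℓ) where
              g₋ = off c 3 (ℕₚ.m≤m+n 4 4)
              g₀ = off c 4 (ℕₚ.m≤m+n 5 3)
              g₁ = off c 5 (ℕₚ.m≤m+n 6 2)
              g₂ = off c 6 (ℕₚ.m≤m+n 7 1)
              t₀ t₁ : Step
              t₀ = mk g₀ g₁
              t₁ = mk g₁ g₂

              Out₁ : Fin n → Set
              Out₁ = Section.Outside t₀ t₁ refl

              pre : Step
              pre = mk g₋ g₀

              inBand : ∀ {u v} (w : Star E′ u v) → ¬ Δ (at g₋) u → Δ (at g₂) v → ∀ {x} → on w x → Band c x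
              inBand w lo hi o = upward (Δ-down _) w lo o , downward (Δ-down _) w hi o

              -- The step `pre` in front of the section spreads each lane to all rows, so every
              -- vertex of the section is accessible from every lane `λ₃`; by `inBand` the walk
              -- stays in the band.
              reach : ∀ {h} → Step.K t₀ h ⊎ Step.K t₁ h → ∀ λ₃ → Star E′ (en (at g₋) (ix (at g₋) λ₃)) h
              reach (inj₁ (i , κ , j , o)) λ₃ =
                proj₁ (Step.stage pre λ₃ κ₀ i) ◅◅ Crossing.edge (cut (at g₀) (ix (at g₀) i)) ◅ proj₁ (prefix (proj₁ (Step.stage t₀ i κ j)) o)
              reach (inj₂ (i , κ , j , o)) λ₃ =
                proj₁ (Step.stage pre λ₃ κ₀ κ₀) ◅◅ Crossing.edge (cut (at g₀) (ix (at g₀) κ₀)) ◅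
                proj₁ (Step.stage t₀ κ₀ κ₀ i) ◅◅ Crossing.edge (cut (at g₁) (ix (at g₁) i)) ◅ proj₁ (prefix (proj₁ (Step.stage t₁ i κ j)) o)

              below : ∀ {h} → Step.K t₀ h ⊎ Step.K t₁ h → Δ (at g₂) h
              below (inj₁ h) = Δ-mono (at-≤ g₁ g₂ (ℕₚ.n≤1+n _)) (Step.K-below t₀ h)
              below (inj₂ h) = Step.K-below t₁ h

              avoids : (∀ {x} → x ∈ Z → ¬ Band c x) → ∀ i → (∀ {x} → x ∈ Z → ¬ tsup (U.path i) x) → P.a (end i) ∉ Z →
                ∀ {h} → tsup (U.path i) h → Step.K t₀ h ⊎ Step.K t₁ h → ¬ ¬ ⊥
              avoids clear i avR a∉ {h} oh Kh = do
                i₀ , av₀ ← survivor Z (λ i → on (P.w (ix c₂ (lookup good i)))) (λ i j a b → lookup-toList-injective good good! i j (ix-injective c₂ (P.disj _ _ a b)))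
                  (ℕₚ.<-trans |Z| (ℕₚ.≤-<-trans (ℕₚ.≤-trans (ℕₚ.m≤m+n ℓ ℓ) (ℕₚ.m≤m+n (ℓ + ℓ) _)) 3ℓ<μ))
                κ′ , avκ ← survivor Z (λ κ → on (Q.w (ix c₂ κ))) (λ i j a b → ix-injective c₂ (Q.disj _ _ a b)) (ℕₚ.<-≤-trans |Z| ℓ≤m)
                λ₃ , av₃ ← survivor Z (λ i → on (P.w (ix (at g₋) i))) (λ i j a b → ix-injective (at g₋) (P.disj _ _ a b)) (ℕₚ.<-≤-trans |Z| ℓ≤m)
                let 2<g₋ = at-< (low 2 (s≤s (s≤s (s≤s z≤n)))) g₋ (s≤s (s≤s (s≤s z≤n)))
                    w₁ = hop c₂ c₂ (at g₋) κ′ ℕₚ.≤-refl 2<g₋ (ix-< 2<g₋)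
                    w₂ = reach Kh λ₃
                    l , wR , last = U.path i
                    w₃ = suffix wR oh
                    avoid₁ : ∀ {x} → on (proj₁ w₁) x → x ∉ Z
                    avoid₁ = λ o x∈ → Sum.[ av₀ x∈ , Sum.[ avκ x∈ , av₃ x∈ ] ] (proj₂ w₁ o)
                    avoid₂ : ∀ {x} → on w₂ x → x ∉ Z
                    avoid₂ = λ o x∈ → clear x∈ (inBand w₂ (Crossing.outside (cut (at g₋) _)) (below Kh) o)
                    W : WalkIn′ E′ (_∉ Z) (src₁ (lookup good i₀)) l
                    W = join (proj₁ w₁ , avoid₁) (Crossing.edge (cut (at g₋) _)) (w₂ , avoid₂) ⊕ weaken (λ o x∈ → avR x∈ o) w₃
                    okW : ∀ {x} → on (proj₁ W) x → ok x
                    okW = λ o → inj₂ (upward (Δ-down c₂) (proj₁ W) (Crossing.outside (cut c₂ _)) o)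
                    W₁ : WalkIn′ R₁ (_∉ Z) (src₁ (lookup good i₀)) l
                    W₁ = restrict {P = λ x → ok x × x ∉ Z} (λ r a b → proj₁ r , proj₁ a , proj₁ b) proj₂ (proj₁ W , λ o → okW o , proj₂ W o)
                    fin : R₁ l (P.a (end i))
                    fin = subst (E l) (ω i) last , okW (on-end (proj₁ W)) , inj₁ (P.a∈T _)
                    W₂ : WalkIn′ R₁ (_∉ Z) (src₁ (lookup good i₀)) (P.a (end i))
                    W₂ = join W₁ fin (ε , λ { refl → a∉ })
                    x , x∈ , o = sepZ (Mₚ.∈-tabulate⁺ i₀) (subst (_∈ L.tabulate (tgt₁ ∘ lookup good)) (ex₀ (end i)) (Mₚ.∈-tabulate⁺ (U.β i))) (proj₁ W₂)
                pure (proj₂ W₂ o x∈)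

              src₂ tgt₂ : Fin m → Fin n
              src₂ i = en (at g₂) (ix (at g₂) i)
              tgt₂ i = ex (at g₀) (ix (at g₀) i)

              R₂ : Fin n → Fin n → Set
              R₂ u v = E u v × Out₁ u × Out₁ v

              above⇒outside : ∀ {x} → ¬ Δ (at g₂) x → Out₁ x
              above⇒outside ¬Δ = (λ h → ¬Δ (below (inj₁ h))) , λ h → ¬Δ (below (inj₂ h))

              below⇒outside : ∀ {x} → Δ (at g₀) x → Out₁ x
              below⇒outside Δx = (λ h → Step.K-above t₀ h Δx) , λ h → Step.K-above t₁ h (Δ-mono (at-≤ g₀ g₁ (ℕₚ.n≤1+n _)) Δx)

              module _ (clear : ∀ {x} → x ∈ Z → ¬ Band c x) (ls′ : Section.Lanes t₀ t₁ refl μ κ) where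
                open Section.Lanes ls′ using () renaming (good to good′; good! to good′!)

                -- A separator `Z′` around section `c` is defeated by a detour: from a lane behind
                -- the section down a column to a row of the last stage, along the return path, then
                -- from a row of the first stage down a column to a lane in front of the section.
                -- Every part is chosen to avoid `Z′`.
                late : Fam R₂ ℓ (L.tabulate (src₂ ∘ lookup good′)) (L.tabulate (tgt₂ ∘ lookup good′)) ⊎
                  Sep R₂ ℓ (L.tabulate (src₂ ∘ lookup good′)) (L.tabulate (tgt₂ ∘ lookup good′)) → ¬ ¬ ⊥
                late (inj₁ F) = do
                  pk ← Section.close t₀ t₁ refl ls′ (famUnord proj₁ src₂ tgt₂ good′ good′ F outF) es≤ℓ
                  λ _ → ¬pack pk
                  where
                  outF : ∀ i {x} → on (Fam.w F i) x → Out₁ x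
                  outF i = stays {P = Out₁} (λ r _ → proj₂ (proj₂ r)) (Fam.w F i)
                    (subst Out₁ (sym (proj₂ (Mₚ.∈-tabulate⁻ (Fam.s∈ F i)))) (above⇒outside (Crossing.outside (cut (at g₂) _))))
                late (inj₂ (Z′ , |Z′| , sepZ′)) = do
                  i , av ← survivor* {q = 3} (Z ++ Z′) sup supd (ℕₚ.≤-<-trans (ℕₚ.*-monoʳ-≤ 3 (ℕₚ.≤-trans (ℕₚ.≤-reflexive (Lₚ.length-++ Z)) (ℕₚ.+-mono-≤ (ℕₚ.<⇒≤ |Z|) (ℕₚ.<⇒≤ |Z′|)))) 3ℓ<μ)
                  i₁ , av₁ ← survivor Z′ (λ i → on (P.w (ix (at g₂) (lookup good′ i)))) (λ i j a b → lookup-toList-injective good′ good′! i j (ix-injective (at g₂) (P.disj _ _ a b))) |Z′|<μ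
                  i₂ , av₂ ← survivor Z′ (λ i → on (P.w (ix (at g₀) (lookup good′ i)))) (λ i j a b → lookup-toList-injective good′ good′! i j (ix-injective (at g₀) (P.disj _ _ a b))) |Z′|<μ
                  κ₁ , avκ₁ ← survivor Z′ (λ κ → on (Q.w (ix (at g₂) κ))) (λ i j a b → ix-injective (at g₂) (Q.disj _ _ a b)) (ℕₚ.<-≤-trans |Z′| ℓ≤m)
                  κ₂ , avκ₂ ← survivor Z′ (λ κ → on (Q.w (ix c₀ κ))) (λ i j a b → ix-injective c₀ (Q.disj _ _ a b)) (ℕₚ.<-≤-trans |Z′| ℓ≤m)
                  out ← nn λ h → avoids clear i (λ z∈ → av zero (Mₚ.∈-++⁺ˡ z∈)) (λ z∈ → av (suc (suc zero)) (Mₚ.∈-++⁺ˡ z∈) (on-start (P.w (end i)))) {h}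
                  let lt₁ = ix-< (at-< g₂ S≥ (ℕₚ.+-mono-<-≤ (ℕₚ.≤-refl {7}) (ℕₚ.*-monoʳ-≤ 4 (ℕₚ.<⇒≤ (Fₚ.toℕ<n c)))))
                      lt₂ = ix-< (at-< (low 0 (s≤s z≤n)) g₀ (s≤s z≤n))
                      av′ : ∀ t {z} → z ∈ Z′ → ¬ sup t i z
                      av′ = λ t z∈ → av t (Mₚ.∈-++⁺ʳ Z z∈)
                      w₁ = descend (at g₂) (at g₂) κ₁ ℕₚ.≤-refl lt₁
                      w₁′ = suffix (P.w (start i)) (zP (start i) (ix (at g₂) κ₁))
                      V₁ : WalkIn′ E′ (_∉ Z′) (src₂ (lookup good′ i₁)) (P.l (start i))
                      V₁ = weaken (λ h z∈ → Sum.[ av₁ z∈ , Sum.[ avκ₁ z∈ , av′ (suc zero) z∈ ] ] h) w₁ ⊕ weaken (λ o z∈ → av′ (suc zero) z∈ o) w₁′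
                      w₃ = prefix (P.w (end i)) (zP (end i) (ix c₀ κ₂))
                      w₃′ = switch {j = ix c₀ κ₂} lt₂
                      w₃″ = toExit (at g₀) (ix (at g₀) (lookup good′ i₂)) (zP _ (ix c₀ κ₂)) (z∈Δ (at-< (low 0 (s≤s z≤n)) g₀ (s≤s z≤n)) _ κ₂)
                      V₃ : WalkIn′ E′ (_∉ Z′) (P.a (end i)) (tgt₂ (lookup good′ i₂))
                      V₃ = weaken (λ o z∈ → av′ (suc (suc zero)) z∈ o) w₃ ⊕ weaken (λ o z∈ → avκ₂ z∈ o) w₃′ ⊕ weaken (λ o z∈ → av₂ z∈ o) w₃″
                      l , wR , last = U.path i
                      OK : Fin n → Set
                      OK = λ x → Out₁ x × x ∉ Z′
                      up₁ : ∀ {x} → on (proj₁ V₁) x → Out₁ x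
                      up₁ = λ o → above⇒outside (upward (Δ-down (at g₂)) (proj₁ V₁) (Crossing.outside (cut (at g₂) _)) o)
                      dn₃ : ∀ {x} → on (proj₁ V₃) x → Out₁ x
                      dn₃ = λ o → below⇒outside (downward (Δ-down (at g₀)) (proj₁ V₃) (Crossing.inside (cut (at g₀) _)) o)
                      X₁ : WalkIn′ E OK (src₂ (lookup good′ i₁)) (P.l (start i))
                      X₁ = restrict {P = OK} (λ r _ _ → proj₁ r) id (proj₁ V₁ , λ o → up₁ o , proj₂ V₁ o)
                      X₂ : WalkIn′ E OK (lookup A (U.α i)) l
                      X₂ = restrict {P = OK} (λ r _ _ → proj₁ r) id (wR , λ o → (out o ∘ inj₁ , out o ∘ inj₂) , λ z∈ → av′ zero z∈ o)
                      X₃ : WalkIn′ E OK (P.a (end i)) (tgt₂ (lookup good′ i₂))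
                      X₃ = restrict {P = OK} (λ r _ _ → proj₁ r) id (proj₁ V₃ , λ o → dn₃ o , proj₂ V₃ o)
                      X = join X₁ (subst (E _) (sym (β i)) (P.last (start i))) (join X₂ (subst (E l) (ω i) last) X₃)
                      Y : WalkIn′ R₂ (_∉ Z′) (src₂ (lookup good′ i₁)) (tgt₂ (lookup good′ i₂))
                      Y = restrict {P = OK} (λ r a b → r , proj₁ a , proj₁ b) proj₂ X
                      x , x∈ , o = sepZ′ (Mₚ.∈-tabulate⁺ i₁) (Mₚ.∈-tabulate⁺ i₂) (proj₁ Y)
                  pure (proj₂ Y o x∈)
                  where
                  |Z′|<μ : length Z′ < μ
                  |Z′|<μ = ℕₚ.<-trans |Z′| (ℕₚ.≤-<-trans (ℕₚ.≤-trans (ℕₚ.m≤m+n ℓ ℓ) (ℕₚ.m≤m+n (ℓ + ℓ) _)) 3ℓ<μ)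
                  sup : Fin 3 → Fin μ → Fin n → Set
                  sup zero i = tsup (U.path i)
                  sup (suc zero) i = on (P.w (start i))
                  sup (suc (suc zero)) i = on (P.w (end i))
                  supd : ∀ t i j {x} → sup t i x → sup t j x → i ≡ j
                  supd zero i j a b = U.disj i j a b
                  supd (suc zero) i j a b = U.α-inj i j (b₁-inj (P.disj _ _ a b))
                  supd (suc (suc zero)) i j a b = U.β-inj i j (a₀-inj (P.disj _ _ a b))
                  nn : ∀ {i} → (∀ h → tsup (U.path i) h → Step.K t₀ h ⊎ Step.K t₁ h → ¬ ¬ ⊥) →
                    ¬ ¬ (∀ {h} → tsup (U.path i) h → ¬ (Step.K t₀ h ⊎ Step.K t₁ h))
                  nn f = pure λ {h} o q → f h o q id

            absurd : ¬ ¬ ⊥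
            absurd = menger R₁ (L.tabulate (src₁ ∘ lookup good)) (L.tabulate (tgt₁ ∘ lookup good)) ℓ >>= λ where
                (inj₁ F) → early F
                (inj₂ (Z , |Z| , sepZ)) → do
                  c , clear ← survivor Z Band Band-disjoint |Z|
                  ls′ ← Section.lanes (Late.t₀ Z |Z| sepZ c) (Late.t₁ Z |Z| sepZ c) refl μ κ (ℕₚ.≤-trans es≤ℓ ℓ≤m) bound≤m
                  r ← menger (Late.R₂ Z |Z| sepZ c) _ _ ℓ
                  Late.late Z |Z| sepZ c clear ls′ r

        contradiction : ¬ ¬ ⊥
        contradiction = do
          ls ← Section.lanes s₀ s₁ refl μ κ (ℕₚ.≤-trans es≤ℓ ℓ≤m) bound≤m
          U ← WithLanes.returnPaths ls
          WithLanes.WithReturn.absurd ls U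

-- The Erdős-Pósa bound for directed cycles

ℓOf μOf mOf : ℕ → ℕ → ℕ
ℓOf k s = proj₁ (es (suc k + suc k))
μOf k s = suc (3 * (ℓOf k s + ℓOf k s)) + (s + s)
mOf k s = suc (ℓOf k s + laneBound (μOf k s) (suc k + suc k))

epBound : ℕ → ℕ → ℕ
epBound k s = linkedSize k s (gridSize ((8 + 4 * ℓOf k s) * mOf k s))

shortest : ∀ {n} (E : Fin n → Fin n → Set) → ¬ ¬ (Σ (List (Fin n)) λ T → Unique T × Hits E T × (∀ X → Hits E X → length T ≤ length X))
shortest {n} E = do
  T , hit , min ← go n (allFin n) (ℕₚ.≤-reflexive (Lₚ.length-tabulate id)) (λ S ((x , sx) , _) h → h sx (Mₚ.∈-allFin x))
  let T′ = L.deduplicate F._≟_ T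
      T′! = deduplicate-! T
  pure (T′ , T′! , (λ S cyc h → hit S cyc λ sx x∈ → h sx (Mₚ.∈-deduplicate⁺ F._≟_ x∈))
    , λ X hX → ℕₚ.≤-trans (unique-length-≤ T′! (Mₚ.∈-deduplicate⁻ F._≟_ T)) (min X hX))
  where
  open import Data.List.Relation.Unary.Unique.DecPropositional.Properties (F._≟_ {n}) using (deduplicate-!)
  Goal = Σ (List (Fin n)) λ T → Hits E T × (∀ Y → Hits E Y → length T ≤ length Y)
  go : ∀ N X → length X ≤ N → Hits E X → ¬ ¬ Goal
  next : ∀ N {Y} → length Y < N → Hits E Y → ¬ ¬ Goal
  next (suc N) (s≤s h) = go N _ h
  go N X h hit = em (Σ (List (Fin n)) λ Y → Hits E Y × length Y < length X) >>= λ where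
    (no ¬p) → pure (X , hit , λ Y hY → ℕₚ.≮⇒≥ λ lt → ¬p (Y , hY , lt))
    (yes (Y , hY , lt)) → next N (ℕₚ.<-≤-trans lt h) hY

smallHittingSet : ∀ {k s} → EPWith k s → EPWith (suc k) (epBound k s)
smallHittingSet {k} {s} IH {n} E ¬pack = do
  T , T! , hit , min ← shortest E
  d ← em (length T ≤ epBound k s)
  conclude T T! hit min d
  where
  ℓ = ℓOf k s
  μ = μOf k s
  m = mOf k s
  conclude : ∀ T → Unique T → Hits E T → (∀ X → Hits E X → length T ≤ length X) → Dec (length T ≤ epBound k s) →
    ¬ ¬ (Σ (List (Fin n)) λ X → length X ≤ epBound k s × Hits E X)
  conclude T T! hit min (yes h) = pure (T , h , hit)
  conclude T T! hit min (no h) = do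
    let 𝕊 = record { IH = IH ; E = E ; ¬pack = ¬pack ; T = T ; T! = T! ; hitsT = hit ; minT = min }
    G ← WellLinked.findGrid 𝕊 ((8 + 4 * ℓ) * m) (ℕₚ.<⇒≤ (ℕₚ.≰⇒> h))
    Δ? ← ¬¬-∀Fin λ c → decFin (WellLinked.Cuts.Δ 𝕊 (8 + 4 * ℓ) m zero G c)
    bot ← WellLinked.Cuts.Close.contradiction 𝕊 (8 + 4 * ℓ) m zero G Δ? ℓ μ ℕₚ.≤-refl ℕₚ.≤-refl (ℕₚ.m≤m+n (suc (3 * (ℓ + ℓ))) (s + s)) (ℕₚ.m≤n+m (s + s) (suc (3 * (ℓ + ℓ))))
      (ℕₚ.m≤n⇒m≤1+n (ℕₚ.m≤m+n ℓ _)) (ℕₚ.m≤n⇒m≤1+n (ℕₚ.m≤n+m _ ℓ))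
    ⊥-elim bot

erdősPósa : ∀ k → Σ ℕ (EPWith k)
erdősPósa zero = 0 , λ E ¬pack → ⊥-elim (¬pack ((λ ()) , (λ ()) , λ ()))
erdősPósa (suc k) with s , IH ← erdősPósa k = epBound k s , smallHittingSet IH

-- Complete colorings from pairwise non-adjacent cycles

-- The properties of cycles on which the colouring argument rests, shared by directed and undirected
-- cycles. Connectedness in `Adj` is what confines a cycle to one of several non-adjacent vertex
-- sets.
record CycleSystem (n : ℕ) : Set₁ where
  field
    Adj   : Fin n → Fin n → Set
    Cycle : List (Fin n) → Set
    cycle-unique : ∀ {c} → Cycle c → Unique c
    cycle-length : ∀ {c} → Cycle c → 2 ≤ length c
    cycle-connected : ∀ {c x y} → Cycle c → x ∈ c → y ∈ c → Star (λ u v → Adj u v × u ∈ c × v ∈ c) x y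

  Cyclic : (Fin n → Set) → Set
  Cyclic S = Σ (List (Fin n)) λ c → Cycle c × (∀ {x} → x ∈ c → S x)

  record CompleteColoring (K : ℕ) : Set where
    field
      color    : Fin n → Fin K
      onto     : ∀ i → Σ (Fin n) λ v → color v ≡ i
      acyclic  : ∀ i → ¬ Cyclic (λ v → color v ≡ i)
      complete : ∀ i j → i ≢ j → Cyclic (λ v → color v ≡ i ⊎ color v ≡ j)

module Coloring {n : ℕ} (𝒞 : CycleSystem n) where
  open CycleSystem 𝒞
  open import Data.List.Membership.DecPropositional (F._≟_ {n}) using (_∈?_)

  -- Removing one vertex of such a cycle leaves no cycle on the others, as it would be shorter.
  Minimal : List (Fin n) → Set
  Minimal c = ∀ d → Cycle d → (∀ x → x ∈ d → x ∈ c) → length c ≤ length d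

  shorten : ∀ {c} → Cycle c → ¬ ¬ (Σ (List (Fin n)) λ d → Cycle d × (∀ x → x ∈ d → x ∈ c) × Minimal d)
  shorten {c} z = go (suc (length c)) z ℕₚ.≤-refl
    where
    go : ∀ N {c} → Cycle c → length c < N → ¬ ¬ (Σ (List (Fin n)) λ d → Cycle d × (∀ x → x ∈ d → x ∈ c) × Minimal d)
    go (suc N) {c} z (s≤s h) = em (Σ (List (Fin n)) λ d → Cycle d × (∀ x → x ∈ d → x ∈ c) × length d < length c) >>= λ where
      (no ¬p) → pure (c , z , (λ _ p → p) , λ d zd d⊆ → ℕₚ.≮⇒≥ λ lt → ¬p (d , zd , d⊆ , lt))
      (yes (d , zd , d⊆ , lt)) → do
        e , ze , e⊆ , min ← go N zd (ℕₚ.<-≤-trans lt h)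
        pure (e , ze , (λ x p → d⊆ x (e⊆ x p)) , min)

  record Partial (q K : ℕ) : Set where
    field
      color   : Fin n → Fin K
      acyclic : ∀ i → ¬ Cyclic (λ v → color v ≡ i)
      rep     : Fin q → Fin K
      clash   : ∀ a b → a ≢ b → Cyclic (λ v → color v ≡ rep a ⊎ color v ≡ rep b)

    -- Equal representatives would make a clash cycle monochromatic.
    rep-injective : ∀ {a b} → rep a ≡ rep b → a ≡ b
    rep-injective {a} {b} e with a F.≟ b
    ... | yes p = p
    ... | no ne with c , z , h ← clash a b ne = ⊥-elim (acyclic (rep b) (c , z , λ x∈ → mono (h x∈)))
      where
      mono : ∀ {v} → color v ≡ rep a ⊎ color v ≡ rep b → color v ≡ rep b
      mono (inj₁ p) = trans p e
      mono (inj₂ p) = p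

    q≤K : q ≤ K
    q≤K = Fₚ.injective⇒≤ {f = rep} rep-injective

  merge : ∀ {q K} (p : Partial q (suc K)) (x y : Fin (suc K)) → y ≢ x →
    ¬ Cyclic (λ v → Partial.color p v ≡ x ⊎ Partial.color p v ≡ y) → Partial q K
  merge {K = K} p x y y≢x ac = record
    { color = μ ∘ color ; rep = μ ∘ rep
    ; acyclic = λ w (c , z , h) → class w c z h
    ; clash = λ a b ne → let c , z , h = clash a b ne in c , z , λ x∈ → push (h x∈) }
    where
    open Partial p
    μ : Fin (suc K) → Fin K
    μ t with y F.≟ t
    ... | yes _ = F.punchOut y≢x
    ... | no ne = F.punchOut ne
    push : ∀ {v a b} → color v ≡ rep a ⊎ color v ≡ rep b → μ (color v) ≡ μ (rep a) ⊎ μ (color v) ≡ μ (rep b)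
    push (inj₁ e) = inj₁ (cong μ e)
    push (inj₂ e) = inj₂ (cong μ e)
    fiber : ∀ t → (t ≡ y × F.punchIn y (μ t) ≡ x) ⊎ (t ≡ F.punchIn y (μ t))
    fiber t with y F.≟ t
    ... | yes e = inj₁ (sym e , Fₚ.punchIn-punchOut y≢x)
    ... | no ne = inj₂ (sym (Fₚ.punchIn-punchOut ne))
    class : ∀ w c → Cycle c → (∀ {v} → v ∈ c → μ (color v) ≡ w) → ⊥
    class w c z h with F.punchIn y w F.≟ x
    ... | yes e = ac (c , z , λ v∈ → in-xy v∈ (fiber _))
      where
      in-xy : ∀ {v} → v ∈ c → (color v ≡ y × F.punchIn y (μ (color v)) ≡ x) ⊎ (color v ≡ F.punchIn y (μ (color v))) → color v ≡ x ⊎ color v ≡ y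
      in-xy v∈ (inj₁ (q , _)) = inj₂ q
      in-xy v∈ (inj₂ q) = inj₁ (trans q (trans (cong (F.punchIn y) (h v∈)) e))
    ... | no ne = acyclic (F.punchIn y w) (c , z , λ v∈ → in-z v∈ (fiber _))
      where
      in-z : ∀ {v} → v ∈ c → (color v ≡ y × F.punchIn y (μ (color v)) ≡ x) ⊎ (color v ≡ F.punchIn y (μ (color v))) → color v ≡ F.punchIn y w
      in-z v∈ (inj₁ (_ , q)) = ⊥-elim (ne (trans (cong (F.punchIn y) (sym (h v∈))) q))
      in-z v∈ (inj₂ q) = trans q (cong (F.punchIn y) (h v∈))

  another : ∀ {K} → 2 ≤ K → (x : Fin K) → Σ (Fin K) λ y → y ≢ x
  another (s≤s (s≤s _)) zero = suc zero , λ ()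
  another (s≤s (s≤s _)) (suc x) = zero , λ ()

  saturate : ∀ {q K} → 2 ≤ q → Partial q K → ¬ ¬ (Σ ℕ λ K′ → q ≤ K′ × CompleteColoring K′)
  saturate {q} {zero} 2≤q p = ⊥-elim (ℕₚ.<⇒≱ (ℕₚ.<-≤-trans (s≤s z≤n) 2≤q) (Partial.q≤K p))
  saturate {q} {suc K} 2≤q p =
    em (Σ (Fin (suc K)) λ x → Σ (Fin (suc K)) λ y → y ≢ x × ¬ Cyclic (λ v → color v ≡ x ⊎ color v ≡ y)) >>= λ where
      (yes (x , y , ne , ac)) → saturate 2≤q (merge p x y ne ac)
      (no none) → do
        complete ← ¬¬-∀Fin λ i → ¬¬-∀Fin λ j → full none i j (i F.≟ j)
        onto ← ¬¬-∀Fin λ i → λ empty → let j , ne = another (ℕₚ.≤-trans 2≤q q≤K) i in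
          none (i , j , ne , λ (c , z , h) → acyclic j (c , z , λ v∈ → drop empty (h v∈)))
        pure (suc K , q≤K , record { color = color ; onto = onto ; acyclic = acyclic ; complete = complete })
    where
    open Partial p
    drop : ∀ {i j v} → ¬ (Σ (Fin n) λ v → color v ≡ i) → color v ≡ i ⊎ color v ≡ j → color v ≡ j
    drop empty (inj₁ e) = ⊥-elim (empty (_ , e))
    drop empty (inj₂ e) = e
    full : ¬ (Σ (Fin (suc K)) λ x → Σ (Fin (suc K)) λ y → y ≢ x × ¬ Cyclic (λ v → color v ≡ x ⊎ color v ≡ y)) →
      ∀ i j → Dec (i ≡ j) → ¬ ¬ (i ≢ j → Cyclic (λ v → color v ≡ i ⊎ color v ≡ j))
    full none i j (yes e) = pure λ ne → ⊥-elim (ne e)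
    full none i j (no ne) = λ k → none (i , j , ne ∘ sym , λ c → k λ _ → c)

  -- Cycle number (i , j) gives colour i to its first vertex and colour j to the others.
  module Assign (q : ℕ) (cyc : Fin (q * q) → List (Fin n)) (isCycle : ∀ p → Cycle (cyc p)) (minimal : ∀ p → Minimal (cyc p))
    (apart : ∀ p p′ {x} → x ∈ cyc p → x ∈ cyc p′ → p ≡ p′) (nonAdj : ∀ p p′ {x y} → x ∈ cyc p → y ∈ cyc p′ → Adj x y → p ≡ p′) where

    In : Fin n → Fin (q * q) → Set
    In v p = v ∈ cyc p × proj₁ (F.remQuot q p) ≢ proj₂ (F.remQuot {q} q p)

    In? : ∀ v p → Dec (In v p)
    In? v p with v ∈? cyc p | proj₁ (F.remQuot q p) F.≟ proj₂ (F.remQuot {q} q p)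
    ... | no a  | _     = no (a ∘ proj₁)
    ... | yes _ | yes e = no λ (_ , ne) → ne e
    ... | yes a | no ne = yes (a , ne)

    isHead : Fin n → List (Fin n) → Fin q × Fin q → Fin q
    isHead v [] (i , j) = i
    isHead v (h ∷ _) (i , j) with v F.≟ h
    ... | yes _ = i
    ... | no _ = j

    -- Vertices outside the cycles with two different labels get the private colours `q ↑ʳ v`;
    -- `saturate` disposes of them.
    col : Fin n → Fin (q + n)
    col v with Fₚ.any? (In? v)
    ... | yes (p , _) = isHead v (cyc p) (F.remQuot q p) F.↑ˡ n
    ... | no _ = q F.↑ʳ v

    col-in : ∀ {v p} → In v p → col v ≡ isHead v (cyc p) (F.remQuot q p) F.↑ˡ n
    col-in {v} {p} h with Fₚ.any? (In? v)
    ... | yes (p′ , h′) = cong (λ p → isHead v (cyc p) (F.remQuot q p) F.↑ˡ n) (apart p′ p (proj₁ h′) (proj₁ h))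
    ... | no ¬p = ⊥-elim (¬p (p , h))

    head-color : ∀ v c ij → isHead v c ij ≡ proj₁ ij ⊎ isHead v c ij ≡ proj₂ ij
    head-color v [] ij = inj₁ refl
    head-color v (h ∷ _) ij with v F.≟ h
    ... | yes _ = inj₁ refl
    ... | no _ = inj₂ refl

    head-yes : ∀ h t ij → isHead h (h ∷ t) ij ≡ proj₁ ij
    head-yes h t ij with h F.≟ h
    ... | yes _ = refl
    ... | no ne = ⊥-elim (ne refl)

    head-no : ∀ {v h} t ij → v ≢ h → isHead v (h ∷ t) ij ≡ proj₂ ij
    head-no {v} {h} t ij ne with v F.≟ h
    ... | yes e = ⊥-elim (ne e)
    ... | no _ = refl

    singleton : ∀ {d} {h : Fin n} → Cycle d → (∀ {v} → v ∈ d → v ≡ h) → ⊥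
    singleton {d} z all = ℕₚ.<⇒≱ (cycle-length z) (unique-length-≤ {ys = _ ∷ []} (cycle-unique z) λ v∈ → here (all v∈))

    some∈ : ∀ {d} → Cycle d → Σ (Fin n) (_∈ d)
    some∈ {[]} z with () ← cycle-length z
    some∈ {x ∷ _} z = x , here refl

    -- A private class has one vertex. Any other monochromatic cycle is connected, so non-adjacency
    -- confines it to one `cyc p`. If it contains the head, it is the head alone, the rest having
    -- another colour; if not, it contradicts minimality.
    acyclicColor : ∀ x → ¬ Cyclic (λ v → col v ≡ x)
    acyclicColor x (d , z , mono) with some∈ z
    ... | v₀ , v₀∈ with Fₚ.any? (In? v₀) in eq
    ... | no none = singleton z λ v∈ → same v∈
      where
      lone : col v₀ ≡ q F.↑ʳ v₀
      lone rewrite eq = refl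
      same : ∀ {v} → v ∈ d → v ≡ v₀
      same {v} v∈ with Fₚ.any? (In? v) in eq′
      ... | no _ = Fₚ.↑ʳ-injective q v v₀ (trans (trans (sym c) (mono v∈)) (trans (sym (mono v₀∈)) lone))
        where
        c : col v ≡ q F.↑ʳ v
        c rewrite eq′ = refl
      ... | yes (p , h) = ⊥-elim (ℕₚ.<⇒≱ (subst (_< q) (sym (Fₚ.toℕ-↑ˡ (isHead v (cyc p) (F.remQuot q p)) n)) (Fₚ.toℕ<n _))
              (subst (q ≤_) (cong toℕ (trans (sym lone) (trans (mono v₀∈) (trans (sym (mono v∈)) (col-in h)))))
                (ℕₚ.≤-trans (ℕₚ.m≤m+n q (toℕ v₀)) (ℕₚ.≤-reflexive (sym (Fₚ.toℕ-↑ʳ q v₀))))))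
    ... | yes (p , h₀) = oneCycle (cyc p) refl
      where
      inside : ∀ {u v} → Star (λ u v → Adj u v × u ∈ d × v ∈ d) u v → In u p → In v p
      inside ε h = h
      inside {u} (_◅_ {j = w} (a , u∈ , w∈) r) h = inside r (lands (Fₚ.any? (In? w)) refl)
        where
        lands : (r : Dec (Σ (Fin (q * q)) (In w))) → r ≡ Fₚ.any? (In? w) → In w p
        lands (yes (p′ , h′)) _ = subst (In w) (sym (nonAdj p p′ (proj₁ h) (proj₁ h′) a)) h′
        lands (no none) e = ⊥-elim (ℕₚ.<⇒≱ (subst (_< q) (sym (Fₚ.toℕ-↑ˡ (isHead u (cyc p) (F.remQuot q p)) n)) (Fₚ.toℕ<n _))
              (subst (q ≤_) (cong toℕ (trans (sym lone) (trans (mono w∈) (trans (sym (mono u∈)) (col-in h)))))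
                (ℕₚ.≤-trans (ℕₚ.m≤m+n q (toℕ w)) (ℕₚ.≤-reflexive (sym (Fₚ.toℕ-↑ʳ q w))))))
          where
          lone : col w ≡ q F.↑ʳ w
          lone rewrite sym e = refl
      all : ∀ {v} → v ∈ d → In v p
      all v∈ = inside (cycle-connected z v₀∈ v∈) h₀
      colors : ∀ {u v} → u ∈ d → v ∈ d → isHead u (cyc p) (F.remQuot q p) ≡ isHead v (cyc p) (F.remQuot q p)
      colors u∈ v∈ = Fₚ.↑ˡ-injective n _ _ (trans (sym (col-in (all u∈))) (trans (mono u∈) (trans (sym (mono v∈)) (col-in (all v∈)))))
      oneCycle : ∀ c → cyc p ≡ c → ⊥
      oneCycle [] e with () ← subst (λ c → 2 ≤ length c) e (cycle-length (isCycle p))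
      oneCycle (h ∷ t) e with h ∈? d
      ... | no h∉ = ℕₚ.<⇒≱ (s≤s (unique-length-≤ (cycle-unique z) λ v∈ → tail v∈ (subst (_ ∈_) e (proj₁ (all v∈)))))
              (subst (λ c → length c ≤ length d) e (minimal p d z (λ _ v∈ → proj₁ (all v∈))))
        where
        tail : ∀ {v} → v ∈ d → v ∈ h ∷ t → v ∈ t
        tail v∈ (here refl) = ⊥-elim (h∉ v∈)
        tail v∈ (there v∈t) = v∈t
      ... | yes h∈ = singleton z isH
        where
        isH : ∀ {v} → v ∈ d → v ≡ h
        isH {v} v∈ with v F.≟ h
        ... | yes q = q
        ... | no ne = ⊥-elim (proj₂ (all h∈) (trans (sym hd) (trans (colors h∈ v∈) tl)))
          where
          hd = trans (cong (λ c → isHead h c (F.remQuot q p)) e) (head-yes h t _)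
          tl = trans (cong (λ c → isHead v c (F.remQuot q p)) e) (head-no t _ ne)

    partialColoring : Partial q (q + n)
    partialColoring = record { color = col ; acyclic = acyclicColor ; rep = F._↑ˡ n ; clash = clash }
      where
      clash : ∀ a b → a ≢ b → Cyclic (λ v → col v ≡ a F.↑ˡ n ⊎ col v ≡ b F.↑ˡ n)
      clash a b ne = cyc p , isCycle p , λ {v} v∈ → two v∈ (head-color v (cyc p) (F.remQuot q p))
        where
        p = F.combine a b
        e : F.remQuot q p ≡ (a , b)
        e = Fₚ.remQuot-combine a b
        two : ∀ {v} → v ∈ cyc p → isHead v (cyc p) (F.remQuot q p) ≡ proj₁ (F.remQuot q p) ⊎ isHead v (cyc p) (F.remQuot q p) ≡ proj₂ (F.remQuot {q} q p) →
          col v ≡ a F.↑ˡ n ⊎ col v ≡ b F.↑ˡ n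
        two v∈ (inj₁ q) = inj₁ (trans (col-in (v∈ , λ h → ne (subst (λ ij → proj₁ ij ≡ proj₂ ij) e h))) (cong (F._↑ˡ n) (trans q (cong proj₁ e))))
        two v∈ (inj₂ q) = inj₂ (trans (col-in (v∈ , λ h → ne (subst (λ ij → proj₁ ij ≡ proj₂ ij) e h))) (cong (F._↑ˡ n) (trans q (cong proj₂ e))))

  manyColors : ∀ q → 2 ≤ q → (cyc : Fin (q * q) → List (Fin n)) → (∀ p → Cycle (cyc p)) →
    (∀ p p′ {x} → x ∈ cyc p → x ∈ cyc p′ → p ≡ p′) → (∀ p p′ {x y} → x ∈ cyc p → y ∈ cyc p′ → Adj x y → p ≡ p′) →
    ¬ ¬ (Σ ℕ λ K → q ≤ K × CompleteColoring K)
  manyColors q 2≤q cyc isCycle apart nonAdj = do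
    short ← ¬¬-∀Fin λ p → shorten (isCycle p)
    saturate 2≤q (Assign.partialColoring q (λ p → proj₁ (short p)) (λ p → proj₁ (proj₂ (short p))) (λ p → proj₂ (proj₂ (proj₂ (short p))))
      (λ p p′ x y → apart p p′ (proj₁ (proj₂ (proj₂ (short p))) _ x) (proj₁ (proj₂ (proj₂ (short p′))) _ y))
      (λ p p′ x y → nonAdj p p′ (proj₁ (proj₂ (proj₂ (short p))) _ x) (proj₁ (proj₂ (proj₂ (short p′))) _ y)))

-- Density of graphs without a complete minor

split-count : ∀ {A B C : Set} (f : A → B ⊎ C) (xs : List A) → Unique xs →
  (∀ {x y} → x ∈ xs → y ∈ xs → f x ≡ f y → x ≡ y) →
  Σ (List B) λ ls → Σ (List C) λ rs → Unique ls × Unique rs × length xs ≡ length ls + length rs ×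
    (∀ {b} → b ∈ ls → Σ A λ x → x ∈ xs × f x ≡ inj₁ b) × (∀ {c} → c ∈ rs → Σ A λ x → x ∈ xs × f x ≡ inj₂ c)
split-count f [] _ _ = [] , [] , [] , [] , refl , (λ ()) , λ ()
split-count {A} f (x ∷ xs) (x∉ ∷ u) inj with split-count f xs u (λ p q → inj (there p) (there q))
... | ls , rs , ul , ur , e , hl , hr with f x in fx
... | inj₁ b = b ∷ ls , rs , All.tabulate (λ b'∈ eq → let y , y∈ , fy = hl b'∈ in
        All.lookup x∉ y∈ (inj (here refl) (there y∈) (trans fx (trans (cong inj₁ eq) (sym fy))))) ∷ ul , ur , cong suc e
      , (λ { (here refl) → x , here refl , fx ; (there p) → let y , y∈ , fy = hl p in y , there y∈ , fy })
      , λ p → let y , y∈ , fy = hr p in y , there y∈ , fy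
... | inj₂ c = ls , c ∷ rs , ul , All.tabulate (λ c'∈ eq → let y , y∈ , fy = hr c'∈ in
        All.lookup x∉ y∈ (inj (here refl) (there y∈) (trans fx (trans (cong inj₂ eq) (sym fy))))) ∷ ur
      , trans (cong suc e) (sym (ℕₚ.+-suc (length ls) (length rs)))
      , (λ p → let y , y∈ , fy = hl p in y , there y∈ , fy)
      , λ { (here refl) → x , here refl , fx ; (there p) → let y , y∈ , fy = hr p in y , there y∈ , fy }

pairs-count : ∀ {A B : Set} D (xs : List A) (P : A → B → Set) → Unique xs →
  (∀ {x} → x ∈ xs → Σ (List B) λ ys → Unique ys × D ≤ length ys × (∀ {y} → y ∈ ys → P x y)) →
  Σ (List (A × B)) λ zs → Unique zs × length xs * D ≤ length zs × (∀ {x y} → (x , y) ∈ zs → x ∈ xs × P x y)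
pairs-count D [] P _ _ = [] , [] , z≤n , λ ()
pairs-count {A} {B} D (x ∷ xs) P (x∉ ∷ u) h with pairs-count D xs P u (h ∘ there) | h (here refl)
... | zs , uz , lz , hz | ys , uy , ly , hy = map (x ,_) ys ++ zs
    , Uₚ.++⁺ (Uₚ.map⁺ (λ { refl → refl }) uy) uz (λ (p , q) → apart p q)
    , ℕₚ.≤-trans (ℕₚ.+-mono-≤ (ℕₚ.≤-trans ly (ℕₚ.≤-reflexive (sym (Lₚ.length-map (x ,_) ys)))) lz) (ℕₚ.≤-reflexive (sym (Lₚ.length-++ (map (x ,_) ys))))
    , member
  where
  apart : ∀ {z} → z ∈ map (x ,_) ys → z ∈ zs → ⊥
  apart p q with Mₚ.∈-map⁻ (x ,_) p
  ... | y , _ , refl = All.lookup x∉ (proj₁ (hz q)) refl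
  member : ∀ {a b} → (a , b) ∈ map (x ,_) ys ++ zs → a ∈ x ∷ xs × P a b
  member p with Mₚ.∈-++⁻ (map (x ,_) ys) p
  ... | inj₂ q = there (proj₁ (hz q)) , proj₂ (hz q)
  ... | inj₁ q with Mₚ.∈-map⁻ (x ,_) q
  ...   | y , y∈ , refl = here refl , hy y∈

*-strict : ∀ {A : Set} {L : List A} {x} → x ∈ L → ∀ d → d * length L < length L * suc d
*-strict {L = _ ∷ L} _ d = ℕₚ.<-≤-trans (s≤s (ℕₚ.m≤n+m (d * suc (length L)) (length L))) (ℕₚ.≤-reflexive (ℕₚ.*-comm (suc d) (suc (length L))))

-- A model of the complete graph on `h` vertices. Branch sets are predicates and become a labelling
-- only in `Excluded.noModel`.
record Model {V : Set} (h : ℕ) (S : List V) (A : V → V → Set) : Set₁ where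
  field
    B     : Fin h → V → Set
    sub   : ∀ i {x} → B i x → x ∈ S
    some  : ∀ i → Σ V (B i)
    disj  : ∀ i j {x} → B i x → B j x → i ≡ j
    conn  : ∀ i {x y} → B i x → B i y → WalkIn′ A (B i) x y
    touch : ∀ i j → i ≢ j → Σ V λ x → Σ V λ y → B i x × B j y × A x y

Arcs≤ : ∀ {V : Set} → List V → (V → V → Set) → ℕ → Set
Arcs≤ {V} S A N = ∀ (xs : List (V × V)) → Unique xs → (∀ {u v} → (u , v) ∈ xs → u ∈ S × v ∈ S × A u v) → length xs ≤ N

-- This is `2 ^ (h + 1) - 2`, a bound on the number of ordered adjacent pairs per vertex. The
-- recursion is the loss of `2 * suc D` pairs when contracting an edge with at most `D` common
-- neighbours.
density : ℕ → ℕ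
density zero = 0
density (suc h) = 2 * suc (density h)

Contracted : ∀ {V : Set} (A : V → V → Set) (u v : V) → V → V → Set
Contracted A u v x y = x ≢ y × (A x y ⊎ (x ≡ u × A v y) ⊎ (y ≡ u × A x v))

module _ {V : Set} {A : V → V → Set} (A-sym : ∀ {x y} → A x y → A y x) where

  Contracted-sym : ∀ {u v x y} → Contracted A u v x y → Contracted A u v y x
  Contracted-sym (ne , inj₁ a) = ne ∘ sym , inj₁ (A-sym a)
  Contracted-sym (ne , inj₂ (inj₁ (e , a))) = ne ∘ sym , inj₂ (inj₂ (e , A-sym a))
  Contracted-sym (ne , inj₂ (inj₂ (e , a))) = ne ∘ sym , inj₂ (inj₁ (e , A-sym a))

  -- `v` joins the branch set of `u`, if there is one, and an edge that `u` got from `v` is rerouted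
  -- through `v`.
  uncontract : ∀ {h S S′ u v} → A u v → v ∈ S → v ∉ S′ → (∀ {x} → x ∈ S′ → x ∈ S) → Model h S′ (Contracted A u v) → Model h S A
  uncontract {u = u} {v} auv v∈ v∉ S′⊆ M = record
    { B = B′ ; sub = λ { i (inj₁ b) → S′⊆ (sub i b) ; i (inj₂ (refl , _)) → v∈ } ; some = λ i → let x , b = some i in x , inj₁ b
    ; disj = λ { i j (inj₁ a) (inj₁ b) → disj i j a b ; i j (inj₁ a) (inj₂ (refl , _)) → ⊥-elim (v∉ (sub i a))
               ; i j (inj₂ (refl , _)) (inj₁ b) → ⊥-elim (v∉ (sub j b)) ; i j (inj₂ (_ , a)) (inj₂ (_ , b)) → disj i j a b }
    ; conn = conn′ ; touch = touch′ }
    where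
    open Model M
    B′ : Fin _ → V → Set
    B′ i x = B i x ⊎ (x ≡ v × B i u)
    lift : ∀ i {x y} (w : Star (Contracted A u v) x y) → (∀ {z} → on w z → B i z) → WalkIn′ A (B′ i) x y
    lift i ε h = ε , λ { refl → inj₁ (h refl) }
    lift i ((_ , inj₁ a) ◅ w) h with w′ , h′ ← lift i w (h ∘ inj₂) = a ◅ w′ , λ { (inj₁ e) → inj₁ (h (inj₁ e)) ; (inj₂ o) → h′ o }
    lift i ((_ , inj₂ (inj₁ (refl , a))) ◅ w) h with w′ , h′ ← lift i w (h ∘ inj₂) =
      auv ◅ a ◅ w′ , λ { (inj₁ e) → inj₁ (h (inj₁ e)) ; (inj₂ (inj₁ e)) → inj₂ (e , h (inj₁ refl)) ; (inj₂ (inj₂ o)) → h′ o }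
    lift i ((_ , inj₂ (inj₂ (refl , a))) ◅ w) h with w′ , h′ ← lift i w (h ∘ inj₂) =
      a ◅ A-sym auv ◅ w′ , λ { (inj₁ e) → inj₁ (h (inj₁ e)) ; (inj₂ (inj₁ e)) → inj₂ (e , h (inj₂ (on-start w))) ; (inj₂ (inj₂ o)) → h′ o }
    core : ∀ i {x y} → B i x → B i y → WalkIn′ A (B′ i) x y
    core i a b = let w , h = conn i a b in lift i w h
    conn′ : ∀ i {x y} → B′ i x → B′ i y → WalkIn′ A (B′ i) x y
    conn′ i (inj₁ a) (inj₁ b) = core i a b
    conn′ i (inj₁ a) (inj₂ (refl , b)) = core i a b ⊕ (auv ◅ ε , λ { (inj₁ refl) → inj₁ b ; (inj₂ refl) → inj₂ (refl , b) })
    conn′ i (inj₂ (refl , a)) (inj₁ b) = (A-sym auv ◅ ε , λ { (inj₁ refl) → inj₂ (refl , a) ; (inj₂ refl) → inj₁ a }) ⊕ core i a b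
    conn′ i (inj₂ (refl , a)) (inj₂ (refl , b)) = ε , λ { refl → inj₂ (refl , a) }
    touch′ : ∀ i j → i ≢ j → Σ V λ x → Σ V λ y → B′ i x × B′ j y × A x y
    touch′ i j ne with touch i j ne
    ... | x , y , bx , by , _ , inj₁ a = x , y , inj₁ bx , inj₁ by , a
    ... | x , y , bx , by , _ , inj₂ (inj₁ (refl , a)) = v , y , inj₂ (refl , bx) , inj₁ by , a
    ... | x , y , bx , by , _ , inj₂ (inj₂ (refl , a)) = x , v , inj₁ bx , inj₂ (refl , by) , a

  cone : ∀ {h S N u} → u ∈ S → (∀ {x} → x ∈ N → x ∈ S × A u x × x ≢ u) → Model h N A → Model (suc h) S A
  cone {h} {u = u} u∈ nb M = record
    { B = B′ ; sub = λ { zero refl → u∈ ; (suc i) b → proj₁ (nb (sub i b)) }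
    ; some = λ { zero → u , refl ; (suc i) → some i }
    ; disj = λ { zero zero _ _ → refl ; zero (suc j) refl b → ⊥-elim (proj₂ (proj₂ (nb (sub j b))) refl)
               ; (suc i) zero a refl → ⊥-elim (proj₂ (proj₂ (nb (sub i a))) refl) ; (suc i) (suc j) a b → cong suc (disj i j a b) }
    ; conn = λ { zero refl refl → ε , (λ e → e) ; (suc i) a b → conn i a b }
    ; touch = touch′ }
    where
    open Model M
    B′ : Fin (suc h) → V → Set
    B′ zero x = x ≡ u
    B′ (suc i) x = B i x
    touch′ : ∀ i j → i ≢ j → Σ V λ x → Σ V λ y → B′ i x × B′ j y × A x y
    touch′ zero zero ne = ⊥-elim (ne refl)
    touch′ zero (suc j) _ = let x , b = some j in u , x , refl , b , proj₁ (proj₂ (nb (sub j b)))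
    touch′ (suc i) zero _ = let x , b = some i in x , u , b , refl , A-sym (proj₁ (proj₂ (nb (sub i b))))
    touch′ (suc i) (suc j) ne = touch i j (λ e → ne (cong suc e))

module Mader {n : ℕ} where
  open import Data.List.Membership.DecPropositional (F._≟_ {n}) using (_∈?_)
  private
    V′ = Fin n

  Few : List V′ → (V′ → V′ → Set) → ℕ → V′ → V′ → Set
  Few S A D u v = ∀ ys → Unique ys → (∀ {y} → y ∈ ys → y ∈ S × A u y × A v y) → length ys ≤ D

  module _ {A : V′ → V′ → Set} (A-sym : ∀ {x y} → A x y → A y x) (A-irr : ∀ {x} → ¬ A x x) (A? : ∀ x y → Dec (A x y))
    {S S′ : List V′} {u v : V′} (auv : A u v) (S⇒S′ : ∀ {x} → x ∈ S → x ≢ v → x ∈ S′) (u∈ : u ∈ S) where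

    -- An arc at v becomes an arc at u, unless the latter exists already or is a loop.
    move : V′ × V′ → (V′ × V′) ⊎ (Bool × V′)
    move (x , y) with x F.≟ v | y F.≟ v
    ... | yes _ | _ with y F.≟ u | A? u y
    ...   | no _ | no _ = inj₁ (u , y)
    ...   | _    | _    = inj₂ (false , y)
    move (x , y) | no _ | yes _ with x F.≟ u | A? u x
    ...   | no _ | no _ = inj₁ (x , u)
    ...   | _    | _    = inj₂ (true , x)
    move (x , y) | no _ | no _ = inj₁ (x , y)

    Move : V′ → V′ → (V′ × V′) ⊎ (Bool × V′) → Set
    Move x y (inj₁ (a , b)) = (x ≡ v × y ≢ u × ¬ A u y × a ≡ u × b ≡ y) ⊎ (x ≢ v × y ≡ v × x ≢ u × ¬ A u x × a ≡ x × b ≡ u) ⊎ (x ≢ v × y ≢ v × a ≡ x × b ≡ y)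
    Move x y (inj₂ (false , b)) = x ≡ v × b ≡ y × (y ≡ u ⊎ A u y)
    Move x y (inj₂ (true , b)) = y ≡ v × b ≡ x × (x ≡ u ⊎ A u x)

    moves : ∀ x y → Move x y (move (x , y))
    moves x y with x F.≟ v | y F.≟ v
    ... | yes p | _ with y F.≟ u | A? u y
    ...   | no a | no b = inj₁ (p , a , b , refl , refl)
    ...   | yes a | _ = p , refl , inj₁ a
    ...   | no _ | yes b = p , refl , inj₂ b
    moves x y | no p | yes q with x F.≟ u | A? u x
    ...   | no a | no b = inj₂ (inj₁ (p , q , a , b , refl , refl))
    ...   | yes a | _ = q , refl , inj₁ a
    ...   | no _ | yes b = q , refl , inj₂ b
    moves x y | no p | no q = inj₂ (inj₂ (p , q , refl , refl))

    moved : ∀ {x y r} → move (x , y) ≡ r → Move x y r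
    moved refl = moves _ _

    -- The pairs that are lost join `v` to `u` or to a common neighbour, at most `suc D` in each
    -- direction.
    contraction-count : ∀ {D N} → Few S A D u v → Arcs≤ S′ (Contracted A u v) N → Arcs≤ S A (N + 2 * suc D)
    contraction-count {D} {N} few arcs xs xs! ok with split-count move xs xs! inj
      where
      clash : ∀ {x y x' y' r} → A x y → A x' y' → Move x y r → Move x' y' r → (x , y) ≡ (x' , y')
      clash {r = inj₁ _} a a' (inj₁ (refl , _ , _ , refl , refl)) (inj₁ (refl , _ , _ , _ , refl)) = refl
      clash {r = inj₁ _} a a' (inj₁ (_ , ne , _ , refl , refl)) (inj₂ (inj₁ (_ , _ , ne' , _ , refl , e))) = ⊥-elim (ne' refl)
      clash {r = inj₁ _} a a' (inj₁ (_ , _ , ¬a , refl , refl)) (inj₂ (inj₂ (_ , _ , refl , refl))) = ⊥-elim (¬a a')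
      clash {r = inj₁ _} a a' (inj₂ (inj₁ (_ , _ , ne , _ , refl , refl))) (inj₁ (_ , _ , _ , e , _)) = ⊥-elim (ne e)
      clash {r = inj₁ _} a a' (inj₂ (inj₁ (_ , refl , _ , _ , refl , refl))) (inj₂ (inj₁ (_ , refl , _ , _ , refl , _))) = refl
      clash {r = inj₁ _} a a' (inj₂ (inj₁ (_ , _ , _ , ¬a , refl , refl))) (inj₂ (inj₂ (_ , _ , refl , refl))) = ⊥-elim (¬a (A-sym a'))
      clash {r = inj₁ _} a a' (inj₂ (inj₂ (_ , _ , refl , refl))) (inj₁ (_ , _ , ¬a , refl , refl)) = ⊥-elim (¬a a)
      clash {r = inj₁ _} a a' (inj₂ (inj₂ (_ , _ , refl , refl))) (inj₂ (inj₁ (_ , _ , _ , ¬a , refl , refl))) = ⊥-elim (¬a (A-sym a))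
      clash {r = inj₁ _} a a' (inj₂ (inj₂ (_ , _ , refl , refl))) (inj₂ (inj₂ (_ , _ , refl , refl))) = refl
      clash {r = inj₂ (false , _)} a a' (refl , refl , _) (refl , refl , _) = refl
      clash {r = inj₂ (true , _)} a a' (refl , refl , _) (refl , refl , _) = refl
      inj : ∀ {p q} → p ∈ xs → q ∈ xs → move p ≡ move q → p ≡ q
      inj {x , y} {x' , y'} p∈ q∈ e = clash (proj₂ (proj₂ (ok p∈))) (proj₂ (proj₂ (ok q∈))) (moved {x} {y} e) (moves x' y')
    ... | ls , rs , ls! , rs! , e , hl , hr = ℕₚ.≤-trans (ℕₚ.≤-reflexive e) (ℕₚ.+-mono-≤ (arcs ls ls! okl) right)
      where
      okl : ∀ {a b} → (a , b) ∈ ls → a ∈ S′ × b ∈ S′ × Contracted A u v a b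
      okl p with (x , y) , xy∈ , fe ← hl p with x∈ , y∈ , a ← ok xy∈ with moved {x} {y} fe
      ... | inj₁ (refl , y≢u , ¬a , refl , refl) = S⇒S′ u∈ (λ { refl → A-irr auv }) , S⇒S′ y∈ (λ { refl → A-irr a }) , y≢u ∘ sym , inj₂ (inj₁ (refl , a))
      ... | inj₂ (inj₁ (x≢v , refl , x≢u , ¬a , refl , refl)) = S⇒S′ x∈ x≢v , S⇒S′ u∈ (λ { refl → A-irr auv }) , x≢u , inj₂ (inj₂ (refl , a))
      ... | inj₂ (inj₂ (x≢v , y≢v , refl , refl)) = S⇒S′ x∈ x≢v , S⇒S′ y∈ y≢v , (λ { refl → A-irr a }) , inj₁ a
      Near : V′ → Set
      Near y = y ∈ S × A v y × (y ≡ u ⊎ A u y)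
      near : ∀ {b y} → (b , y) ∈ rs → Near y
      near p with (x , y) , xy∈ , fe ← hr p with x∈ , y∈ , a ← ok xy∈ = nearest x∈ y∈ a (moved {x} {y} fe)
        where
        nearest : ∀ {x y b z} → x ∈ S → y ∈ S → A x y → Move x y (inj₂ (b , z)) → Near z
        nearest {b = false} x∈ y∈ a (refl , refl , h) = y∈ , a , h
        nearest {b = true} x∈ y∈ a (refl , refl , h) = x∈ , A-sym a , h
      bound : ∀ ys → Unique ys → (∀ {y} → y ∈ ys → Near y) → length ys ≤ suc D
      bound ys ys! h = ℕₚ.≤-trans (unique-length-≤ ys! λ {y} y∈ → place y∈ (y F.≟ u)) (s≤s (few zs (Uₚ.filter⁺ _ ys!) common))
        where
        ≢u? : ∀ y → Dec (y ≢ u)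
        ≢u? y = Relation.Nullary.¬? (y F.≟ u)
        zs = filter ≢u? ys
        place : ∀ {y} → y ∈ ys → Dec (y ≡ u) → y ∈ u ∷ zs
        place y∈ (yes refl) = here refl
        place y∈ (no ne) = there (Mₚ.∈-filter⁺ ≢u? y∈ ne)
        common : ∀ {y} → y ∈ zs → y ∈ S × A u y × A v y
        common y∈ with Mₚ.∈-filter⁻ ≢u? {xs = ys} y∈
        ... | y∈ys , ne with h y∈ys
        ... | y∈S , av , inj₁ e = ⊥-elim (ne e)
        ... | y∈S , av , inj₂ au = y∈S , au , av
      side : Bool × V′ → V′ ⊎ V′
      side (false , y) = inj₁ y
      side (true , y) = inj₂ y
      side-inj : ∀ p q → side p ≡ side q → p ≡ q
      side-inj (false , y) (false , _) refl = refl
      side-inj (true , y) (true , _) refl = refl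
      right : length rs ≤ 2 * suc D
      right with split-count side rs rs! (λ _ _ → side-inj _ _)
      ... | l₂ , r₂ , l! , r! , e₂ , hl₂ , hr₂ = ℕₚ.≤-trans (ℕₚ.≤-reflexive e₂) (ℕₚ.+-mono-≤
              (bound l₂ l! λ p → nl (hl₂ p)) (ℕₚ.≤-trans (bound r₂ r! λ p → nr (hr₂ p)) (ℕₚ.≤-reflexive (sym (ℕₚ.+-identityʳ _)))))
        where
        nl : ∀ {y} → (Σ (Bool × V′) λ p → p ∈ rs × side p ≡ inj₁ y) → Near y
        nl ((false , _) , p∈ , refl) = near p∈
        nr : ∀ {y} → (Σ (Bool × V′) λ p → p ∈ rs × side p ≡ inj₂ y) → Near y
        nr ((true , _) , p∈ , refl) = near p∈

  record Graph : Set₁ where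
    field
      A     : V′ → V′ → Set
      A-sym : ∀ {x y} → A x y → A y x
      A-irr : ∀ {x} → ¬ A x x

  MaderFor : ℕ → Set₁
  MaderFor h = ∀ N (G : Graph) (S : List V′) → let open Graph G in Unique S → length S ≤ N → ¬ Model h S A → Arcs≤ S A (density h * length S)

  -- Each vertex of the neighbourhood of `u` has more than `density h` neighbours within it, so the
  -- neighbourhood is too dense to lack a model with `h` branch sets, and `u` is a further one.
  denseNeighbourhoods : ∀ {h} → MaderFor h → (G : Graph) (S : List V′) → let open Graph G in Unique S → ¬ Model (suc h) S A →
    (∀ x y → Dec (A x y)) → (∀ {u v} → u ∈ S → v ∈ S → A u v → ¬ Few S A (density h) u v) →
    ∀ xs → Unique xs → (∀ {u v} → (u , v) ∈ xs → u ∈ S × v ∈ S × A u v) → ¬ ¬ (length xs ≤ density (suc h) * length S)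
  denseNeighbourhoods IH G S S! ¬M A? many [] xs! ok = pure z≤n
  denseNeighbourhoods {h} IH G S S! ¬M A? many ((u , v) ∷ xs) xs! ok = do
      ys ← ¬¬-∀Fin λ w → λ k → k λ w∈ → ⊥-elim (toMany w w∈ λ r → k λ _ → r)
      let zs , zs! , len′ , h′ = pairs-count (suc (density h)) Nb (λ w y → y ∈ Nb × A w y) Nb! λ {w} → ys w
          small = IH (length Nb) G Nb Nb! ℕₚ.≤-refl (λ M → ¬M (cone A-sym u∈ nb M)) zs zs!
                    λ p → let w∈ , y∈ , a = h′ p in w∈ , y∈ , a
      λ _ → ℕₚ.<⇒≱ (*-strict v∈Nb (density h)) (ℕₚ.≤-trans len′ small)
    where
    open Graph G
    u∈ = proj₁ (ok (here refl))
    Nb = filter (A? u) S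
    Nb! = Uₚ.filter⁺ (A? u) S!
    v∈Nb : v ∈ Nb
    v∈Nb = Mₚ.∈-filter⁺ (A? u) (proj₁ (proj₂ (ok (here refl)))) (proj₂ (proj₂ (ok (here refl))))
    nb : ∀ {x} → x ∈ Nb → x ∈ S × A u x × x ≢ u
    nb p with x∈ , a ← Mₚ.∈-filter⁻ (A? u) {xs = S} p = x∈ , a , λ { refl → A-irr a }
    Wanted : V′ → Set
    Wanted w = Σ (List V′) λ ys → Unique ys × suc (density h) ≤ length ys × (∀ {y} → y ∈ ys → y ∈ Nb × A w y)
    toMany : ∀ w → w ∈ Nb → ¬ ¬ Wanted w
    toMany w w∈ k with w∈S , a , _ ← nb w∈ = many u∈ w∈S a λ ys ys! h′ → ℕₚ.≮⇒≥ λ lt → k (ys , ys! , lt , λ y∈ →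
      let y∈S , auy , awy = h′ y∈ in Mₚ.∈-filter⁺ (A? u) y∈S auy , awy)

  -- Contract an edge with few common neighbours; if there is none, the neighbourhoods are dense and have no K_h minor.
  maderStep : ∀ {h} → MaderFor h → MaderFor (suc h)
  maderStep IH N G S S! len ¬M [] xs! ok = z≤n
  maderStep IH zero G [] S! len ¬M (_ ∷ _) xs! ok with () ← proj₁ (ok (here refl))
  maderStep {h} IH (suc N) G S S! len ¬M xs@(_ ∷ _) xs! ok = Relation.Nullary.decidable-stable (length xs ℕₚ.≤? density (suc h) * length S) do
      A? ← ¬¬-∀Fin λ x → decFin (A x)
      few ← em (Σ V′ λ u → Σ V′ λ v → u ∈ S × v ∈ S × A u v × Few S A (density h) u v)
      cases A? few
    where
    open Graph G
    cases : (∀ x y → Dec (A x y)) → Dec (Σ V′ λ u → Σ V′ λ v → u ∈ S × v ∈ S × A u v × Few S A (density h) u v) →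
      ¬ ¬ (length xs ≤ density (suc h) * length S)
    cases A? (no ¬p) = denseNeighbourhoods IH G S S! ¬M A? (λ u∈ v∈ a few → ¬p (_ , _ , u∈ , v∈ , a , few)) xs xs! ok
    cases A? (yes (u , v , u∈ , v∈ , a , few)) = pure (ℕₚ.≤-trans
        (contraction-count A-sym A-irr A? a (Mₚ.∈-filter⁺ ≢v?) u∈ few
          (maderStep IH N (record { A = Contracted A u v ; A-sym = Contracted-sym A-sym ; A-irr = λ (ne , _) → ne refl }) S″ (Uₚ.filter⁺ ≢v? S!)
            (ℕₚ.≤-pred (ℕₚ.≤-trans shorter len))
            (λ M → ¬M (uncontract A-sym a v∈ (λ p → proj₂ (Mₚ.∈-filter⁻ ≢v? {xs = S} p) refl) (λ p → proj₁ (Mₚ.∈-filter⁻ ≢v? {xs = S} p)) M))) xs xs! ok)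
        (ℕₚ.≤-trans (ℕₚ.≤-reflexive (trans (ℕₚ.+-comm (density (suc h) * length S″) _) (sym (ℕₚ.*-suc (density (suc h)) (length S″)))))
          (ℕₚ.*-monoʳ-≤ (density (suc h)) shorter)))
      where
      ≢v? : ∀ y → Dec (y ≢ v)
      ≢v? y = Relation.Nullary.¬? (y F.≟ v)
      S″ = filter ≢v? S
      shorter : suc (length S″) ≤ length S
      shorter = unique-length-≤ {xs = v ∷ S″} (All.tabulate (λ p e → proj₂ (Mₚ.∈-filter⁻ ≢v? {xs = S} p) (sym e)) ∷ Uₚ.filter⁺ ≢v? S!)
        λ { (here refl) → v∈ ; (there p) → proj₁ (Mₚ.∈-filter⁻ ≢v? {xs = S} p) }

  mader : ∀ h → MaderFor h
  mader zero N G S S! h ¬M = ⊥-elim (¬M (record { B = λ () ; sub = λ () ; some = λ () ; disj = λ () ; conn = λ () ; touch = λ () }))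
  mader (suc h) = maderStep (mader h)

  fewNeighbours : ∀ {D} (G : Graph) (S : List V′) → let open Graph G in Unique S → Arcs≤ S A (D * length S) → ∀ {s} → s ∈ S →
    ¬ ¬ (Σ V′ λ u → u ∈ S × (∀ ys → Unique ys → (∀ {y} → y ∈ ys → y ∈ S × A u y) → length ys ≤ D))
  fewNeighbours {D} G S S! arcs s∈ none = ¬¬-∀Fin {P = λ w → w ∈ S → Σ (List V′) λ ys → Unique ys × suc D ≤ length ys × (∀ {y} → y ∈ ys → y ∈ S × Graph.A G w y)}
    (λ w k → k λ w∈ → ⊥-elim (none (w , w∈ , λ ys ys! h → ℕₚ.≮⇒≥ λ lt → k λ _ → ys , ys! , lt , h))) λ ys →
      let zs , zs! , len , h = pairs-count (suc D) S (λ w y → y ∈ S × Graph.A G w y) S! λ {w} → ys w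
      in ℕₚ.<⇒≱ (*-strict s∈ D) (ℕₚ.≤-trans len (arcs zs zs! h))

  -- Greedy: some vertex has at most `D` neighbours, and choosing it discards at most `suc D`
  -- vertices.
  independent : ∀ {D} (G : Graph) → let open Graph G in (∀ S → Unique S → Arcs≤ S A (D * length S)) → ∀ N S → Unique S → length S ≤ N →
    ¬ ¬ (Σ (List V′) λ I → Unique I × (∀ {x} → x ∈ I → x ∈ S) × (∀ {x y} → x ∈ I → y ∈ I → ¬ A x y) × length S ≤ suc D * length I)
  independent G arcs N [] S! len = pure ([] , [] , (λ ()) , (λ ()) , z≤n)
  independent {D} G arcs (suc N) S@(s ∷ _) S! len = do
    A? ← ¬¬-∀Fin λ x → decFin (A x)
    u , u∈ , few ← fewNeighbours {D} G S S! (arcs S S!) (here refl)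
    let rest? = λ y → Relation.Nullary._×-dec_ (Relation.Nullary.¬? (y F.≟ u)) (Relation.Nullary.¬? (A? u y))
        S′ = filter rest? S
        nbs = filter (A? u) S
        in-rest : ∀ {y} → y ∈ S′ → y ∈ S × y ≢ u × ¬ A u y
        in-rest p = Mₚ.∈-filter⁻ rest? {xs = S} p
        S′! = Uₚ.filter⁺ rest? S!
        smaller : suc (length S′) ≤ length S
        smaller = unique-length-≤ {xs = u ∷ S′} (All.tabulate (λ p e → proj₁ (proj₂ (in-rest p)) (sym e)) ∷ S′!)
          λ { (here refl) → u∈ ; (there p) → proj₁ (in-rest p) }
        place : ∀ {y} → y ∈ S → Dec (y ≡ u) → Dec (A u y) → y ∈ (u ∷ nbs) ++ S′
        place y∈ = λ { (yes refl) _ → here refl ; (no ne) (yes a) → Mₚ.∈-++⁺ˡ {ys = S′} (there (Mₚ.∈-filter⁺ (A? u) y∈ a))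
                     ; (no ne) (no ¬a) → Mₚ.∈-++⁺ʳ (u ∷ nbs) (Mₚ.∈-filter⁺ rest? y∈ (ne , ¬a)) }
        covered : length S ≤ suc D + length S′
        covered = ℕₚ.≤-trans (unique-length-≤ S! λ {y} y∈ → place y∈ (y F.≟ u) (A? u y))
          (ℕₚ.≤-trans (ℕₚ.≤-reflexive (Lₚ.length-++ (u ∷ nbs))) (ℕₚ.+-monoˡ-≤ (length S′) (s≤s
            (few nbs (Uₚ.filter⁺ (A? u) S!) λ p → Mₚ.∈-filter⁻ (A? u) {xs = S} p))))
    I , I! , I⊆ , ind , size ← independent {D} G arcs N S′ S′! (ℕₚ.≤-pred (ℕₚ.≤-trans smaller len))
    pure (u ∷ I , All.tabulate (λ p e → proj₁ (proj₂ (in-rest (I⊆ p))) (sym e)) ∷ I!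
      , (λ { (here refl) → u∈ ; (there p) → proj₁ (in-rest (I⊆ p)) })
      , (λ { (here refl) (here refl) → A-irr ; (here refl) (there q) → proj₂ (proj₂ (in-rest (I⊆ q)))
           ; (there p) (here refl) a → proj₂ (proj₂ (in-rest (I⊆ p))) (A-sym a) ; (there p) (there q) → ind p q })
      , ℕₚ.≤-trans covered (ℕₚ.≤-trans (ℕₚ.+-monoʳ-≤ (suc D) size) (ℕₚ.≤-reflexive (sym (ℕₚ.*-suc (suc D) (length I))))))
    where
    open Graph G

-- Graphs of minimum degree three without a complete minor have short cycles

len : ∀ {V : Set} {R : V → V → Set} {u v} → Star R u v → ℕ
len ε = 0
len (_ ◅ w) = suc (len w)

verts : ∀ {V : Set} {R : V → V → Set} {u v} → Star R u v → List V
verts {u = u} ε = u ∷ []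
verts {u = u} (_ ◅ w) = u ∷ verts w

module _ {V : Set} {R : V → V → Set} where
  verts-length : ∀ {u v} (w : Star R u v) → length (verts w) ≡ suc (len w)
  verts-length ε = refl
  verts-length (_ ◅ w) = cong suc (verts-length w)

  on⇒verts : ∀ {u v x} (w : Star R u v) → on w x → x ∈ verts w
  on⇒verts ε refl = here refl
  on⇒verts (_ ◅ w) (inj₁ refl) = here refl
  on⇒verts (_ ◅ w) (inj₂ o) = there (on⇒verts w o)

  verts⇒on : ∀ {u v x} (w : Star R u v) → x ∈ verts w → on w x
  verts⇒on ε (here refl) = refl
  verts⇒on (_ ◅ w) (here refl) = inj₁ refl
  verts⇒on (_ ◅ w) (there p) = inj₂ (verts⇒on w p)

  len-◅◅ : ∀ {u v t} (p : Star R u v) (q : Star R v t) → len (p ◅◅ q) ≡ len p + len q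
  len-◅◅ ε q = refl
  len-◅◅ (_ ◅ p) q = cong suc (len-◅◅ p q)

  back : (∀ {x y} → R x y → R y x) → ∀ {u v} (p : Star R u v) → Σ (Star R v u) λ q → len q ≡ len p
  back s ε = ε , refl
  back s (r ◅ p) with q , e ← back s p = q ◅◅ s r ◅ ε , trans (len-◅◅ q (s r ◅ ε)) (trans (ℕₚ.+-comm (len q) 1) (cong suc e))

  Simple : ∀ {u v} → Star R u v → Set
  Simple ε = ⊤
  Simple {u} (_ ◅ w) = ¬ on w u × Simple w

  cutTo : ∀ {u v x} (w : Star R u v) → Simple w → on w x → Σ (Star R x v) λ w′ → Simple w′ × len w′ ≤ len w
  cutTo ε s refl = ε , tt , z≤n
  cutTo (r ◅ w) s (inj₁ refl) = r ◅ w , s , ℕₚ.≤-refl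
  cutTo (r ◅ w) (_ , s) (inj₂ o) with w′ , s′ , h ← cutTo w s o = w′ , s′ , ℕₚ.m≤n⇒m≤1+n h

map-len : ∀ {V : Set} {R R′ : V → V → Set} (f : ∀ {x y} → R x y → R′ x y) {u v} (w : Star R u v) → len (Star.map f w) ≡ len w
map-len f ε = refl
map-len f (_ ◅ w) = cong suc (map-len f w)

module ShortCore {n : ℕ} where
  open import Data.List.Membership.DecPropositional (F._≟_ {n}) using (_∈?_)
  open Mader {n}
  private
    V = Fin n

  TwoIn : (V → V → Set) → List V → V → Set
  TwoIn R C x = Σ V λ y → Σ V λ y′ → y ≢ y′ × y ∈ C × y′ ∈ C × R x y × R x y′

  -- Stands for a cycle of length at most `g`.
  Short : (V → V → Set) → ℕ → Set
  Short R g = Σ (List V) λ C → Σ V (_∈ C) × length C ≤ g × (∀ {x} → x ∈ C → TwoIn R C x)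

  module _ {R : V → V → Set} where
    erase : ∀ {u v} (w : Star R u v) → Σ (Star R u v) λ w′ → Simple w′ × len w′ ≤ len w
    erase ε = ε , tt , z≤n
    erase {u} (r ◅ w) with erase w
    ... | w′ , s , h with u ∈? verts w′
    ... | no u∉ = r ◅ w′ , ((λ o → u∉ (on⇒verts w′ o)) , s) , s≤s h
    ... | yes u∈ with w″ , s″ , h″ ← cutTo w′ s (verts⇒on w′ u∈) = w″ , s″ , ℕₚ.m≤n⇒m≤1+n (ℕₚ.≤-trans h″ h)

  module Shortcut {R : V → V → Set} (R-sym : ∀ {x y} → R x y → R y x) (R-irr : ∀ {x} → ¬ R x x) (x y : V) (rxy : R x y) where
    R⁻ : V → V → Set
    R⁻ u v = R u v × ¬ (u ≡ x × v ≡ y) × ¬ (u ≡ y × v ≡ x)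

    R⁻-sym : ∀ {u v} → R⁻ u v → R⁻ v u
    R⁻-sym (r , a , b) = R-sym r , (λ (p , q) → b (q , p)) , λ (p , q) → a (q , p)

    cycle : ∀ {ℓ} (w : Star R⁻ x y) → len w ≤ ℓ → Short R (suc ℓ)
    cycle w h with erase w
    ... | ε , _ , _ = ⊥-elim (R-irr rxy)
    ... | _◅_ {j = u} r w′ , (x∉ , s) , h′ = C , (x , here refl)
        , ℕₚ.≤-trans (s≤s (ℕₚ.≤-reflexive (verts-length w′))) (s≤s (ℕₚ.≤-trans h′ h))
        , λ { (here refl) → u , y , (λ e → proj₁ (proj₂ r) (refl , e)) , there (on⇒verts w′ (on-start w′)) , there (on⇒verts w′ (on-end w′)) , proj₁ r , rxy
            ; (there p) → inner x r w′ s x∉ (here refl) (λ o → there (on⇒verts w′ o)) (verts⇒on w′ p) }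
      where
      C = x ∷ verts w′
      inner : ∀ q {u z} → R⁻ q u → (w : Star R⁻ u y) → Simple w → ¬ on w q → q ∈ C → (∀ {z} → on w z → z ∈ C) → on w z → TwoIn R C z
      inner q r ε s q∉ q∈ sub refl = q , x , (λ e → proj₁ (proj₂ r) (e , refl)) , q∈ , here refl , R-sym (proj₁ r) , R-sym rxy
      inner q r (r′ ◅ w) (u∉ , s) q∉ q∈ sub (inj₁ refl) = q , _ , (λ { refl → q∉ (inj₂ (on-start w)) }) , q∈ , sub (inj₂ (on-start w)) , R-sym (proj₁ r) , proj₁ r′
      inner q r (r′ ◅ w) (u∉ , s) q∉ q∈ sub (inj₂ o) = inner _ r′ w s u∉ (sub (inj₁ refl)) (sub ∘ inj₂) o

  -- The longest cycle that occurs consists of two edges between the same two cells and two walks of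
  -- length at most `4 * density h` inside the cells.
  shortSize : ℕ → ℕ
  shortSize h = suc (suc (8 * density h))

  record NoShortCore (h : ℕ) : Set₁ where
    field
      G   : Graph
      S   : List V
      S!  : Unique S
      A?  : ∀ x y → Dec (Graph.A G x y)
      deg : ∀ {x} → x ∈ S → Σ (List V) λ ys → Unique ys × 3 ≤ length ys × (∀ {y} → y ∈ ys → y ∈ S × Graph.A G x y)
      ¬M  : ¬ Model h S (Graph.A G)
      none : ¬ Short (λ x y → Graph.A G x y × x ∈ S × y ∈ S) (shortSize h)

  module Cells {h : ℕ} (𝕊 : NoShortCore h) where
    open NoShortCore 𝕊
    open Graph G

    R : V → V → Set
    R x y = A x y × x ∈ S × y ∈ S

    R? : ∀ x y → Dec (R x y)
    R? x y = Relation.Nullary._×-dec_ (A? x y) (Relation.Nullary._×-dec_ (x ∈? S) (y ∈? S))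

    D τ : ℕ
    D = density h
    τ = D + D

    R-sym : ∀ {x y} → R x y → R y x
    R-sym (a , x∈ , y∈) = A-sym a , y∈ , x∈

    R-irr : ∀ {x} → ¬ R x x
    R-irr r = A-irr (proj₁ r)

    Ball : ℕ → V → V → Set
    Ball j c w = Σ (Star R c w) λ p → len p ≤ j

    ball-sym : ∀ {j c w} → Ball j c w → Ball j w c
    ball-sym (p , h) with q , e ← back R-sym p = q , subst (_≤ _) (sym e) h

    ball-trans : ∀ {i j c w x} → Ball i c w → Ball j w x → Ball (i + j) c x
    ball-trans (p , h) (q , h′) = p ◅◅ q , subst (_≤ _) (sym (len-◅◅ p q)) (ℕₚ.+-mono-≤ h h′)

    ball-S : ∀ {j c w} → c ∈ S → Ball j c w → w ∈ S
    ball-S c∈ (w , _) = stays {P = _∈ S} (λ r _ → proj₂ (proj₂ r)) w c∈ (on-end w)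

    -- If no vertex can be added, the set collected so far is closed under neighbours, has minimum
    -- degree three and is itself a short core.
    bigBall : ∀ j c → c ∈ S → suc j ≤ shortSize h → ¬ ¬ (Σ (List V) λ L → Unique L × suc j ≤ length L × length L ≤ suc j × c ∈ L × (∀ {w} → w ∈ L → Ball j c w))
    bigBall zero c c∈ _ = pure (c ∷ [] , [] ∷ [] , ℕₚ.≤-refl , ℕₚ.≤-refl , here refl , λ { (here refl) → ε , z≤n ; (there ()) })
    bigBall (suc j) c c∈ g = do
      L , L! , lo , hi , c∈L , inB ← bigBall j c c∈ (ℕₚ.<⇒≤ g)
      new ← em (Σ V λ w → Ball (suc j) c w × w ∉ L)
      grow L L! lo hi c∈L inB new
      where
      grow : ∀ L → Unique L → suc j ≤ length L → length L ≤ suc j → c ∈ L → (∀ {w} → w ∈ L → Ball j c w) → Dec (Σ V λ w → Ball (suc j) c w × w ∉ L) →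
        ¬ ¬ (Σ (List V) λ L → Unique L × suc (suc j) ≤ length L × length L ≤ suc (suc j) × c ∈ L × (∀ {w} → w ∈ L → Ball (suc j) c w))
      grow L L! lo hi c∈L inB (yes (w , b , w∉)) = pure (w ∷ L , All.tabulate (λ { p refl → w∉ p }) ∷ L! , s≤s lo , s≤s hi , there c∈L
        , λ { (here refl) → b ; (there p) → let q , l = inB p in q , ℕₚ.m≤n⇒m≤1+n l })
      grow L L! lo hi c∈L inB (no closed) = ⊥-elim (none (L , (c , c∈L) , ℕₚ.≤-trans hi (ℕₚ.<⇒≤ g) , λ {x} x∈ → two x∈ (deg (ball-S c∈ (inB x∈)))))
        where
        inL : ∀ {x y} → x ∈ L → A x y → y ∈ S → y ∈ L
        inL {x} {y} x∈ a y∈ with y ∈? L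
        ... | yes p = p
        ... | no p = ⊥-elim (closed (y , (let q , l = inB x∈ in q ◅◅ (a , ball-S c∈ (inB x∈) , y∈) ◅ ε
                , ℕₚ.≤-trans (ℕₚ.≤-reflexive (trans (len-◅◅ q _) (ℕₚ.+-comm (len q) 1))) (s≤s l)) , p))
        two : ∀ {x} → x ∈ L → (Σ (List V) λ ys → Unique ys × 3 ≤ length ys × (∀ {y} → y ∈ ys → y ∈ S × A x y)) → TwoIn R L x
        two x∈ (y₁ ∷ y₂ ∷ _ , ((ne ∷ _) ∷ _) , _ , h) with y₁∈ , a₁ ← h (here refl) with y₂∈ , a₂ ← h (there (here refl)) =
          y₁ , y₂ , ne , inL x∈ a₁ y₁∈ , inL x∈ a₂ y₂∈ , (a₁ , (ball-S c∈ (inB x∈)) , y₁∈) , (a₂ , (ball-S c∈ (inB x∈)) , y₂∈)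
        two x∈ (_ ∷ [] , _ , s≤s () , _)

    Meet : V → V → Set
    Meet c s = Σ V λ x → Ball D c x × Ball D s x

    -- A maximal scattered set: the balls of radius `D` around centres are disjoint, and each vertex
    -- is within `D + D`, that is `τ`, of a centre.
    Centres : List V → Set
    Centres Xs = Σ (List V) λ I → Unique I × (∀ {c} → c ∈ I → c ∈ Xs) ×
      (∀ {c c′} → c ∈ I → c′ ∈ I → Meet c c′ → c ≡ c′) × (∀ {s} → s ∈ Xs → Σ V λ c → c ∈ I × Meet c s)

    centres : ∀ Xs → ¬ ¬ Centres Xs
    centres [] = pure ([] , [] , (λ ()) , (λ ()) , λ ())
    centres (s ∷ Xs) = do
      I , I! , I⊆ , ap , cov ← centres Xs
      d ← em (Σ V λ c → c ∈ I × Meet c s)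
      pure (decide I I! I⊆ ap cov d)
      where
      self : ∀ c → Meet c c
      self c = c , (ε , z≤n) , (ε , z≤n)
      flip-meet : ∀ {c d} → Meet c d → Meet d c
      flip-meet (x , p , q) = x , q , p
      decide : ∀ I → Unique I → (∀ {c} → c ∈ I → c ∈ Xs) → (∀ {c c′} → c ∈ I → c′ ∈ I → Meet c c′ → c ≡ c′) →
        (∀ {s} → s ∈ Xs → Σ V λ c → c ∈ I × Meet c s) → Dec (Σ V λ c → c ∈ I × Meet c s) → Centres (s ∷ Xs)
      decide I I! I⊆ ap cov (yes p) = I , I! , (λ c∈ → there (I⊆ c∈)) , ap , λ { (here refl) → p ; (there q) → cov q }
      decide I I! I⊆ ap cov (no ¬p) = s ∷ I , All.tabulate (λ { c∈ refl → ¬p (s , c∈ , self s) }) ∷ I!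
        , (λ { (here refl) → here refl ; (there c∈) → there (I⊆ c∈) })
        , (λ { (here refl) (here refl) _ → refl ; (here refl) (there c∈) m → ⊥-elim (¬p (_ , c∈ , flip-meet m))
             ; (there c∈) (here refl) m → ⊥-elim (¬p (_ , c∈ , m)) ; (there p) (there q) m → ap p q m })
        , λ { (here refl) → s , here refl , self s ; (there q) → let c , c∈ , m = cov q in c , there c∈ , m }

    module Quotient (𝕀 : Centres S) where
      I : List V
      I = proj₁ 𝕀

      I! : Unique I
      I! = proj₁ (proj₂ 𝕀)

      I⊆S : ∀ {c} → c ∈ I → c ∈ S
      I⊆S = proj₁ (proj₂ (proj₂ 𝕀))

      apart : ∀ {c c′} → c ∈ I → c′ ∈ I → Meet c c′ → c ≡ c′
      apart = proj₁ (proj₂ (proj₂ (proj₂ 𝕀)))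

      cover : ∀ {s} → s ∈ S → Σ V λ c → c ∈ I × Meet c s
      cover = proj₂ (proj₂ (proj₂ (proj₂ 𝕀)))

      abstract
        just? : ∀ {B : Set} (m : Maybe B) → Dec (Σ B λ b → m ≡ just b)
        just? nothing = no λ ()
        just? (just b) = yes (b , refl)

        -- Breadth-first search from all centres: the centre and the parent of each vertex reached
        -- within `t` rounds. A label once given is kept.
        T : ℕ → V → Maybe (V × V)
        near : ∀ t w → Dec (Σ V λ y → R w y × Σ (V × V) λ b → T t y ≡ just b)
        T zero w with w ∈? I
        ... | yes _ = just (w , w)
        ... | no _ = nothing
        T (suc t) w with T t w | near t w
        ... | just b  | _ = just b
        ... | nothing | yes (y , _ , (c , _) , _) = just (c , y)
        ... | nothing | no _ = nothing
        near t w = Fₚ.any? λ y → Relation.Nullary._×-dec_ (R? w y) (just? (T t y))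

        T-step : ∀ {t w b} → T t w ≡ just b → T (suc t) w ≡ just b
        T-step {t} {w} e with T t w | near t w
        T-step refl | just b | _ = refl

        T-mono : ∀ {t t′ w b} → t ≤ t′ → T t w ≡ just b → T t′ w ≡ just b
        T-mono {t′ = zero} z≤n e = e
        T-mono {t} {suc t′} h e with ℕₚ.m≤n⇒m<n∨m≡n h
        ... | inj₂ refl = e
        ... | inj₁ (s≤s h′) = T-step {t′} (T-mono h′ e)

        T-sound : ∀ t {w c p} → T t w ≡ just (c , p) → (w ≡ c × c ∈ I) ⊎ (Σ ℕ λ t′ → t′ < t × R w p × Σ V λ p′ → T t′ p ≡ just (c , p′))
        T-sound zero {w} e with w ∈? I
        T-sound zero refl | yes w∈ = inj₁ (refl , w∈)
        T-sound (suc t) {w} e with T t w in eq | near t w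
        T-sound (suc t) refl | just b | _ with T-sound t eq
        ... | inj₁ h = inj₁ h
        ... | inj₂ (t′ , lt , r) = inj₂ (t′ , ℕₚ.m≤n⇒m≤1+n lt , r)
        T-sound (suc t) refl | nothing | yes (y , r , (c , p′) , e) = inj₂ (t , ℕₚ.≤-refl , r , p′ , e)

        T-complete : ∀ t {w c} → c ∈ I → (p : Star R w c) → len p ≤ t → Σ (V × V) λ b → T t w ≡ just b
        T-complete t {w} c∈ ε _ = (w , w) , T-mono {0} {t} z≤n start
          where
          start : T 0 w ≡ just (w , w)
          start with w ∈? I
          ... | yes _ = refl
          ... | no w∉ = ⊥-elim (w∉ c∈)
        T-complete (suc t) {w} c∈ (r ◅ p) (s≤s h) with T t w | near t w | T-complete t c∈ p h
        ... | just b  | _ | _ = b , refl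
        ... | nothing | yes (y , _ , (c , _) , _) | _ = (c , y) , refl
        ... | nothing | no none′ | b , e = ⊥-elim (none′ (_ , r , b , e))

        root par : V → V
        root w with T τ w
        ... | just (c , _) = c
        ... | nothing = w
        par w with T τ w
        ... | just (_ , p) = p
        ... | nothing = w

        T-root : ∀ {t w c p} → t ≤ τ → T t w ≡ just (c , p) → root w ≡ c × par w ≡ p
        T-root {t} {w} h e with T τ w | T-mono {t} {τ} {w} h e
        ... | _ | refl = refl , refl

      Tree : V → V → Set
      Tree u v = R u v × par u ≡ v × root u ≡ root v

      abstract
        climb : ∀ N t {w c p} → t ≤ N → t ≤ τ → T t w ≡ just (c , p) → c ∈ I × Σ (Star Tree w c) λ q → len q ≤ t
        climb N t h hτ e with T-sound t e
        ... | inj₁ (refl , c∈) = c∈ , ε , z≤n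
        climb (suc N) t h hτ e | inj₂ (t′ , lt , r , p′ , e′) with climb N t′ (ℕₚ.≤-pred (ℕₚ.≤-trans lt h)) (ℕₚ.≤-trans (ℕₚ.<⇒≤ lt) hτ) e′
        ... | c∈ , q , l = c∈ , (r , proj₂ (T-root hτ e) , trans (proj₁ (T-root hτ e)) (sym (proj₁ (T-root (ℕₚ.≤-trans (ℕₚ.<⇒≤ lt) hτ) e′)))) ◅ q , ℕₚ.≤-trans (s≤s l) lt
        climb zero t h hτ e | inj₂ (t′ , lt , _) = ⊥-elim (ℕₚ.n≮0 (ℕₚ.<-≤-trans lt h))

        toRoot : ∀ {w} → w ∈ S → root w ∈ I × Σ (Star Tree w (root w)) λ q → len q ≤ τ
        toRoot {w} w∈ with c , c∈ , x , p , q ← cover w∈ with ball-trans q (ball-sym p)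
        ... | r , l with T-complete τ c∈ r l
        ... | b , e = subst (λ c → c ∈ I × Σ (Star Tree w c) λ q → len q ≤ τ) (sym (proj₁ (T-root ℕₚ.≤-refl e))) (climb τ τ ℕₚ.≤-refl ℕₚ.≤-refl e)

        -- `w` is labelled within `D` rounds and so lies in the `D`-ball of its root too; since the
        -- balls are disjoint, the root is `c`.
        ball⊆cell : ∀ {c w} → c ∈ I → Ball D c w → root w ≡ c
        ball⊆cell {c} {w} c∈ b with q , l ← ball-sym b with (c′ , _) , e ← T-complete D c∈ q l with climb D D ℕₚ.≤-refl (ℕₚ.m≤m+n D D) e
        ... | c′∈ , q′ , l′ = trans (proj₁ (T-root (ℕₚ.m≤m+n D D) e)) (apart c′∈ c∈ (w , ball-sym (Star.map proj₁ q′ , subst (_≤ D) (sym (map-len proj₁ q′)) l′) , b))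

      tooShort : ∀ {g} → g ≤ shortSize h → ¬ Short R g
      tooShort le (C , ne , l , two) = none (C , ne , ℕₚ.≤-trans l le , two)

      τ₄ : (τ + τ) + (τ + τ) ≡ 8 * D
      τ₄ = solve 1 (λ d → ((d :+ d) :+ (d :+ d)) :+ ((d :+ d) :+ (d :+ d)) := con 8 :* d) refl D
        where open import Data.Nat.Solver using (module +-*-Solver)
              open +-*-Solver

      module Away {x y : V} (rxy : R x y) (avoid : ∀ {u v} → Tree u v → ¬ (u ≡ x × v ≡ y) × ¬ (u ≡ y × v ≡ x)) where
        open Shortcut R-sym R-irr x y rxy public

        Bounded : ℕ → V → V → Set
        Bounded ℓ a b = Σ (Star R⁻ a b) λ q → len q ≤ ℓ

        up : ∀ {w} → w ∈ S → Bounded τ w (root w)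
        up w∈ = let q , l = proj₂ (toRoot w∈) in Star.map (λ t → proj₁ t , avoid t) q , subst (_≤ τ) (sym (map-len _ q)) l

        down : ∀ {w} → w ∈ S → Bounded τ (root w) w
        down w∈ = let q , l = up w∈ ; q′ , e = back R⁻-sym q in q′ , subst (_≤ τ) (sym e) l

        join′ : ∀ {i j a b c} → Bounded i a b → Bounded j b c → Bounded (i + j) a c
        join′ (p , l) (q , l′) = p ◅◅ q , ℕₚ.≤-trans (ℕₚ.≤-reflexive (len-◅◅ p q)) (ℕₚ.+-mono-≤ l l′)

        walk : ∀ {a b} → a ∈ S → b ∈ S → root a ≡ root b → Bounded (τ + τ) a b
        walk {a} {b} a∈ b∈ e = join′ (up a∈) (subst (λ c → Bounded τ c b) (sym e) (down b∈))

      -- Otherwise the edge closes a cycle of length at most `2 * τ + 1` through the root.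
      inner-tree : ∀ {x y} → R x y → root x ≡ root y → par x ≢ y → par y ≡ x
      inner-tree {x} {y} r@(_ , x∈ , y∈) e ne = Relation.Nullary.decidable-stable (par y F.≟ x) λ ne′ →
        let avoid : ∀ {u v} → Tree u v → ¬ (u ≡ x × v ≡ y) × ¬ (u ≡ y × v ≡ x)
            avoid = λ { (_ , p , _) → (λ { (refl , refl) → ne p }) , λ { (refl , refl) → ne′ p } }
            w , l = Away.walk r avoid x∈ y∈ e
        in tooShort (s≤s (ℕₚ.≤-trans (ℕₚ.≤-trans (ℕₚ.m≤m+n (τ + τ) (τ + τ)) (ℕₚ.≤-reflexive τ₄)) (ℕₚ.n≤1+n _))) (Away.cycle r avoid w l)

      -- Two walks through the roots, of at most `2 * τ` steps each, and the two edges: exactly the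
      -- length allowed by `shortSize`.
      crossing-cycle : ∀ {x y x′ y′} → R x y → R x′ y′ → root x ≢ root y → root x ≡ root x′ → root y ≡ root y′ → ¬ (x′ ≡ x × y′ ≡ y) → ⊥
      crossing-cycle {x} {y} {x′} {y′} r@(_ , x∈ , y∈) r′@(_ , x′∈ , y′∈) ne ex ey diff = tooShort (s≤s (s≤s (ℕₚ.≤-reflexive τ₄))) (cycle (proj₁ w) lw)
        where
        avoid : ∀ {u v} → Tree u v → ¬ (u ≡ x × v ≡ y) × ¬ (u ≡ y × v ≡ x)
        avoid (_ , _ , e) = (λ { (refl , refl) → ne e }) , λ { (refl , refl) → ne (sym e) }
        open Away r avoid
        mid : Bounded 1 x′ y′
        mid = (r′ , diff , λ (e , _) → ne (trans ex (cong root e))) ◅ ε , s≤s z≤n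
        w : Bounded ((τ + τ) + (1 + (τ + τ))) x y
        w = join′ (walk x∈ x′∈ ex) (join′ mid (walk y′∈ y∈ (sym ey)))
        lw : len (proj₁ w) ≤ suc ((τ + τ) + (τ + τ))
        lw = ℕₚ.≤-trans (proj₂ w) (ℕₚ.≤-reflexive (ℕₚ.+-suc (τ + τ) (τ + τ)))

      one-cross : ∀ {x y x′ y′} → R x y → R x′ y′ → root x ≢ root y → root x ≡ root x′ → root y ≡ root y′ → (x , y) ≡ (x′ , y′)
      one-cross {x} {y} {x′} {y′} r r′ ne ex ey with x F.≟ x′ | y F.≟ y′
      ... | yes refl | yes refl = refl
      ... | no p | _ = ⊥-elim (crossing-cycle r r′ ne ex ey (λ (a , _) → p (sym a)))
      ... | yes _ | no q = ⊥-elim (crossing-cycle r r′ ne ex ey (λ (_ , b) → q (sym b)))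

      A′ : V → V → Set
      A′ c d = c ≢ d × Σ V λ x → Σ V λ y → root x ≡ c × root y ≡ d × R x y

      quotient : Model h I A′ → Model h S A
      quotient M = record
        { B = B′ ; sub = λ i → proj₁ ; some = λ i → let c , b = some i in c , I⊆S (sub i b) , subst (B i) (sym (ball⊆cell (sub i b) (ε , z≤n))) b
        ; disj = λ i j (_ , a) (_ , b) → disj i j a b ; conn = conn′ ; touch = touch′ }
        where
        open Model M
        B′ : Fin h → V → Set
        B′ i x = x ∈ S × B i (root x)
        centre : ∀ {c} → c ∈ I → root c ≡ c
        centre c∈ = ball⊆cell c∈ (ε , z≤n)
        climb′ : ∀ i {x y} (q : Star Tree x y) → x ∈ S → B i (root x) → WalkIn′ A (B′ i) x y
        climb′ i ε x∈ b = ε , λ { refl → x∈ , b }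
        climb′ i ((r , _ , e) ◅ q) x∈ b with a , _ , y∈ ← r with w , hw ← climb′ i q y∈ (subst (B i) e b) =
          a ◅ w , λ { (inj₁ refl) → x∈ , b ; (inj₂ o) → hw o }
        reverse : ∀ {P x y} → WalkIn′ A P x y → WalkIn′ A P y x
        reverse {P} (w , h) = go w h
          where
          go : ∀ {x y} (w : Star A x y) → (∀ {z} → on w z → P z) → WalkIn′ A P y x
          go ε h = ε , h
          go (a ◅ w) h = go w (h ∘ inj₂) ⊕ (A-sym a ◅ ε , λ { (inj₁ refl) → h (inj₂ (on-start w)) ; (inj₂ refl) → h (inj₁ refl) })
        home : ∀ i {x} → x ∈ S → B i (root x) → WalkIn′ A (B′ i) x (root x)
        home i x∈ b = climb′ i (proj₁ (proj₂ (toRoot x∈))) x∈ b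
        steps : ∀ i {c d} (w : Star A′ c d) → (∀ {z} → on w z → B i z) → WalkIn′ A (B′ i) c d
        steps i {c} ε hw = ε , λ { refl → I⊆S (sub i (hw refl)) , subst (B i) (sym (centre (sub i (hw refl)))) (hw refl) }
        steps i ((_ , x , y , refl , refl , r) ◅ w) hw with a , x∈ , y∈ ← r =
          reverse (home i x∈ (hw (inj₁ refl))) ⊕ (a ◅ ε , λ { (inj₁ refl) → x∈ , hw (inj₁ refl) ; (inj₂ refl) → y∈ , hw (inj₂ (on-start w)) })
          ⊕ home i y∈ (hw (inj₂ (on-start w))) ⊕ steps i w (hw ∘ inj₂)
        conn′ : ∀ i {x y} → B′ i x → B′ i y → WalkIn′ A (B′ i) x y
        conn′ i (x∈ , a) (y∈ , b) = home i x∈ a ⊕ (let w , hw = conn i a b in steps i w hw) ⊕ reverse (home i y∈ b)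
        touch′ : ∀ i j → i ≢ j → Σ V λ x → Σ V λ y → B′ i x × B′ j y × A x y
        touch′ i j ne with touch i j ne
        ... | _ , _ , bc , bd , _ , x , y , refl , refl , r with a , x∈ , y∈ ← r = x , y , (x∈ , bc) , (y∈ , bd) , a

      quotientGraph : Graph
      quotientGraph = record { A = A′ ; A-sym = λ (ne , x , y , ex , ey , r) → ne ∘ sym , y , x , ey , ex , R-sym r ; A-irr = λ (ne , _) → ne refl }

      classify : V × V → (Bool × V) ⊎ (V × V)
      classify (x , y) with root x F.≟ root y | par x F.≟ y
      ... | yes _ | yes _ = inj₁ (false , x)
      ... | yes _ | no _ = inj₁ (true , y)
      ... | no _ | _ = inj₂ (root x , root y)

      Class : V → V → (Bool × V) ⊎ (V × V) → Set
      Class x y (inj₁ (false , a)) = a ≡ x × par x ≡ y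
      Class x y (inj₁ (true , b)) = b ≡ y × root x ≡ root y × par x ≢ y
      Class x y (inj₂ (c , d)) = c ≡ root x × d ≡ root y × root x ≢ root y

      classified : ∀ x y {r} → classify (x , y) ≡ r → Class x y r
      classified x y refl with root x F.≟ root y | par x F.≟ y
      ... | yes _ | yes q = refl , q
      ... | yes p | no q = refl , p , q
      ... | no p | _ = refl , refl , p

      -- Minimum degree three gives at least `3 * length S` arcs. At most `length S` lead to a
      -- parent and as many from a parent to a child; the others are at most one for each ordered
      -- pair of adjacent cells, so `mader` in the quotient bounds them by `D * length I`.
      count : length S ≤ D * length I
      count with pairs-count 3 S (λ x y → y ∈ S × A x y) S! deg
      ... | zs , zs! , lz , hz with split-count classify zs zs! inj
        where
        arc : ∀ {x y} → (x , y) ∈ zs → R x y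
        arc p with x∈ , y∈ , a ← hz p = (a , x∈ , y∈)
        same : ∀ {x y x′ y′ r} → R x y → R x′ y′ → Class x y r → Class x′ y′ r → (x , y) ≡ (x′ , y′)
        same {r = inj₁ (false , _)} _ _ (refl , refl) (refl , refl) = refl
        same {r = inj₁ (true , _)} a a′ (refl , e , ne) (refl , e′ , ne′) with refl ← inner-tree a e ne | refl ← inner-tree a′ e′ ne′ = refl
        same {r = inj₂ _} a a′ (refl , refl , ne) (ex , ey , _) = one-cross a a′ ne ex ey
        inj : ∀ {p q} → p ∈ zs → q ∈ zs → classify p ≡ classify q → p ≡ q
        inj {x , y} {x′ , y′} p∈ q∈ e = same (arc p∈) (arc q∈) (classified x y e) (classified x′ y′ refl)
      ... | ls , rs , ls! , rs! , e , hl , hr = ℕₚ.+-cancelˡ-≤ (length S + length S) (length S) (D * length I) (ℕₚ.≤-trans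
              (ℕₚ.≤-reflexive (solve 1 (λ a → (a :+ a) :+ a := a :* con 3) refl (length S)))
              (ℕₚ.≤-trans lz (ℕₚ.≤-trans (ℕₚ.≤-reflexive e) (ℕₚ.+-mono-≤ left right))))
        where
        open import Data.Nat.Solver using (module +-*-Solver)
        open +-*-Solver
        in-S : ∀ {b v} → (b , v) ∈ ls → v ∈ S
        in-S p with (x , y) , xy∈ , fe ← hl p with x∈ , y∈ , _ ← hz xy∈ = pickV (classified x y fe)
          where
          pickV : ∀ {b v} → Class x y (inj₁ (b , v)) → v ∈ S
          pickV {false} (refl , _) = x∈
          pickV {true} (refl , _) = y∈
        left : length ls ≤ length S + length S
        left = ℕₚ.≤-trans (unique-length-≤ {ys = fs ++ ts} ls! place)
          (ℕₚ.≤-reflexive (trans (Lₚ.length-++ fs {ts}) (cong₂ _+_ (Lₚ.length-map (tag false) S) (Lₚ.length-map (tag true) S))))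
          where
          tag : Bool → V → Bool × V
          tag b v = b , v
          fs ts : List (Bool × V)
          fs = map (tag false) S
          ts = map (tag true) S
          place : ∀ {b} → b ∈ ls → b ∈ fs ++ ts
          place {false , v} p = Mₚ.∈-++⁺ˡ (Mₚ.∈-map⁺ (tag false) (in-S p))
          place {true , v} p = Mₚ.∈-++⁺ʳ fs (Mₚ.∈-map⁺ (tag true) (in-S p))
        right : length rs ≤ D * length I
        right = mader h (length I) quotientGraph I I! ℕₚ.≤-refl (¬M ∘ quotient) rs rs! member
          where
          member : ∀ {c d} → (c , d) ∈ rs → c ∈ I × d ∈ I × A′ c d
          member p with (x , y) , xy∈ , fe ← hr p with x∈ , y∈ , a ← hz xy∈ with refl , refl , ne ← classified x y fe =
            proj₁ (toRoot x∈) , proj₁ (toRoot y∈) , ne , x , y , refl , refl , (a , x∈ , y∈)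

      -- Each cell contains a ball with more than `D` vertices, against `count`.
      contradiction′ : ∀ {c} → c ∈ I → ¬ ¬ ⊥
      contradiction′ c∈ = do
        balls ← ¬¬-∀Fin {P = λ c → c ∈ I → Σ (List V) λ L → Unique L × suc D ≤ length L × (∀ {w} → w ∈ L → root w ≡ c × w ∈ S)} λ c k → k λ c∈ → ⊥-elim
          (bigBall D c (I⊆S c∈) (s≤s (ℕₚ.≤-trans (ℕₚ.m≤m+n D _) (ℕₚ.n≤1+n _))) λ (L , L! , lo , _ , _ , inB) →
            k λ _ → L , L! , lo , λ w∈ → ball⊆cell c∈ (inB w∈) , ball-S (I⊆S c∈) (inB w∈))
        let zs , zs! , lz , hz = pairs-count (suc D) I (λ c w → root w ≡ c × w ∈ S) I! λ {c} → balls c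
            ws = map proj₂ zs
            det : ∀ {p q} → p ∈ zs → q ∈ zs → proj₂ p ≡ proj₂ q → p ≡ q
            det = λ { {c , w} {c′ , w′} p q refl → cong (_, w) (trans (sym (proj₁ (proj₂ (hz p)))) (proj₁ (proj₂ (hz q)))) }
            ls , rs , _ , rs! , e , _ , hr = split-count {B = ⊥} (inj₂ ∘ proj₂) zs zs! λ p q e → det p q (⊎ₚ.inj₂-injective e)
            small = unique-length-≤ {ys = S} rs! λ r∈ → let p , p∈ , fe = hr r∈ in subst (_∈ S) (⊎ₚ.inj₂-injective fe) (proj₂ (proj₂ (hz p∈)))
        λ _ → ℕₚ.<⇒≱ (*-strict c∈ D) (ℕₚ.≤-trans lz (ℕₚ.≤-trans (ℕₚ.≤-reflexive (trans e (cong (_+ length rs) (empty ls)))) (ℕₚ.≤-trans small count)))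
        where
        empty : (ls : List ⊥) → length ls ≡ 0
        empty [] = refl

    contradiction : ∀ {s} → s ∈ S → ¬ ¬ ⊥
    contradiction s∈ = do
      𝕀 ← centres S
      Quotient.contradiction′ 𝕀 (proj₁ (proj₂ (Quotient.cover 𝕀 s∈)))

  shortCore : ∀ h (G : Graph) (S : List V) → let open Graph G in Unique S → ∀ {s} → s ∈ S →
    (∀ {x} → x ∈ S → Σ (List V) λ ys → Unique ys × 3 ≤ length ys × (∀ {y} → y ∈ ys → y ∈ S × A x y)) → ¬ Model h S A →
    ¬ ¬ (Short (λ x y → A x y × x ∈ S × y ∈ S) (shortSize h))
  shortCore h G S S! s∈ deg ¬M none = (do
      A? ← ¬¬-∀Fin λ x → decFin (A x)
      Cells.contradiction (record { G = G ; S = S ; S! = S! ; A? = A? ; deg = deg ; ¬M = ¬M ; none = none }) s∈) id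
    where open Graph G

-- The Erdős–Pósa property for cycles in multigraphs without a complete minor

module Multi {n : ℕ} where
  open Mader {n}
  open ShortCore {n} using (Short; TwoIn; shortCore; shortSize)
  open import Data.List.Membership.DecPropositional (F._≟_ {n}) using (_∈?_)
  private
    V = Fin n

  record Mult : Set where
    field
      M     : V → V → ℕ
      M-sym : ∀ u v → M u v ≡ M v u
      M-irr : ∀ v → M v v ≡ 0

    A : V → V → Set
    A u v = 0 < M u v

    A-sym : ∀ {u v} → A u v → A v u
    A-sym {u} {v} = subst (0 <_) (M-sym u v)

    A-irr : ∀ {v} → ¬ A v v
    A-irr {v} a = ℕₚ.<⇒≢ a (sym (M-irr v))

    graph : Graph
    graph = record { A = A ; A-sym = λ {u} {v} → A-sym {u} {v} ; A-irr = λ {v} → A-irr {v} }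

    Two : (V → Set) → V → Set
    Two C x = (Σ V λ y → C y × 2 ≤ M x y) ⊎ (Σ V λ y → Σ V λ y′ → y ≢ y′ × C y × C y′ × A x y × A x y′)

    Core : (V → Set) → Set
    Core C = Σ V C × (∀ {x} → C x → Two C x)

  two-mono : ∀ (G : Mult) {C C′ : V → Set} → (∀ {x} → C x → C′ x) → ∀ {x} → Mult.Two G C x → Mult.Two G C′ x
  two-mono G f (inj₁ (y , c , h)) = inj₁ (y , f c , h)
  two-mono G f (inj₂ (y , y′ , ne , c , c′ , a , a′)) = inj₂ (y , y′ , ne , f c , f c′ , a , a′)

  -- The linear Erdős-Pósa property with a single `k` that counts the disjoint cores found and also
  -- bounds the hitting set.
  record Result (g : ℕ) (G : Mult) (S : List V) : Set₁ where
    open Mult G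
    field
      k     : ℕ
      C     : Fin k → V → Set
      cores : ∀ i → Core (C i)
      C⊆S   : ∀ i {x} → C i x → x ∈ S
      disj  : ∀ i j {x} → C i x → C j x → i ≡ j
      X     : List V
      X≤    : length X ≤ g * k
      hits  : ∀ D → Core D → (∀ {x} → D x → x ∈ S) → ¬ (∀ {x} → D x → x ∉ X)

  minus : List V → List V → List V
  minus S C = filter (λ x → Relation.Nullary.¬? (x ∈? C)) S

  ∈-minus⁻ : ∀ S C {x} → x ∈ minus S C → x ∈ S × x ∉ C
  ∈-minus⁻ S C p = Mₚ.∈-filter⁻ (λ x → Relation.Nullary.¬? (x ∈? C)) {xs = S} p

  ∈-minus⁺ : ∀ S C {x} → x ∈ S → x ∉ C → x ∈ minus S C
  ∈-minus⁺ S C x∈ x∉ = Mₚ.∈-filter⁺ (λ x → Relation.Nullary.¬? (x ∈? C)) x∈ x∉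

  minus! : ∀ {S} C → Unique S → Unique (minus S C)
  minus! C u = Uₚ.filter⁺ (λ x → Relation.Nullary.¬? (x ∈? C)) u

  minus-< : ∀ {S} C {v N} → Unique S → v ∈ S → v ∈ C → length S ≤ suc N → length (minus S C) ≤ N
  minus-< {S} C {v} u v∈S v∈C h = ℕₚ.≤-pred (ℕₚ.≤-trans (unique-length-≤ {xs = v ∷ minus S C} {ys = S}
      (All.tabulate (λ { p refl → proj₂ (∈-minus⁻ S C p) v∈C }) ∷ minus! C u) λ { (here refl) → v∈S ; (there p) → proj₁ (∈-minus⁻ S C p) }) h)

  model-mono : ∀ {h S S′} {A A′ : V → V → Set} → (∀ {x} → x ∈ S′ → x ∈ S) → (∀ {x y} → x ∈ S′ → y ∈ S′ → A′ x y → A x y) → Model h S′ A′ → Model h S A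
  model-mono {A = A} {A′} f g m = record { B = B ; sub = λ i b → f (sub i b) ; some = some ; disj = disj
      ; conn = λ i a b → restrict {P = B i} (λ r p q → g (sub i p) (sub i q) r) id (conn i a b)
      ; touch = λ i j ne → let x , y , bx , by , a = touch i j ne in x , y , bx , by , g (sub i bx) (sub j by) a }
    where open Model m

  -- A short core pays for itself: it adds one to `k` and at most `g` vertices to `X`.
  removeCore : ∀ {g G S} (C₀ : List V) → Σ V (_∈ C₀) → (∀ {x} → x ∈ C₀ → x ∈ S) → length C₀ ≤ g → (∀ {x} → x ∈ C₀ → Mult.Two G (_∈ C₀) x) →
    Result g G (minus S C₀) → Result g G S
  removeCore {g} {G} {S} C₀ ne C₀⊆ len₀ two₀ r = record
    { k = suc k ; C = λ { zero → _∈ C₀ ; (suc i) → C i } ; cores = λ { zero → ne , two₀ ; (suc i) → cores i }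
    ; C⊆S = λ { zero → C₀⊆ ; (suc i) c → proj₁ (∈-minus⁻ S C₀ (C⊆S i c)) }
    ; disj = λ { zero zero _ _ → refl ; zero (suc j) a b → ⊥-elim (proj₂ (∈-minus⁻ S C₀ (C⊆S j b)) a)
               ; (suc i) zero a b → ⊥-elim (proj₂ (∈-minus⁻ S C₀ (C⊆S i a)) b) ; (suc i) (suc j) a b → cong suc (disj i j a b) }
    ; X = C₀ ++ X ; X≤ = ℕₚ.≤-trans (ℕₚ.≤-reflexive (Lₚ.length-++ C₀)) (ℕₚ.≤-trans (ℕₚ.+-mono-≤ len₀ X≤) (ℕₚ.≤-reflexive (sym (ℕₚ.*-suc g k))))
    ; hits = λ D core D⊆ av → hits D core (λ d → ∈-minus⁺ S C₀ (D⊆ d) λ p → av d (Mₚ.∈-++⁺ˡ p)) λ d p → av d (Mₚ.∈-++⁺ʳ C₀ p) }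
    where open Result r

  removeVertex : ∀ {g G S v} → ¬ Mult.Two G (_∈ S) v → Result g G (minus S (v ∷ [])) → Result g G S
  removeVertex {G = G} {S} {v} low r = record { Result r
    ; C⊆S = λ i c → proj₁ (∈-minus⁻ S (v ∷ []) (C⊆S i c))
    ; hits = λ D core D⊆ → hits D core λ d → ∈-minus⁺ S (v ∷ []) (D⊆ d) λ { (here refl) → low (two-mono G D⊆ (proj₂ core d)) } }
    where open Result r

  -- A vertex v of degree two with neighbours a ≠ b is suppressed: it is replaced by a new edge between a and b.
  module Suppress (G : Mult) (S : List V) (v a b : V) (v∈ : v ∈ S) (a∈ : a ∈ S) (b∈ : b ∈ S) (a≢b : a ≢ b)
    (va : Mult.A G v a) (vb : Mult.A G v b) (only : ∀ {y} → y ∈ S → Mult.A G v y → y ≡ a ⊎ y ≡ b)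
    (noBigon : ∀ {x y} → x ∈ S → y ∈ S → ¬ 2 ≤ Mult.M G x y) where
    open Mult G

    Join : V → V → Set
    Join x y = (x ≡ a × y ≡ b) ⊎ (x ≡ b × y ≡ a)

    Join? : ∀ x y → Dec (Join x y)
    Join? x y = Relation.Nullary._⊎-dec_ (Relation.Nullary._×-dec_ (x F.≟ a) (y F.≟ b)) (Relation.Nullary._×-dec_ (x F.≟ b) (y F.≟ a))

    Join-sym : ∀ {x y} → Join x y → Join y x
    Join-sym (inj₁ (p , q)) = inj₂ (q , p)
    Join-sym (inj₂ (p , q)) = inj₁ (q , p)

    M′ : V → V → ℕ
    M′ x y with Join? x y
    ... | yes _ = suc (M x y)
    ... | no _ = M x y

    M′-yes : ∀ {x y} → Join x y → M′ x y ≡ suc (M x y)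
    M′-yes {x} {y} j with Join? x y
    ... | yes _ = refl
    ... | no ¬j = ⊥-elim (¬j j)

    M′-no : ∀ {x y} → ¬ Join x y → M′ x y ≡ M x y
    M′-no {x} {y} ¬j with Join? x y
    ... | yes j = ⊥-elim (¬j j)
    ... | no _ = refl

    M≤M′ : ∀ x y → M x y ≤ M′ x y
    M≤M′ x y with Join? x y
    ... | yes _ = ℕₚ.n≤1+n _
    ... | no _ = ℕₚ.≤-refl

    G′ : Mult
    G′ = record
      { M = M′
      ; M-sym = λ x y → symm x y (Join? x y)
      ; M-irr = λ x → trans (M′-no λ { (inj₁ (p , q)) → a≢b (trans (sym p) q) ; (inj₂ (p , q)) → a≢b (trans (sym q) p) }) (M-irr x) }
      where
      symm : ∀ x y → Dec (Join x y) → M′ x y ≡ M′ y x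
      symm x y (yes j) = trans (M′-yes j) (trans (cong suc (M-sym x y)) (sym (M′-yes (Join-sym j))))
      symm x y (no ¬j) = trans (M′-no ¬j) (trans (M-sym x y) (sym (M′-no (¬j ∘ Join-sym))))

    module G′ = Mult G′

    A′⇒ : ∀ {x y} → G′.A x y → A x y ⊎ Join x y
    A′⇒ {x} {y} h with Join? x y
    ... | yes j = inj₂ j
    ... | no _ = inj₁ h

    S′ : List V
    S′ = minus S (v ∷ [])

    in-S′ : ∀ {x} → x ∈ S′ → x ∈ S × x ≢ v
    in-S′ p with x∈ , x∉ ← ∈-minus⁻ S (v ∷ []) p = x∈ , λ { refl → x∉ (here refl) }

    -- Up to multiplicities, suppressing `v` is contracting its edge to `a`.
    noModel : ∀ {h} → ¬ Model h S A → ¬ Model h S′ G′.A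
    noModel ¬m m = ¬m (uncontract (λ {x} {y} → A-sym {x} {y}) {S = S} {S′ = S′} {u = a} {v = v} (A-sym {v} {a} va) v∈ (λ p → proj₂ (in-S′ p) refl) (proj₁ ∘ in-S′)
        (model-mono {S = S′} {A = Contracted A a v} id (λ {x} {y} _ _ h → (λ { refl → G′.A-irr {x} h }) , edge (A′⇒ {x} {y} h)) m))
      where
      edge : ∀ {x y} → A x y ⊎ Join x y → A x y ⊎ (x ≡ a × A v y) ⊎ (y ≡ a × A x v)
      edge (inj₁ h) = inj₁ h
      edge (inj₂ (inj₁ (refl , refl))) = inj₂ (inj₁ (refl , vb))
      edge (inj₂ (inj₂ (refl , refl))) = inj₂ (inj₂ (refl , A-sym {v} {b} vb))

    near : ∀ {x y} → Join x y → A x v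
    near (inj₁ (refl , _)) = A-sym {v} {a} va
    near (inj₂ (refl , _)) = A-sym {v} {b} vb

    both : ∀ {D : V → Set} {x y} → Join x y → D x → D y → D a × D b
    both (inj₁ (refl , refl)) p q = p , q
    both (inj₂ (refl , refl)) p q = q , p

    Join-unique : ∀ {x y y′} → Join x y → Join x y′ → y ≡ y′
    Join-unique (inj₁ (refl , refl)) (inj₁ (_ , e)) = sym e
    Join-unique (inj₁ (refl , refl)) (inj₂ (e , _)) = ⊥-elim (a≢b e)
    Join-unique (inj₂ (refl , refl)) (inj₁ (e , _)) = ⊥-elim (a≢b (sym e))
    Join-unique (inj₂ (refl , refl)) (inj₂ (_ , e)) = sym e

    -- `v` is added whenever `a` and `b` are both present, whether or not the new edge is used. As
    -- `a` lies in at most one of the disjoint cores, they stay disjoint.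
    Expand : (V → Set) → V → Set
    Expand D x = D x ⊎ (x ≡ v × D a × D b)

    expand : ∀ {D} → (∀ {x} → D x → x ∈ S′) → G′.Core D → Core (Expand D)
    expand {D} D⊆ ((x₀ , d₀) , two) = (x₀ , inj₁ d₀) , λ { (inj₁ d) → lift d (two d)
        ; (inj₂ (refl , da , db)) → inj₂ (a , b , a≢b , inj₁ da , inj₁ db , va , vb) }
      where
      ≢v : ∀ {y} → D y → y ≢ v
      ≢v d = proj₂ (in-S′ (D⊆ d))
      v∈D : ∀ {x y} → Join x y → D x → D y → Expand D v
      v∈D j dx dy = inj₂ (refl , both {D} j dx dy)
      lift : ∀ {x} → D x → G′.Two D x → Two (Expand D) x
      lift {x} d (inj₁ (y , dy , h)) with Join? x y
      ... | no _ = inj₁ (y , inj₁ dy , h)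
      -- A bigon that uses the new edge becomes a triangle through `v`.
      ... | yes j = inj₂ (y , v , ≢v dy , inj₁ dy , v∈D j d dy , ℕₚ.≤-pred h , near j)
      lift {x} d (inj₂ (y , y′ , ne , dy , dy′ , h , h′)) with A′⇒ {x} {y} h | A′⇒ {x} {y′} h′
      ... | inj₁ p | inj₁ q = inj₂ (y , y′ , ne , inj₁ dy , inj₁ dy′ , p , q)
      ... | inj₁ p | inj₂ j = inj₂ (y , v , ≢v dy , inj₁ dy , v∈D j d dy′ , p , near j)
      ... | inj₂ j | inj₁ q = inj₂ (y′ , v , ≢v dy′ , inj₁ dy′ , v∈D j d dy , q , near j)
      ... | inj₂ j | inj₂ j′ = ⊥-elim (ne (Join-unique j j′))

    shrink : ∀ {D} → (∀ {x} → D x → x ∈ S) → Core D → (∀ x → Dec (D x)) → G′.Core (λ x → D x × x ≢ v)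
    shrink {D} D⊆ (start , two) D? = nonempty (D? v) , λ (d , ne) → lift d ne (two d)
      where
      lift₁ : ∀ {x y} → A x y → G′.A x y
      lift₁ {x} {y} h = ℕₚ.<-≤-trans h (M≤M′ x y)
      ab : D v → D a × D b
      ab dv with two dv
      ... | inj₁ (y , dy , h) = ⊥-elim (noBigon v∈ (D⊆ dy) h)
      ... | inj₂ (y , y′ , ne , dy , dy′ , h , h′) with only (D⊆ dy) h | only (D⊆ dy′) h′
      ...   | inj₁ refl | inj₁ refl = ⊥-elim (ne refl)
      ...   | inj₁ refl | inj₂ refl = dy , dy′
      ...   | inj₂ refl | inj₁ refl = dy′ , dy
      ...   | inj₂ refl | inj₂ refl = ⊥-elim (ne refl)
      a≢v : a ≢ v
      a≢v refl = A-irr {v} va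
      b≢v : b ≢ v
      b≢v refl = A-irr {v} vb
      nonempty : Dec (D v) → Σ V λ x → D x × x ≢ v
      nonempty (yes dv) = a , proj₁ (ab dv) , a≢v
      nonempty (no ¬dv) = proj₁ start , proj₂ start , λ { refl → ¬dv (proj₂ start) }
      D′ : V → Set
      D′ x = D x × x ≢ v
      -- The neighbour v of x is replaced by the other neighbour of v.
      other : ∀ {x} → D x → D v → A x v → Σ V λ y → D′ y × Join x y
      other dx dv h with only (D⊆ dx) (A-sym {_} {v} h)
      ... | inj₁ refl = b , (proj₂ (ab dv) , b≢v) , inj₁ (refl , refl)
      ... | inj₂ refl = a , (proj₁ (ab dv) , a≢v) , inj₂ (refl , refl)
      redirect : ∀ {x y} → D x → D v → A x v → D y → y ≢ v → A x y → G′.Two D′ x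
      redirect {x} {y} dx dv h dy ne hy with other dx dv h
      ... | t , dt , j with t F.≟ y
      ...   | yes refl = inj₁ (t , dt , subst (2 ≤_) (sym (M′-yes j)) (s≤s hy))
      ...   | no t≢y = inj₂ (t , y , t≢y , dt , (dy , ne) , subst (0 <_) (sym (M′-yes j)) (s≤s z≤n) , lift₁ {x} {y} hy)
      lift : ∀ {x} → D x → x ≢ v → Two D x → G′.Two D′ x
      lift d ne (inj₁ (y , dy , h)) = ⊥-elim (noBigon (D⊆ d) (D⊆ dy) h)
      lift {x} d ne (inj₂ (y , y′ , y≢y′ , dy , dy′ , h , h′)) with y F.≟ v | y′ F.≟ v
      ... | yes refl | yes refl = ⊥-elim (y≢y′ refl)
      ... | yes refl | no q = redirect d dy h dy′ q h′
      ... | no p | yes refl = redirect d dy′ h′ dy p h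
      ... | no p | no q = inj₂ (y , y′ , y≢y′ , (dy , p) , (dy′ , q) , lift₁ {x} {y} h , lift₁ {x} {y′} h′)

    result : ∀ {g} → Result g G′ S′ → Result g G S
    result r = record
      { k = k ; C = λ i → Expand (C i) ; cores = λ i → expand (C⊆S i) (cores i)
      ; C⊆S = λ { i (inj₁ c) → proj₁ (in-S′ (C⊆S i c)) ; i (inj₂ (refl , _)) → v∈ }
      ; disj = λ { i j (inj₁ p) (inj₁ q) → disj i j p q ; i j (inj₁ p) (inj₂ (refl , _)) → ⊥-elim (proj₂ (in-S′ (C⊆S i p)) refl)
                 ; i j (inj₂ (refl , _)) (inj₁ q) → ⊥-elim (proj₂ (in-S′ (C⊆S j q)) refl) ; i j (inj₂ (_ , p , _)) (inj₂ (_ , q , _)) → disj i j p q }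
      ; X = X ; X≤ = X≤
      ; hits = λ D core D⊆ av → decFin D λ D? → hits _ (shrink D⊆ core D?) (λ (d , ne) → ∈-minus⁺ S (v ∷ []) (D⊆ d) λ { (here e) → ne e }) λ (d , _) → av d }
      where open Result r

  -- A bigon is a short core, a vertex of degree at most one lies in no core, and a vertex of degree
  -- two is suppressed. If none of these occurs, the minimum degree is three and `shortCore`
  -- applies.
  multiEP : ∀ h N (G : Mult) S → Unique S → length S ≤ N → ¬ Model h S (Mult.A G) → ¬ ¬ Result (shortSize h) G S
  multiEP h N G [] S! len ¬m = pure (record { k = 0 ; C = λ () ; cores = λ () ; C⊆S = λ () ; disj = λ () ; X = [] ; X≤ = z≤n
    ; hits = λ { D ((x , d) , _) D⊆ _ → ∉[] (D⊆ d) } })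
    where
    ∉[] : ∀ {x : V} → x ∈ [] → ⊥
    ∉[] ()
  multiEP h (suc N) G S@(s ∷ _) S! len ¬m = do
      bigon ← em (Σ V λ u → Σ V λ v → u ∈ S × v ∈ S × 2 ≤ M u v)
      low ← em (Σ V λ v → v ∈ S × ¬ Two (_∈ S) v)
      deg2 ← em (Σ V λ v → Σ V λ a → Σ V λ b → v ∈ S × a ∈ S × b ∈ S × a ≢ b × A v a × A v b × (∀ {y} → y ∈ S → A v y → y ≡ a ⊎ y ≡ b))
      cases bigon low deg2
    where
    open Mult G
    fewer : ∀ C → Model h (minus S C) A → ⊥
    fewer C m = ¬m (model-mono (λ p → proj₁ (∈-minus⁻ S C p)) (λ _ _ a → a) m)
    cases : Dec (Σ V λ u → Σ V λ v → u ∈ S × v ∈ S × 2 ≤ M u v) → Dec (Σ V λ v → v ∈ S × ¬ Two (_∈ S) v) →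
      Dec (Σ V λ v → Σ V λ a → Σ V λ b → v ∈ S × a ∈ S × b ∈ S × a ≢ b × A v a × A v b × (∀ {y} → y ∈ S → A v y → y ≡ a ⊎ y ≡ b)) →
      ¬ ¬ Result (shortSize h) G S
    cases (yes (u , v , u∈ , v∈ , m)) _ _ = do
      r ← multiEP h N G (minus S (u ∷ v ∷ [])) (minus! (u ∷ v ∷ []) S!) (minus-< (u ∷ v ∷ []) S! u∈ (here refl) len) (fewer (u ∷ v ∷ []))
      pure (removeCore (u ∷ v ∷ []) (u , here refl) (λ { (here refl) → u∈ ; (there (here refl)) → v∈ }) (s≤s (s≤s z≤n))
        (λ { (here refl) → inj₁ (v , there (here refl) , m) ; (there (here refl)) → inj₁ (u , here refl , subst (2 ≤_) (M-sym u v) m) }) r)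
    cases _ (yes (v , v∈ , ¬two)) _ = do
      r ← multiEP h N G (minus S (v ∷ [])) (minus! (v ∷ []) S!) (minus-< (v ∷ []) S! v∈ (here refl) len) (fewer (v ∷ []))
      pure (removeVertex ¬two r)
    cases (no ¬bigon) _ (yes (v , a , b , v∈ , a∈ , b∈ , a≢b , va , vb , only)) = do
      let noBigon : ∀ {x y} → x ∈ S → y ∈ S → ¬ 2 ≤ M x y
          noBigon = λ x∈ y∈ m → ¬bigon (_ , _ , x∈ , y∈ , m)
          open Suppress G S v a b v∈ a∈ b∈ a≢b va vb only noBigon
      r ← multiEP h N G′ S′ (minus! (v ∷ []) S!) (minus-< (v ∷ []) S! v∈ (here refl) len) (noModel ¬m)
      pure (result r)
    cases (no ¬bigon) (no ¬low) (no ¬deg2) = do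
      degs ← ¬¬-∀Fin {P = λ v → v ∈ S → Σ (List V) λ ys → Unique ys × 3 ≤ length ys × (∀ {y} → y ∈ ys → y ∈ S × A v y)} λ v k → k λ v∈ →
        ⊥-elim (¬low (v , v∈ , λ t → three v∈ t λ r → k λ _ → r))
      C , ne , len′ , two ← shortCore h graph S S! (here refl) (λ {x} → degs x) ¬m
      let in-S : ∀ {x} → x ∈ C → x ∈ S
          in-S = λ {x} x∈ → let _ , _ , _ , _ , _ , (_ , x∈S , _) , _ = two x∈ in x∈S
      r ← multiEP h N G (minus S C) (minus! C S!) (minus-< C S! (in-S (proj₂ ne)) (proj₂ ne) len) (fewer C)
      pure (removeCore C ne in-S len′ (λ x∈ → let y , y′ , y≢ , y∈ , y′∈ , (a , _) , (a′ , _) = two x∈ in inj₂ (y , y′ , y≢ , y∈ , y′∈ , a , a′)) r)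
      where
      three : ∀ {v} → v ∈ S → Two (_∈ S) v → ¬ ¬ (Σ (List V) λ ys → Unique ys × 3 ≤ length ys × (∀ {y} → y ∈ ys → y ∈ S × A v y))
      three {v} v∈ (inj₁ (y , y∈ , m)) _ = ¬bigon (v , y , v∈ , y∈ , m)
      three {v} v∈ (inj₂ (a , b , a≢b , a∈ , b∈ , va , vb)) k = ¬deg2 (v , a , b , v∈ , a∈ , b∈ , a≢b , va , vb , λ {y} y∈ vy → choose y y∈ vy (y F.≟ a) (y F.≟ b))
        where
        choose : ∀ y → y ∈ S → A v y → Dec (y ≡ a) → Dec (y ≡ b) → y ≡ a ⊎ y ≡ b
        choose y y∈ vy (yes e) _ = inj₁ e
        choose y y∈ vy _ (yes e) = inj₂ e
        choose y y∈ vy (no p) (no q) = ⊥-elim (k (y ∷ a ∷ b ∷ [] , (p ∷ q ∷ []) ∷ (a≢b ∷ []) ∷ [] ∷ [] , s≤s (s≤s (s≤s z≤n))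
          , λ { (here refl) → y∈ , vy ; (there (here refl)) → a∈ , va ; (there (there (here refl))) → b∈ , vb }))

open import Defs

-- Cycles as sequences

module Extract {n : ℕ} (R : Fin n → Fin n → Set) where
  open import Data.List.Membership.DecPropositional (F._≟_ {n}) using (_∈?_)

  record ClosedPath (j : ℕ) (S : Fin n → Set) : Set where
    field
      h : Fin n
      t : List (Fin n)
      unique : Unique (h ∷ t)
      linked : Linked R (h ∷ t)
      long   : j < length (h ∷ t)
      inside : ∀ {x} → x ∈ h ∷ t → S x
      closing : R (L.lookup (h ∷ t) (F.fromℕ (length t))) h

  -- Cutting at the repeated vertex `x` leaves more than `j` vertices because `x` is not among the
  -- first `j`.
  upTo : ∀ j h t {x} → Linked R (h ∷ t) → Unique (h ∷ t) → x ∈ h ∷ t → x ∉ L.take j (h ∷ t) →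
    Σ (List (Fin n)) λ t′ → Unique (h ∷ t′) × Linked R (h ∷ t′) × j < length (h ∷ t′) × (∀ {y} → y ∈ h ∷ t′ → y ∈ h ∷ t) ×
      L.lookup (h ∷ t′) (F.fromℕ (length t′)) ≡ x
  upTo zero h t l u (here refl) _ = [] , [] ∷ [] , [-] , s≤s z≤n , (λ { (here e) → here e ; (there ()) }) , refl
  upTo (suc j) h t l u (here refl) x∉ = ⊥-elim (x∉ (here refl))
  upTo j h (h₂ ∷ t₂) (r ∷ l) (h∉ ∷ u) (there p) x∉ with upTo (ℕ.pred j) h₂ t₂ l u p (shift j x∉)
    where
    shift : ∀ j {x} → x ∉ L.take j (h ∷ h₂ ∷ t₂) → x ∉ L.take (ℕ.pred j) (h₂ ∷ t₂)
    shift zero x∉ = λ ()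
    shift (suc j) x∉ = x∉ ∘ there
  ... | t′ , u′ , l′ , lt , sub , e = h₂ ∷ t′ , All.tabulate (λ q eq → All.lookup h∉ (sub q) eq) ∷ u′ , r ∷ l′ , grow j lt
      , (λ { (here e) → here e ; (there q) → there (sub q) }) , e
    where
    grow : ∀ j {m} → ℕ.pred j < m → j < suc m
    grow zero lt = s≤s z≤n
    grow (suc j) lt = s≤s lt

  module _ {j : ℕ} {S D : Fin n → Set} {Done : Set}
    (next : ∀ h t → S h → Linked R (h ∷ t) → Done ⊎ Σ (Fin n) λ x → S x × R x h × x ∉ L.take j (h ∷ t)) where

    -- The path grows at its head until a vertex repeats, as it must after `n` steps. `Done` lets
    -- the undirected case stop at a bigon.
    extend : ∀ fuel h t → Unique (h ∷ t) → Linked R (h ∷ t) → (∀ {x} → x ∈ h ∷ t → S x) → n < fuel + length (h ∷ t) → Done ⊎ ClosedPath j S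
    extend zero h t u l s lt = ⊥-elim (ℕₚ.<⇒≱ lt (subst (length (h ∷ t) ≤_) (Lₚ.length-tabulate id) (unique-length-≤ u λ {x} _ → Mₚ.∈-allFin x)))
    extend (suc fuel) h t u l s lt with next h t (s (here refl)) l
    ... | inj₁ d = inj₁ d
    ... | inj₂ (x , sx , r , x∉) with x ∈? (h ∷ t)
    ...   | no x∉ht = extend fuel x (h ∷ t) (All.tabulate (λ { p refl → x∉ht p }) ∷ u) (r ∷ l) (λ { (here refl) → sx ; (there p) → s p })
            (subst (n <_) (sym (ℕₚ.+-suc fuel (length (h ∷ t)))) lt)
    ...   | yes x∈ with t′ , u′ , l′ , lt′ , sub , e ← upTo j h t l u x∈ x∉ = inj₂ (record
            { h = h ; t = t′ ; unique = u′ ; linked = l′ ; long = lt′ ; inside = s ∘ sub ; closing = subst (λ y → R y h) (sym e) r })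

    extract : Σ (Fin n) S → Done ⊎ ClosedPath j S
    extract (x , sx) = extend n x [] ([] ∷ []) [-] (λ { (here refl) → sx ; (there ()) }) (subst (n <_) (ℕₚ.+-comm 1 n) ℕₚ.≤-refl)

  linked-lookup : ∀ h t → Linked R (h ∷ t) → ∀ i → R (L.lookup (h ∷ t) (F.inject₁ i)) (L.lookup (h ∷ t) (suc i))
  linked-lookup h (_ ∷ t) (r ∷ l) zero = r
  linked-lookup h (h₂ ∷ t) (r ∷ l) (suc i) = linked-lookup h₂ t l i

Closed : ∀ {n m} (R : Fin n → Fin n → Set) → (Fin (suc m) → Fin n) → Set
Closed {m = m} R σ = (∀ {i j} → σ i ≡ σ j → i ≡ j) × (∀ i → R (σ (F.inject₁ i)) (σ (suc i))) × R (σ (F.fromℕ m)) (σ zero)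

module _ {n : ℕ} {A : Fin n → Fin n → Set} (A-sym : ∀ {x y} → A x y → A y x) {m} (σ : Fin (suc m) → Fin n)
  (steps : ∀ i → A (σ (F.inject₁ i)) (σ (suc i))) where

  connected : ∀ {x y} → x ∈ L.tabulate σ → y ∈ L.tabulate σ → Star (λ u v → A u v × u ∈ L.tabulate σ × v ∈ L.tabulate σ) x y
  connected x∈ y∈ with Mₚ.∈-tabulate⁻ {f = σ} x∈ | Mₚ.∈-tabulate⁻ {f = σ} y∈
  ... | i , refl | j , refl = Fᵢ.<-weakInduction (λ i → Star B (σ i) (σ zero)) ε (λ i w → (A-sym (steps i) , in-σ (suc i) , in-σ (F.inject₁ i)) ◅ w) i
      ◅◅ Fᵢ.<-weakInduction (λ i → Star B (σ zero) (σ i)) ε (λ i w → w ◅◅ (steps i , in-σ (F.inject₁ i) , in-σ (suc i)) ◅ ε) j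
    where
    B : Fin n → Fin n → Set
    B u v = A u v × u ∈ L.tabulate σ × v ∈ L.tabulate σ
    in-σ : ∀ i → σ i ∈ L.tabulate σ
    in-σ = Mₚ.∈-tabulate⁺

module Directed {n : ℕ} (D : Digraph n) where
  Arc : Fin n → Fin n → Set
  Arc u v = 0 < arc D u v

  -- The core theorem is applied to the reversed digraph, so that paths grow at their head.
  Rev : Fin n → Fin n → Set
  Rev u v = Arc v u

  irr : ∀ {v} → ¬ Arc v v
  irr {v} a = ℕₚ.<⇒≢ a (sym (loopless D v))

  system : CycleSystem n
  system = record
    { Adj = SimpleGraph.Adj (underlying D)
    ; Cycle = λ c → Σ ℕ λ m → Σ (Fin (suc (suc m)) → Fin n) λ σ → c ≡ L.tabulate σ × Closed Arc σ
    ; cycle-unique = λ { (m , σ , refl , inj , _) → Uₚ.tabulate⁺ inj }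
    ; cycle-length = λ { (m , σ , refl , _) → s≤s (s≤s z≤n) }
    ; cycle-connected = λ { (m , σ , refl , _ , steps , _) x∈ y∈ → connected (SimpleGraph.adj-sym (underlying D)) σ (λ i → inj₁ (steps i)) x∈ y∈ } }

  open CycleSystem system using (Cyclic; Cycle)

  toDiCycle : ∀ {S} → Cyclic S → DiCycleIn D S
  toDiCycle (_ , (m , σ , refl , inj , steps , cl) , h) = m , σ , inj , (λ i → h (Mₚ.∈-tabulate⁺ {f = σ} i)) , steps , cl

  fromDiCycle : ∀ {S} → DiCycleIn D S → Cyclic S
  fromDiCycle {S} (m , σ , inj , s , steps , cl) = L.tabulate σ , (m , σ , refl , inj , steps , cl) , in-S
    where
    in-S : ∀ {x} → x ∈ L.tabulate σ → S x
    in-S p with i , refl ← Mₚ.∈-tabulate⁻ {f = σ} p = s i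

  closed⇒Cyc : ∀ {c} → Cycle c → Cyc Rev (_∈ c)
  closed⇒Cyc (m , σ , refl , _ , steps , cl) = (σ zero , Mₚ.∈-tabulate⁺ {f = σ} zero) , λ {x} p → pred p
    where
    pred : ∀ {x} → x ∈ L.tabulate σ → Σ (Fin n) λ y → Rev x y × y ∈ L.tabulate σ
    pred p with Mₚ.∈-tabulate⁻ {f = σ} p
    ... | zero , refl = _ , cl , Mₚ.∈-tabulate⁺ {f = σ} (F.fromℕ (suc m))
    ... | suc i , refl = _ , steps i , Mₚ.∈-tabulate⁺ {f = σ} (F.inject₁ i)

  Cyc⇒cyclic : ∀ {S} → Cyc Rev S → Cyclic S
  Cyc⇒cyclic {S} (start , s) with Extract.extract Arc {j = 1} {S} {S} {⊥}
      (λ h t sh _ → inj₂ (pred h t (s sh))) start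
    where
    pred : ∀ h t → Σ (Fin n) (λ y → Rev h y × S y) → Σ (Fin n) λ x → S x × Arc x h × x ∉ L.take 1 (h ∷ t)
    pred h t (y , a , sy) = y , sy , a , λ { (here refl) → irr a ; (there ()) }
  ... | inj₂ p = build (Extract.ClosedPath.h p) (Extract.ClosedPath.t p) (Extract.ClosedPath.unique p) (Extract.ClosedPath.linked p)
        (Extract.ClosedPath.long p) (Extract.ClosedPath.inside p) (Extract.ClosedPath.closing p)
    where
    build : ∀ h t → Unique (h ∷ t) → Linked Arc (h ∷ t) → 1 < length (h ∷ t) → (∀ {x} → x ∈ h ∷ t → S x) →
      Arc (L.lookup (h ∷ t) (F.fromℕ (length t))) h → Cyclic S
    build h [] u l (s≤s ()) ins c
    build h (b ∷ t) u l lt ins c = h ∷ b ∷ t , (length t , L.lookup (h ∷ b ∷ t) , sym (Lₚ.tabulate-lookup (h ∷ b ∷ t))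
      , (λ {i} {j} → lookup-injective u i j) , Extract.linked-lookup Arc h (b ∷ t) l , c) , ins

module Undirected {n : ℕ} (G : Multigraph n) where
  M : Multi.Mult {n}
  M = record { M = mult G ; M-sym = mult-sym G ; M-irr = mult-loop G }
  open Multi.Mult M using (A; A-sym; A-irr; Core; Two)

  system : CycleSystem n
  system = record
    { Adj = SimpleGraph.Adj (simplification G)
    ; Cycle = λ c → (Σ (Fin n) λ u → Σ (Fin n) λ v → c ≡ u ∷ v ∷ [] × 2 ≤ mult G u v)
                  ⊎ (Σ ℕ λ m → Σ (Fin (suc (suc (suc m))) → Fin n) λ σ → c ≡ L.tabulate σ × Closed A σ)
    ; cycle-unique = λ { (inj₁ (u , v , refl , h)) → ((λ { refl → A-irr {u} (ℕₚ.≤-trans (s≤s z≤n) h) }) ∷ []) ∷ [] ∷ [] ; (inj₂ (m , σ , refl , inj , _)) → Uₚ.tabulate⁺ inj }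
    ; cycle-length = λ { (inj₁ (u , v , refl , h)) → ℕₚ.≤-refl ; (inj₂ (m , σ , refl , _)) → s≤s (s≤s z≤n) }
    ; cycle-connected = λ { (inj₁ (u , v , refl , h)) x∈ y∈ → connected (λ {x} {y} → A-sym {x} {y}) {m = 1} (L.lookup (u ∷ v ∷ [])) (λ { zero → ℕₚ.≤-trans (s≤s z≤n) h }) x∈ y∈
                          ; (inj₂ (m , σ , refl , _ , steps , _)) x∈ y∈ → connected (λ {x} {y} → A-sym {x} {y}) σ steps x∈ y∈ } }

  open CycleSystem system using (Cyclic; Cycle)

  toCycle : ∀ {S} → Cyclic S → CycleIn G S
  toCycle (_ , inj₁ (u , v , refl , m) , h) = inj₁ (u , v , h (here refl) , h (there (here refl)) , m)
  toCycle (_ , inj₂ (m , σ , refl , inj , steps , cl) , h) = inj₂ (m , σ , inj , (λ i → h (Mₚ.∈-tabulate⁺ {f = σ} i)) , steps , cl)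

  fromCycle : ∀ {S} → CycleIn G S → Cyclic S
  fromCycle (inj₁ (u , v , su , sv , m)) = u ∷ v ∷ [] , inj₁ (u , v , refl , m) , λ { (here refl) → su ; (there (here refl)) → sv }
  fromCycle {S} (inj₂ (m , σ , inj , s , steps , cl)) = L.tabulate σ , inj₂ (m , σ , refl , inj , steps , cl) , in-S
    where
    in-S : ∀ {x} → x ∈ L.tabulate σ → S x
    in-S p with i , refl ← Mₚ.∈-tabulate⁻ {f = σ} p = s i

  cycle⇒Core : ∀ {c} → Cycle c → Core (_∈ c)
  cycle⇒Core (inj₁ (u , v , refl , m)) = (u , here refl) , λ { (here refl) → inj₁ (v , there (here refl) , m)
    ; (there (here refl)) → inj₁ (u , here refl , subst (2 ≤_) (mult-sym G u v) m) }
  cycle⇒Core (inj₂ (m , σ , refl , inj , steps , cl)) = (σ zero , in-σ zero) , λ {x} p → two p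
    where
    in-σ : ∀ i → σ i ∈ L.tabulate σ
    in-σ = Mₚ.∈-tabulate⁺
    two : ∀ {x} → x ∈ L.tabulate σ → Two (_∈ L.tabulate σ) x
    two p with Mₚ.∈-tabulate⁻ {f = σ} p
    ... | zero , refl = inj₂ (_ , _ , (λ e → case (cong toℕ (inj e))) , in-σ (suc zero) , in-σ (F.fromℕ (suc (suc m))) , steps zero , A-sym {σ (F.fromℕ (suc (suc m)))} cl)
      where
      case : 1 ≡ suc (suc (toℕ (F.fromℕ m))) → ⊥
      case ()
    ... | suc i , refl with view i
    ...   | ‵fromℕ = inj₂ (_ , _ , (λ e → case (inj e)) , in-σ (F.inject₁ (F.fromℕ (suc m))) , in-σ zero , A-sym {σ (F.inject₁ (F.fromℕ (suc m)))} (steps (F.fromℕ (suc m))) , cl)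
      where
      case : F.inject₁ (F.fromℕ (suc m)) ≡ zero → ⊥
      case ()
    ...   | ‵inject₁ k = inj₂ (_ , _ , (λ e → case (cong toℕ (inj e))) , in-σ (F.inject₁ (F.inject₁ k)) , in-σ (suc (suc k))
            , A-sym {σ (F.inject₁ (F.inject₁ k))} (steps (F.inject₁ k)) , steps (suc k))
      where
      case : toℕ (F.inject₁ (F.inject₁ k)) ≡ suc (suc (toℕ k)) → ⊥
      case e = ℕₚ.<⇒≢ (ℕₚ.m≤n⇒m≤1+n ℕₚ.≤-refl) (trans (sym (trans (Fₚ.toℕ-inject₁ (F.inject₁ k)) (Fₚ.toℕ-inject₁ k))) e)

  -- One of two distinct neighbours differs from the vertex just left, so with `j = 2` the closed
  -- path has at least three vertices.
  Core⇒cyclic : ∀ {S} → Core S → Cyclic S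
  Core⇒cyclic {S} (start , two) with Extract.extract A {j = 2} {S} {S} {Σ (Fin n) λ u → Σ (Fin n) λ v → S u × S v × 2 ≤ mult G u v} next start
    where
    fresh : ∀ {h y y′} t → y ≢ y′ → S y → S y′ → A h y → A h y′ → Σ (Fin n) λ x → S x × A x h × x ∉ L.take 2 (h ∷ t)
    fresh {h} {y} [] ne sy sy′ a a′ = y , sy , A-sym {h} {y} a , λ { (here refl) → A-irr {h} a ; (there ()) }
    fresh {h} {y} {y′} (q ∷ t) ne sy sy′ a a′ with y F.≟ q
    ... | no y≢q = y , sy , A-sym {h} {y} a , λ { (here refl) → A-irr {h} a ; (there (here e)) → y≢q e ; (there (there ())) }
    ... | yes refl = y′ , sy′ , A-sym {h} {y′} a′ , λ { (here refl) → A-irr {h} a′ ; (there (here e)) → ne (sym e) ; (there (there ())) }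
    next : ∀ h t → S h → Linked A (h ∷ t) → (Σ (Fin n) λ u → Σ (Fin n) λ v → S u × S v × 2 ≤ mult G u v) ⊎ Σ (Fin n) λ x → S x × A x h × x ∉ L.take 2 (h ∷ t)
    next h t sh _ with two sh
    ... | inj₁ (y , sy , m) = inj₁ (h , y , sh , sy , m)
    ... | inj₂ (y , y′ , ne , sy , sy′ , a , a′) = inj₂ (fresh t ne sy sy′ a a′)
  ... | inj₁ (u , v , su , sv , m) = u ∷ v ∷ [] , inj₁ (u , v , refl , m) , λ { (here refl) → su ; (there (here refl)) → sv }
  ... | inj₂ p = build (Extract.ClosedPath.h p) (Extract.ClosedPath.t p) (Extract.ClosedPath.unique p) (Extract.ClosedPath.linked p)
        (Extract.ClosedPath.long p) (Extract.ClosedPath.inside p) (Extract.ClosedPath.closing p)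
    where
    build : ∀ h t → Unique (h ∷ t) → Linked A (h ∷ t) → 2 < length (h ∷ t) → (∀ {x} → x ∈ h ∷ t → S x) →
      A (L.lookup (h ∷ t) (F.fromℕ (length t))) h → Cyclic S
    build h [] u l (s≤s ()) ins c
    build h (_ ∷ []) u l (s≤s (s≤s ())) ins c
    build h (b ∷ d ∷ t) u l lt ins c = h ∷ b ∷ d ∷ t , inj₂ (length t , L.lookup (h ∷ b ∷ d ∷ t) , sym (Lₚ.tabulate-lookup (h ∷ b ∷ d ∷ t))
      , (λ {i} {j} → lookup-injective u i j) , Extract.linked-lookup A h (b ∷ d ∷ t) l , c) , ins

-- Minor-closed classes

complete : ∀ h → SimpleGraph h
complete h = record { Adj = _≢_ ; adj-sym = λ ne e → ne (sym e) ; irrefl = λ ne → ne refl }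

module Excluded (𝒢 : GraphClass) (closed : MinorClosed 𝒢) {h} (H : SimpleGraph h) (¬𝒢H : ¬ 𝒢 h H) where

  -- Every graph on `h` vertices is a minor of the complete one.
  ¬𝒢K : ¬ 𝒢 h (complete h)
  ¬𝒢K g = ¬𝒢H (closed H (complete h) (record
    { β = just ; nonempty = λ i → i , refl
    ; connected = λ { i u v refl e → subst (WalkIn (complete h) (λ w → just w ≡ just i) i) (sym (just-injective e)) (here refl) }
    ; edges = λ i j a → i , j , refl , refl , λ { refl → SimpleGraph.irrefl H a } }) g)

  noModel : ∀ {N} (Γ : SimpleGraph N) → 𝒢 N Γ → ¬ Model h (allFin N) (Adj Γ)
  noModel {N} Γ g M = go id
    where
    open Model M
    go : ¬ ¬ ⊥
    go = do
      B? ← decFin λ u → Σ (Fin h) λ i → B i u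
      let label : ∀ {u} → Dec (Σ (Fin h) λ i → B i u) → Maybe (Fin h)
          label = λ { (yes (i , _)) → just i ; (no _) → nothing }
          label-just : ∀ {u} (d : Dec (Σ (Fin h) λ i → B i u)) i → label d ≡ just i → B i u
          label-just = λ { (yes (_ , b)) i refl → b }
          just-label : ∀ {u} (d : Dec (Σ (Fin h) λ i → B i u)) i → B i u → label d ≡ just i
          just-label = λ { (yes (j , b′)) i b → cong just (disj j i b′ b) ; (no ¬p) i b → ⊥-elim (¬p (i , b)) }
          walk : ∀ i {u v} (w : Star (Adj Γ) u v) → (∀ {z} → on w z → B i z) → WalkIn Γ (λ w → label (B? w) ≡ just i) u v
          walk = walkOf λ i b → just-label (B? _) i b
      pure (¬𝒢K (closed (complete h) Γ (record
        { β = λ u → label (B? u) ; nonempty = λ i → let u , b = some i in u , just-label (B? u) i b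
        ; connected = λ i u v eu ev → let w , hw = conn i (label-just (B? u) i eu) (label-just (B? v) i ev) in walk i w hw
        ; edges = λ i j ne → let x , y , bx , by , a = touch i j ne in x , y , just-label (B? x) i bx , just-label (B? y) j by , a }) g))
      where
      walkOf : ∀ {Q : Fin h → Fin N → Set} → (∀ i {u} → B i u → Q i u) → ∀ i {u v} (w : Star (Adj Γ) u v) → (∀ {z} → on w z → B i z) → WalkIn Γ (Q i) u v
      walkOf f i ε hw = WalkIn.here (f i (hw refl))
      walkOf f i (a ◅ w) hw = step (f i (hw (inj₁ refl))) a (walkOf f i w (hw ∘ inj₂))

  -- Contracting the given disjoint cycles gives a graph of the class; an independent set in it is a family of non-adjacent cycles.
  module Contract {n} (Γ : SimpleGraph n) (g : 𝒢 n Γ) (𝒞 : CycleSystem n)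
    (adj : ∀ {x y} → CycleSystem.Adj 𝒞 x y → Adj Γ x y)
    {N} (c : Fin N → List (Fin n)) (isCycle : ∀ i → CycleSystem.Cycle 𝒞 (c i)) (apart : ∀ i j {x} → x ∈ c i → x ∈ c j → i ≡ j) where
    open import Data.List.Membership.DecPropositional (F._≟_ {n}) using (_∈?_)
    open CycleSystem 𝒞 using (CompleteColoring)

    quotient : SimpleGraph N
    quotient = record
      { Adj = λ i j → i ≢ j × Σ (Fin n) λ x → Σ (Fin n) λ y → x ∈ c i × y ∈ c j × Adj Γ x y
      ; adj-sym = λ (ne , x , y , x∈ , y∈ , a) → (λ e → ne (sym e)) , y , x , y∈ , x∈ , adj-sym Γ a
      ; irrefl = λ (ne , _) → ne refl }

    label : ∀ {u} → Dec (Σ (Fin N) λ i → u ∈ c i) → Maybe (Fin N)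
    label (yes (i , _)) = just i
    label (no _) = nothing

    owner : Fin n → Maybe (Fin N)
    owner u = label (Fₚ.any? λ i → u ∈? c i)

    owner-just : ∀ {u i} → owner u ≡ just i → u ∈ c i
    owner-just {u} e with Fₚ.any? (λ i → u ∈? c i)
    owner-just refl | yes (_ , u∈) = u∈

    just-owner : ∀ {u i} → u ∈ c i → owner u ≡ just i
    just-owner {u} {i} u∈ with Fₚ.any? (λ i → u ∈? c i)
    ... | yes (j , u∈j) = cong just (apart j i u∈j u∈)
    ... | no ¬p = ⊥-elim (¬p (i , u∈))

    minor : 𝒢 N quotient
    minor = closed quotient Γ (record
      { β = owner ; nonempty = λ i → let u , u∈ = member (c i) (CycleSystem.cycle-length 𝒞 (isCycle i)) in u , just-owner u∈
      ; connected = λ i u v eu ev → walk (owner-just ev) (CycleSystem.cycle-connected 𝒞 (isCycle i) (owner-just eu) (owner-just ev))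
      ; edges = λ { i j (_ , x , y , x∈ , y∈ , a) → x , y , just-owner x∈ , just-owner y∈ , a } }) g
      where
      member : ∀ (l : List (Fin n)) → 2 ≤ length l → Σ (Fin n) (_∈ l)
      member (x ∷ _) _ = x , here refl
      walk : ∀ {i u v} → v ∈ c i → Star (λ u v → CycleSystem.Adj 𝒞 u v × u ∈ c i × v ∈ c i) u v → WalkIn Γ (λ w → owner w ≡ just i) u v
      walk v∈ ε = WalkIn.here (just-owner v∈)
      walk v∈ ((a , u∈ , _) ◅ w) = step (just-owner u∈) (adj a) (walk v∈ w)

    colors : ∀ q → 2 ≤ q → suc (density h) * (q * q) ≤ N → ¬ ¬ (Σ ℕ λ K → q ≤ K × CompleteColoring K)
    colors q 2≤q large = do
      I , I! , _ , ind , size ← Mader.independent {D = density h} graph (λ S S! → Mader.mader h (length S) graph S S! ℕₚ.≤-refl λ M → noModel quotient minor (everywhere M))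
        (length (allFin N)) (allFin N) (Uₚ.allFin⁺ N) ℕₚ.≤-refl
      let large′ : q * q ≤ length I
          large′ = ℕₚ.*-cancelˡ-≤ (suc (density h)) (ℕₚ.≤-trans large (subst (_≤ suc (density h) * length I) (Lₚ.length-tabulate id) size))
          sel : Fin (q * q) → Fin N
          sel p = L.lookup I (F.inject≤ p large′)
          sel! : ∀ p p′ → sel p ≡ sel p′ → p ≡ p′
          sel! = λ p p′ e → Fₚ.inject≤-injective large′ large′ p p′ (lookup-injective I! _ _ e)
          nonAdj : ∀ p p′ {x y} → x ∈ c (sel p) → y ∈ c (sel p′) → CycleSystem.Adj 𝒞 x y → Dec (sel p ≡ sel p′) → p ≡ p′
          nonAdj = λ { p p′ x∈ y∈ a (yes e) → sel! p p′ e
                     ; p p′ x∈ y∈ a (no ne) → ⊥-elim (ind (Mₚ.∈-lookup (F.inject≤ p large′)) (Mₚ.∈-lookup (F.inject≤ p′ large′)) (ne , _ , _ , x∈ , y∈ , adj a)) }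
      Coloring.manyColors 𝒞 q 2≤q (c ∘ sel) (λ p → isCycle (sel p)) (λ p p′ x∈ x∈′ → sel! p p′ (apart _ _ x∈ x∈′))
        (λ p p′ x∈ y∈ a → nonAdj p p′ x∈ y∈ a (sel p F.≟ sel p′))
      where
      graph : Mader.Graph {N}
      graph = record { A = Adj quotient ; A-sym = adj-sym quotient ; A-irr = irrefl quotient }
      everywhere : ∀ {S} → Model h S (Adj quotient) → Model h (allFin N) (Adj quotient)
      everywhere M = record { Model M ; sub = λ i {x} _ → Mₚ.∈-allFin x }

-- Hitting sets as subsets, and the final bounds

fromList : ∀ {n} → List (Fin n) → Subset n
fromList [] = ∅
fromList (x ∷ xs) = ⁅ x ⁆ ∪ fromList xs

fromList⁺ : ∀ {n} {xs : List (Fin n)} {x} → x ∈ xs → x ∈ˢ fromList xs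
fromList⁺ (here refl) = Subₚ.x∈p∪q⁺ (inj₁ (Subₚ.x∈⁅x⁆ _))
fromList⁺ {xs = y ∷ xs} (there p) = Subₚ.x∈p∪q⁺ {p = ⁅ y ⁆} (inj₂ (fromList⁺ p))

∣⁅x⁆∪p∣≤ : ∀ {n} (x : Fin n) (p : Subset n) → ∣ ⁅ x ⁆ ∪ p ∣ ≤ suc ∣ p ∣
∣⁅x⁆∪p∣≤ {suc n} zero (true ∷ p) = s≤s (ℕₚ.≤-trans (ℕₚ.≤-reflexive (cong ∣_∣ (Subₚ.∪-identityˡ p))) (ℕₚ.n≤1+n _))
∣⁅x⁆∪p∣≤ {suc n} zero (false ∷ p) = s≤s (ℕₚ.≤-reflexive (cong ∣_∣ (Subₚ.∪-identityˡ p)))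
∣⁅x⁆∪p∣≤ (suc x) (true ∷ p) = s≤s (∣⁅x⁆∪p∣≤ x p)
∣⁅x⁆∪p∣≤ (suc x) (false ∷ p) = ∣⁅x⁆∪p∣≤ x p

∣fromList∣≤ : ∀ {n} (xs : List (Fin n)) → ∣ fromList xs ∣ ≤ length xs
∣fromList∣≤ {n} [] = ℕₚ.≤-reflexive (Subₚ.∣⊥∣≡0 n)
∣fromList∣≤ (x ∷ xs) = ℕₚ.≤-trans (∣⁅x⁆∪p∣≤ x (fromList xs)) (s≤s (∣fromList∣≤ xs))

-- Enough disjoint cycles to force `2 + a` colours, which is more than `a` and at least the two
-- required by `manyColors`. The factor `suc (density h)` pays for the independent set.
colorSize : ℕ → ℕ → ℕ
colorSize h a = suc (density h) * ((2 + a) * (2 + a))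

-- The 4 comes from `2 + a ≤ a + a`, valid once `a` is at least 2, squared. The value of `shortSize`
-- is the same for every number of vertices, so `{0}` is as good as any.
arborealConstant : ℕ → ℕ
arborealConstant h = ShortCore.shortSize {0} h * (suc (density h) * 4)

module Bounds (𝒢 : GraphClass) (closed : MinorClosed 𝒢) {h} (H : SimpleGraph h) (¬𝒢H : ¬ 𝒢 h H) where
  open Excluded 𝒢 closed H ¬𝒢H

  tooMany : ∀ {K a} → 2 + a ≤ K → ¬ K ≤ a
  tooMany le le′ = ℕₚ.<⇒≱ (ℕₚ.<-≤-trans (ℕₚ.m≤n⇒m≤1+n ℕₚ.≤-refl) le) le′

  digraphs : ∀ n (D : Digraph n) (a t : ℕ) → 𝒢 n (underlying D) → IsAdi D a → IsTauD D t → t ≤ proj₁ (erdősPósa (colorSize h a))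
  digraphs n D a t g (_ , maximal) (_ , minimal) = Relation.Nullary.decidable-stable (t ℕₚ.≤? proj₁ (erdősPósa (colorSize h a))) do
      packing ← em (Packing Rev (colorSize h a))
      decide packing
    where
    open Directed D
    Goal = t ≤ proj₁ (erdősPósa (colorSize h a))
    decide : Dec (Packing Rev (colorSize h a)) → ¬ ¬ Goal
    decide (no ¬p) = do
      X , X≤ , hits ← proj₂ (erdősPósa (colorSize h a)) Rev ¬p
      pure (ℕₚ.≤-trans (minimal (fromList X) λ d → let c , z , av = fromDiCycle {_∉ˢ fromList X} d in hits (_∈ c) (closed⇒Cyc z) λ x∈ p → av x∈ (fromList⁺ p))
        (ℕₚ.≤-trans (∣fromList∣≤ X) X≤))
    decide (yes (S , cyc , disj)) = do
      let cycle : ∀ i → CycleSystem.Cyclic system (S i)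
          cycle i = Cyc⇒cyclic (cyc i)
      K , K≥ , col ← Contract.colors (underlying D) g system id (λ i → proj₁ (cycle i)) (λ i → proj₁ (proj₂ (cycle i)))
        (λ i j x y → disj i j (proj₂ (proj₂ (cycle i)) x) (proj₂ (proj₂ (cycle j)) y)) (2 + a) (s≤s (s≤s z≤n)) ℕₚ.≤-refl
      let open CycleSystem.CompleteColoring col renaming (complete to compl)
      ⊥-elim (tooMany K≥ (maximal K (record { color = color ; onto = onto ; acyclic = λ i d → acyclic i (fromDiCycle d)
        ; complete = λ i j ne → toDiCycle (compl i j ne) })))

  fewCycles : ∀ n (G : Multigraph n) (a t : ℕ) → 𝒢 n (simplification G) → IsAva G a → IsTauG G t → t ≤ ShortCore.shortSize {0} h * colorSize h a
  fewCycles n G a t g (_ , maximal) (_ , minimal) = Relation.Nullary.decidable-stable (t ℕₚ.≤? ShortCore.shortSize {0} h * colorSize h a) do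
      r ← Multi.multiEP h (length (allFin n)) M (allFin n) (Uₚ.allFin⁺ n) ℕₚ.≤-refl (noModel (simplification G) g)
      large ← em (colorSize h a ≤ Multi.Result.k r)
      decide r large
    where
    open Undirected G
    decide : (r : Multi.Result (ShortCore.shortSize {n} h) M (allFin n)) → Dec (colorSize h a ≤ Multi.Result.k r) → ¬ ¬ (t ≤ ShortCore.shortSize {0} h * colorSize h a)
    decide r (no small) = pure (ℕₚ.≤-trans (minimal (fromList X) λ d → let c , z , av = fromCycle {_∉ˢ fromList X} d in
          hits (_∈ c) (cycle⇒Core z) (λ {x} _ → Mₚ.∈-allFin x) λ x∈ p → av x∈ (fromList⁺ p))
        (ℕₚ.≤-trans (∣fromList∣≤ X) (ℕₚ.≤-trans X≤ (ℕₚ.*-monoʳ-≤ (ShortCore.shortSize {n} h) (ℕₚ.<⇒≤ (ℕₚ.≰⇒> small))))))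
      where open Multi.Result r
    decide r (yes large) = do
      let cycle : ∀ i → CycleSystem.Cyclic system (Multi.Result.C r i)
          cycle i = Core⇒cyclic (Multi.Result.cores r i)
      K , K≥ , col ← Contract.colors (simplification G) g system id (λ i → proj₁ (cycle i)) (λ i → proj₁ (proj₂ (cycle i)))
        (λ i j x y → Multi.Result.disj r i j (proj₂ (proj₂ (cycle i)) x) (proj₂ (proj₂ (cycle j)) y)) (2 + a) (s≤s (s≤s z≤n)) large
      let open CycleSystem.CompleteColoring col renaming (complete to compl)
      ⊥-elim (tooMany K≥ (maximal K (record { color = color ; onto = onto ; forest = λ i d → acyclic i (fromCycle d)
        ; complete = λ i j ne → toCycle (compl i j ne) })))

  -- With at most one colour class the graph is a forest; otherwise the logarithm is at least 1.
  graphs : ∀ n (G : Multigraph n) (a t : ℕ) → 𝒢 n (simplification G) → IsAva G a → IsTauG G t → t ≤ arborealConstant h * (a ^ 2) * ⌊log₂ a ⌋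
  graphs n G zero t g (col , _) (_ , minimal) = ℕₚ.≤-trans (minimal ∅ noCycle) (ℕₚ.≤-trans (ℕₚ.≤-reflexive (Subₚ.∣⊥∣≡0 n)) z≤n)
    where
    noCycle : ∀ {S} → ¬ CycleIn G S
    noCycle (inj₁ (u , _)) = Fₚ.¬Fin0 (CompleteArborealColoring.color col u)
    noCycle (inj₂ (_ , σ , _)) = Fₚ.¬Fin0 (CompleteArborealColoring.color col (σ zero))
  graphs n G (suc zero) t g (col , _) (_ , minimal) = ℕₚ.≤-trans (minimal ∅ noCycle) (ℕₚ.≤-trans (ℕₚ.≤-reflexive (Subₚ.∣⊥∣≡0 n)) z≤n)
    where
    open CompleteArborealColoring col
    one : ∀ v → color v ≡ zero
    one v with color v
    ... | zero = refl
    noCycle : ∀ {S} → ¬ CycleIn G S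
    noCycle (inj₁ (u , v , _ , _ , m)) = forest zero (inj₁ (u , v , one u , one v , m))
    noCycle (inj₂ (m , σ , inj , _ , steps , cl)) = forest zero (inj₂ (m , σ , inj , (λ i → one (σ i)) , steps , cl))
  graphs n G a@(suc (suc b)) t g ava tau = ℕₚ.≤-trans (fewCycles n G a t g ava tau)
      (ℕₚ.≤-trans (ℕₚ.≤-trans (ℕₚ.*-monoʳ-≤ s (ℕₚ.*-monoʳ-≤ d (ℕₚ.*-mono-≤ 2+a≤ 2+a≤))) (ℕₚ.≤-reflexive quadratic))
        (ℕₚ.≤-trans (ℕₚ.≤-reflexive (sym (ℕₚ.*-identityʳ _))) (ℕₚ.*-monoʳ-≤ (arborealConstant h * (a ^ 2)) (⌊log₂⌋-mono-≤ {2} {a} (s≤s (s≤s z≤n))))))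
    where
    open import Data.Nat.Solver using (module +-*-Solver)
    open +-*-Solver
    s = ShortCore.shortSize {0} h
    d = suc (density h)
    2+a≤ : 2 + a ≤ a + a
    2+a≤ = ℕₚ.+-monoˡ-≤ a (s≤s (s≤s z≤n))
    quadratic : s * (d * ((a + a) * (a + a))) ≡ s * (d * 4) * (a ^ 2)
    quadratic = solve 3 (λ s d a → s :* (d :* ((a :+ a) :* (a :+ a))) := s :* (d :* con 4) :* (a :* (a :* con 1))) refl s d a

theorem3p7 : (𝒢 : GraphClass) → MinorClosed 𝒢 → Proper 𝒢 →
    (Σ (ℕ → ℕ) λ f → (∀ n (D : Digraph n) (a t : ℕ) →
    𝒢 n (underlying D) → IsAdi D a → IsTauD D t → t ≤ f a))
    ×
    (Σ ℕ λ C → (0 < C × (∀ n (G : Multigraph n) (a t : ℕ) →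
    𝒢 n (simplification G) → IsAva G a → IsTauG G t →
    t ≤ C * (a ^ 2) * ⌊log₂ a ⌋)))
theorem3p7 𝒢 closed (h , H , ¬𝒢H) = ((λ a → proj₁ (erdősPósa (colorSize h a))) , digraphs) , (arborealConstant h , s≤s z≤n , graphs)
  where open Bounds 𝒢 closed H ¬𝒢H
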